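{- Let $C_3\in(0,1)$ be the absolute constant fixed in the context and let $\nu:=-\log_3(C_3)>0$. (i) For every $\epsilon>0$ there exists $N=N(\epsilon)$ such that for all positive integers $n,\ell$ with $n\ge N$, $\ell\geq N$ and $n-\ell\geq N$, every prime $p>\frac{4n}{\epsilon}$, and every set $A=\{v_1,\dots,v_n\}$ of $n$ distinct elements of $\mathbb{Z}_p$, if $X$ is chosen uniformly at random among the subsets of $A$ of size $\ell$, then $$\max_{x\in \mathbb{Z}_p} \mathbb{P}\Big[\sum_{v\in X} v=x\Big]\leq\frac{\epsilon}{n}.$$ (ii) In particular, if $\epsilon=2\left(\frac{3}{\ell_0}\right)^{\nu}$ for a positive integer $\ell_0$, then the same conclusion $\max_{x\in \mathbb{Z}_p} \mathbb{P}[\sum_{v\in X} v=x]\leq\frac{\epsilon}{n}$ holds whenever $\ell>\ell_0$, $n-\ell>\ell_0$, $p$ is a prime with $p>n^2$, and $n$ is sufficiently large with respect to $\ell_0$.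
   Context: $\mathbb{Z}_p$ is the cyclic group of prime order $p$. The constant $C_3\in(0,1)$ is a fixed absolute constant having the following property: for every real $0<\lambda\leq\frac{9}{10}$, every prime $p>\frac{2}{\lambda}$, and all i.i.d. $\mathbb{Z}_p$-valued random variables $Y_1,Y_2,Y_3$ with $\max_{x\in\mathbb{Z}_p}\mathbb{P}[Y_1=x]\leq\lambda$, one has $\max_{x\in\mathbb{Z}_p}\mathbb{P}[Y_1+Y_2+Y_3=x]\leq C_3\lambda$. (The existence of such a constant is a separate result and may be assumed.) -}

module Defs where

open import Data.Nat as ℕ using (ℕ; zero; suc; NonZero; _⊔_)
import Data.Nat.Properties as ℕ
open import Data.Nat.DivMod using (_mod_)
open import Data.Nat.Primality using (Prime)
open import Data.Integer using (+_; _⊖_)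
open import Data.Rational as ℚ using (ℚ; 0ℚ; 1ℚ; ½; _/_)
import Data.Rational.Properties as ℚ
open import Data.Rational.Solver using (module +-*-Solver)
open import Data.Fin as Fin using (Fin; toℕ)
open import Data.Fin.Subset using (Subset; inside; outside; ∣_∣)
open import Data.Fin.Subset.Properties using (_∈?_; _⊆?_)
open import Data.Bool using (if_then_else_)
open import Data.List as List using (List; _++_; filter; length; allFin)
open import Data.Vec using ([]; _∷_)
import Data.Vec.Functional as Functional
open import Data.Product using (∃; _×_; _,_)
open import Relation.Nullary using (does)
open import Relation.Nullary.Decidable using (_×-dec_)
open import Relation.Unary using (Pred; Decidable)
open import Relation.Binary.PropositionalEquality using (_≡_; refl; cong; subst)
open import Level using (0ℓ)

-- Real numbers are Cauchy sequences of rationals, identified up to _≈ᴿ_.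
-- The relations compare limits, so all operations can be taken termwise.

IsCauchy : (ℕ → ℚ) → Set
IsCauchy x = ∀ ε → 0ℚ ℚ.< ε →
  ∃ λ N → ∀ m n → N ℕ.≤ m → N ℕ.≤ n → ℚ.∣ x m ℚ.- x n ∣ ℚ.≤ ε

record ℝ : Set where
  constructor mkℝ
  field
    seq    : ℕ → ℚ
    cauchy : IsCauchy seq

open ℝ public

infix 4 _≤ᴿ_ _<ᴿ_ _≈ᴿ_

_≤ᴿ_ : ℝ → ℝ → Set
x ≤ᴿ y = ∀ ε → 0ℚ ℚ.< ε → ∃ λ N → ∀ n → N ℕ.≤ n → seq x n ℚ.≤ seq y n ℚ.+ ε

_<ᴿ_ : ℝ → ℝ → Set
x <ᴿ y = ∃ λ ε → 0ℚ ℚ.< ε × ∃ λ N → ∀ n → N ℕ.≤ n → seq x n ℚ.+ ε ℚ.≤ seq y n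

_≈ᴿ_ : ℝ → ℝ → Set
x ≈ᴿ y = x ≤ᴿ y × y ≤ᴿ x

private
  open module Reasoning = ℚ.≤-Reasoning
  open module Solver = +-*-Solver

abstract

  half : ∀ {ε} → 0ℚ ℚ.< ε → 0ℚ ℚ.< ½ ℚ.* ε
  half {ε} 0<ε = ℚ.positive⁻¹ (½ ℚ.* ε) {{ℚ.pos*pos⇒pos ½ ε {{ℚ.positive 0<ε}}}}

  const-cauchy : ∀ q → IsCauchy (λ _ → q)
  const-cauchy q ε 0<ε = 0 , λ _ _ _ _ → begin
    ℚ.∣ q ℚ.- q ∣  ≡⟨ cong ℚ.∣_∣ (ℚ.+-inverseʳ q) ⟩
    0ℚ             <⟨ 0<ε ⟩
    ε              ∎

  +-cauchy : ∀ x y → IsCauchy x → IsCauchy y → IsCauchy (λ n → x n ℚ.+ y n)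
  +-cauchy x y cx cy ε 0<ε =
    let M , hx = cx (½ ℚ.* ε) (half 0<ε)
        N , hy = cy (½ ℚ.* ε) (half 0<ε)
    in M ⊔ N , λ m n m≥ n≥ → begin
      ℚ.∣ (x m ℚ.+ y m) ℚ.- (x n ℚ.+ y n) ∣
        ≡⟨ cong ℚ.∣_∣ (solve 4 (λ a b c d → (a :+ b) :- (c :+ d) := (a :- c) :+ (b :- d))
                         refl (x m) (y m) (x n) (y n)) ⟩
      ℚ.∣ (x m ℚ.- x n) ℚ.+ (y m ℚ.- y n) ∣
        ≤⟨ ℚ.∣p+q∣≤∣p∣+∣q∣ (x m ℚ.- x n) (y m ℚ.- y n) ⟩
      ℚ.∣ x m ℚ.- x n ∣ ℚ.+ ℚ.∣ y m ℚ.- y n ∣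
        ≤⟨ ℚ.+-mono-≤ (hx m n (ℕ.m⊔n≤o⇒m≤o M N m≥) (ℕ.m⊔n≤o⇒m≤o M N n≥))
                      (hy m n (ℕ.m⊔n≤o⇒n≤o M N m≥) (ℕ.m⊔n≤o⇒n≤o M N n≥)) ⟩
      ½ ℚ.* ε ℚ.+ ½ ℚ.* ε
        ≡⟨ solve 1 (λ e → con ½ :* e :+ con ½ :* e := e) refl ε ⟩
      ε ∎

  neg-cauchy : ∀ x → IsCauchy x → IsCauchy (λ n → ℚ.- x n)
  neg-cauchy x cx ε 0<ε =
    let N , hx = cx ε 0<ε
    in N , λ m n m≥ n≥ → begin
      ℚ.∣ ℚ.- x m ℚ.- ℚ.- x n ∣
        ≡⟨ cong ℚ.∣_∣ (solve 2 (λ a b → :- a :- :- b := b :- a) refl (x m) (x n)) ⟩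
      ℚ.∣ x n ℚ.- x m ∣
        ≤⟨ hx n m n≥ m≥ ⟩
      ε ∎

  eventually-bounded : ∀ (x : ℕ → ℚ) → IsCauchy x →
    ∃ λ B → 0ℚ ℚ.< B × ∃ λ N → ∀ n → N ℕ.≤ n → ℚ.∣ x n ∣ ℚ.≤ B
  eventually-bounded x cx =
    let N , hx = cx 1ℚ (ℚ.positive⁻¹ 1ℚ)
    in 1ℚ ℚ.+ ℚ.∣ x N ∣
       , ℚ.positive⁻¹ (1ℚ ℚ.+ ℚ.∣ x N ∣)
           {{ℚ.pos+nonNeg⇒pos 1ℚ ℚ.∣ x N ∣ {{ℚ.∣-∣-nonNeg (x N)}}}}
       , N , λ n n≥ → begin
         ℚ.∣ x n ∣
           ≡⟨ cong ℚ.∣_∣ (solve 2 (λ a b → a := (a :- b) :+ b) refl (x n) (x N)) ⟩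
         ℚ.∣ (x n ℚ.- x N) ℚ.+ x N ∣
           ≤⟨ ℚ.∣p+q∣≤∣p∣+∣q∣ (x n ℚ.- x N) (x N) ⟩
         ℚ.∣ x n ℚ.- x N ∣ ℚ.+ ℚ.∣ x N ∣
           ≤⟨ ℚ.+-monoˡ-≤ ℚ.∣ x N ∣ (hx n N n≥ ℕ.≤-refl) ⟩
         1ℚ ℚ.+ ℚ.∣ x N ∣ ∎

  *-mono-∣∣ : ∀ p q {B δ} → ℚ.∣ p ∣ ℚ.≤ B → ℚ.∣ q ∣ ℚ.≤ δ → 0ℚ ℚ.< B →
              ℚ.∣ p ℚ.* q ∣ ℚ.≤ B ℚ.* δ
  *-mono-∣∣ p q {B} {δ} p≤B q≤δ 0<B = begin
    ℚ.∣ p ℚ.* q ∣          ≡⟨ ℚ.∣p*q∣≡∣p∣*∣q∣ p q ⟩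
    ℚ.∣ p ∣ ℚ.* ℚ.∣ q ∣    ≤⟨ ℚ.*-monoʳ-≤-nonNeg ℚ.∣ q ∣ {{ℚ.∣-∣-nonNeg q}} p≤B ⟩
    B ℚ.* ℚ.∣ q ∣          ≤⟨ ℚ.*-monoˡ-≤-nonNeg B {{ℚ.pos⇒nonNeg B {{ℚ.positive 0<B}}}} q≤δ ⟩
    B ℚ.* δ                ∎

  divide : ∀ {D ε} → 0ℚ ℚ.< D → 0ℚ ℚ.< ε → ∃ λ δ → 0ℚ ℚ.< δ × D ℚ.* δ ≡ ε
  divide {D} {ε} 0<D 0<ε = D⁻¹ ℚ.* ε
    , ℚ.positive⁻¹ (D⁻¹ ℚ.* ε)
        {{ℚ.pos*pos⇒pos D⁻¹ {{ℚ.1/pos⇒pos D {{ℚ.positive 0<D}}}} ε {{ℚ.positive 0<ε}}}}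
    , (begin-equality
      D ℚ.* (D⁻¹ ℚ.* ε)    ≡⟨ ℚ.*-assoc D D⁻¹ ε ⟨
      (D ℚ.* D⁻¹) ℚ.* ε    ≡⟨ cong (ℚ._* ε) (ℚ.*-inverseʳ D {{D≢0}}) ⟩
      1ℚ ℚ.* ε             ≡⟨ ℚ.*-identityˡ ε ⟩
      ε                    ∎)
    where
    D≢0 : ℚ.NonZero D
    D≢0 = ℚ.pos⇒nonZero D {{ℚ.positive 0<D}}
    D⁻¹ : ℚ
    D⁻¹ = (ℚ.1/ D) {{D≢0}}

  *-close : ∀ (x y : ℕ → ℚ) {B C δ M₁ M₂ N₁ N₂} → 0ℚ ℚ.< B → 0ℚ ℚ.< C →
    (∀ n → M₁ ℕ.≤ n → ℚ.∣ x n ∣ ℚ.≤ B) → (∀ n → M₂ ℕ.≤ n → ℚ.∣ y n ∣ ℚ.≤ C) →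
    (∀ m n → N₁ ℕ.≤ m → N₁ ℕ.≤ n → ℚ.∣ x m ℚ.- x n ∣ ℚ.≤ δ) →
    (∀ m n → N₂ ℕ.≤ m → N₂ ℕ.≤ n → ℚ.∣ y m ℚ.- y n ∣ ℚ.≤ δ) →
    ∀ m n → M₁ ⊔ M₂ ⊔ (N₁ ⊔ N₂) ℕ.≤ m → M₁ ⊔ M₂ ⊔ (N₁ ⊔ N₂) ℕ.≤ n →
    ℚ.∣ x m ℚ.* y m ℚ.- x n ℚ.* y n ∣ ℚ.≤ (B ℚ.+ C) ℚ.* δ
  *-close x y {B} {C} {δ} {M₁} {M₂} {N₁} {N₂} 0<B 0<C bx by hx hy m n m≥ n≥ = begin
    ℚ.∣ x m ℚ.* y m ℚ.- x n ℚ.* y n ∣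
      ≡⟨ cong ℚ.∣_∣ (solve 4 (λ a b c d → a :* b :- c :* d := a :* (b :- d) :+ d :* (a :- c))
                       refl (x m) (y m) (x n) (y n)) ⟩
    ℚ.∣ x m ℚ.* (y m ℚ.- y n) ℚ.+ y n ℚ.* (x m ℚ.- x n) ∣
      ≤⟨ ℚ.∣p+q∣≤∣p∣+∣q∣ (x m ℚ.* (y m ℚ.- y n)) (y n ℚ.* (x m ℚ.- x n)) ⟩
    ℚ.∣ x m ℚ.* (y m ℚ.- y n) ∣ ℚ.+ ℚ.∣ y n ℚ.* (x m ℚ.- x n) ∣
      ≤⟨ ℚ.+-mono-≤
           (*-mono-∣∣ (x m) (y m ℚ.- y n) (bx m (ℕ.m⊔n≤o⇒m≤o M₁ M₂ m≥M))
             (hy m n (ℕ.m⊔n≤o⇒n≤o N₁ N₂ m≥N) (ℕ.m⊔n≤o⇒n≤o N₁ N₂ n≥N)) 0<B)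
           (*-mono-∣∣ (y n) (x m ℚ.- x n) (by n (ℕ.m⊔n≤o⇒n≤o M₁ M₂ n≥M))
             (hx m n (ℕ.m⊔n≤o⇒m≤o N₁ N₂ m≥N) (ℕ.m⊔n≤o⇒m≤o N₁ N₂ n≥N)) 0<C) ⟩
    B ℚ.* δ ℚ.+ C ℚ.* δ
      ≡⟨ ℚ.*-distribʳ-+ δ B C ⟨
    (B ℚ.+ C) ℚ.* δ ∎
    where
    m≥M : M₁ ⊔ M₂ ℕ.≤ m
    m≥M = ℕ.m⊔n≤o⇒m≤o (M₁ ⊔ M₂) (N₁ ⊔ N₂) m≥
    m≥N : N₁ ⊔ N₂ ℕ.≤ m
    m≥N = ℕ.m⊔n≤o⇒n≤o (M₁ ⊔ M₂) (N₁ ⊔ N₂) m≥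
    n≥M : M₁ ⊔ M₂ ℕ.≤ n
    n≥M = ℕ.m⊔n≤o⇒m≤o (M₁ ⊔ M₂) (N₁ ⊔ N₂) n≥
    n≥N : N₁ ⊔ N₂ ℕ.≤ n
    n≥N = ℕ.m⊔n≤o⇒n≤o (M₁ ⊔ M₂) (N₁ ⊔ N₂) n≥

  *-cauchy : ∀ x y → IsCauchy x → IsCauchy y → IsCauchy (λ n → x n ℚ.* y n)
  *-cauchy x y cx cy ε 0<ε =
    let B , 0<B , M₁ , bx = eventually-bounded x cx
        C , 0<C , M₂ , by = eventually-bounded y cy
        δ , 0<δ , [B+C]δ≡ε = divide (ℚ.+-mono-< 0<B 0<C) 0<ε
        N₁ , hx = cx δ 0<δ
        N₂ , hy = cy δ 0<δ
    in M₁ ⊔ M₂ ⊔ (N₁ ⊔ N₂) , λ m n m≥ n≥ →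
       subst (ℚ.∣ x m ℚ.* y m ℚ.- x n ℚ.* y n ∣ ℚ.≤_) [B+C]δ≡ε
         (*-close x y {B} {C} {δ} {M₁} {M₂} {N₁} {N₂} 0<B 0<C bx by hx hy m n m≥ n≥)

fromℚ : ℚ → ℝ
fromℚ q = mkℝ (λ _ → q) (const-cauchy q)

fromℕ : ℕ → ℝ
fromℕ n = fromℚ (+ n / 1)

infixl 6 _+ᴿ_
infixl 7 _*ᴿ_
infix  8 -ᴿ_
infixr 9 _^ᴿ_

_+ᴿ_ : ℝ → ℝ → ℝ
x +ᴿ y = mkℝ (λ n → seq x n ℚ.+ seq y n) (+-cauchy (seq x) (seq y) (cauchy x) (cauchy y))

_*ᴿ_ : ℝ → ℝ → ℝ
x *ᴿ y = mkℝ (λ n → seq x n ℚ.* seq y n) (*-cauchy (seq x) (seq y) (cauchy x) (cauchy y))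

-ᴿ_ : ℝ → ℝ
-ᴿ x = mkℝ (λ n → ℚ.- seq x n) (neg-cauchy (seq x) (cauchy x))

_^ᴿ_ : ℝ → ℕ → ℝ
x ^ᴿ zero  = fromℕ 1
x ^ᴿ suc n = x *ᴿ x ^ᴿ n

_/ᴿ_ : ℝ → (n : ℕ) → .{{NonZero n}} → ℝ
x /ᴿ n = x *ᴿ fromℚ (+ 1 / n)

sumᴿ : ∀ {n} → (Fin n → ℝ) → ℝ
sumᴿ = Functional.foldr _+ᴿ_ (fromℕ 0)

-- IsPower a x y says that y = aˣ, for real a > 0 and real x.  The power
-- is pinned down by monotonicity in the exponent: for every rational
-- r = (m - k) / b, the numbers y and aʳ compare as x and r do (in the
-- reverse order if a ≤ 1).  Comparing y with aʳ amounts to comparing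
-- aᵏ yᵇ with aᵐ, which involves natural exponents only.

record IsPower (a x y : ℝ) : Set where
  field
    base-positive  : fromℕ 0 <ᴿ a
    value-positive : fromℕ 0 <ᴿ y
    above : ∀ m k b .{{_ : NonZero b}} → fromℚ ((m ⊖ k) / b) <ᴿ x →
            (fromℕ 1 ≤ᴿ a → a ^ᴿ m ≤ᴿ a ^ᴿ k *ᴿ y ^ᴿ b) ×
            (a ≤ᴿ fromℕ 1 → a ^ᴿ k *ᴿ y ^ᴿ b ≤ᴿ a ^ᴿ m)
    below : ∀ m k b .{{_ : NonZero b}} → x <ᴿ fromℚ ((m ⊖ k) / b) →
            (fromℕ 1 ≤ᴿ a → a ^ᴿ k *ᴿ y ^ᴿ b ≤ᴿ a ^ᴿ m) ×
            (a ≤ᴿ fromℕ 1 → a ^ᴿ m ≤ᴿ a ^ᴿ k *ᴿ y ^ᴿ b)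

-- IsLog a y t says that t = logₐ y, for a ≠ 1.
IsLog : (a y t : ℝ) → Set
IsLog a y t = IsPower a t y

-- ℤ/p is represented by the residues Fin p.

module _ {p : ℕ} .{{_ : NonZero p}} where

  infixl 6 _⊕_

  _⊕_ : Fin p → Fin p → Fin p
  a ⊕ b = (toℕ a ℕ.+ toℕ b) mod p

  elementSum : Subset p → Fin p
  elementSum X = List.foldr _⊕_ (0 mod p) (filter (_∈? X) (allFin p))

IsDistribution : ∀ {p} → (Fin p → ℝ) → Set
IsDistribution μ = (∀ a → fromℕ 0 ≤ᴿ μ a) × (sumᴿ μ ≈ᴿ fromℕ 1)

-- ℙ[Y₁ + Y₂ + Y₃ = x] for independent Y₁, Y₂, Y₃ with law μ.
threefoldSumProb : ∀ {p} .{{_ : NonZero p}} → (Fin p → ℝ) → Fin p → ℝ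
threefoldSumProb μ x =
  sumᴿ λ a → sumᴿ λ b → sumᴿ λ c →
    if does (a ⊕ b ⊕ c Fin.≟ x)
    then μ a *ᴿ μ b *ᴿ μ c
    else fromℕ 0

ratio : ℕ → ℕ → ℚ
ratio k zero    = 0ℚ
ratio k (suc n) = + k / suc n

-- The probability of an event for the uniform choice of an entry of a
-- list, with value 0 if the list is empty.
uniformProb : {A : Set} {E : Pred A 0ℓ} → List A → Decidable E → ℚ
uniformProb xs E? = ratio (length (filter E? xs)) (length xs)

allSubsets : ∀ n → List (Subset n)
allSubsets zero    = [] List.∷ List.[]
allSubsets (suc n) = List.map (inside ∷_) (allSubsets n) ++ List.map (outside ∷_) (allSubsets n)

subsetsOfSize : ∀ {p} → Subset p → ℕ → List (Subset p)
subsetsOfSize {p} A ℓ = filter (λ X → (X ⊆? A) ×-dec (∣ X ∣ ℕ.≟ ℓ)) (allSubsets p)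

-- ℙ[Σ_{v ∈ X} v = x] for X uniform among the ℓ-element subsets of A.
subsetSumProb : ∀ {p} .{{_ : NonZero p}} → Subset p → ℕ → Fin p → ℝ
subsetSumProb A ℓ x = fromℚ (uniformProb (subsetsOfSize A ℓ) (λ X → elementSum X Fin.≟ x))

-- As λ > 0, the condition p > 2/λ is written 2 < p λ; a bound on a
-- maximum over ℤ/p is a bound at every point.

ThreefoldContraction : ℝ → Set
ThreefoldContraction C₃ =
  ∀ (lam : ℝ) → fromℕ 0 <ᴿ lam → lam ≤ᴿ fromℚ (+ 9 / 10) →
  ∀ (p : ℕ) .{{_ : NonZero p}} → Prime p → fromℕ 2 <ᴿ fromℕ p *ᴿ lam →
  ∀ (μ : Fin p → ℝ) → IsDistribution μ → (∀ x → μ x ≤ᴿ lam) →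
  ∀ x → threefoldSumProb μ x ≤ᴿ C₃ *ᴿ lam

{-# OPTIONS --safe #-}
module Submission where

-- Put k = 3ᵐ.  For a family of M distinct elements of ℤ/p, the sum of k
-- independent uniform entries is obtained by m-fold repetition of Y ↦ Y₁ + Y₂ + Y₃,
-- so if M ≥ n/2 the contraction hypothesis bounds its point probabilities by
-- C₃ᵐ · 2/n, as long as n < p C₃ʲ for all j < m.  Sampling k entries without
-- replacement costs only a factor (D + 1)/D once M is large.  A uniform
-- ℓ-subset with ℓ ≥ k is sampled by revealing ℓ - k of its elements first: the
-- remaining k are uniform in a family of size n - ℓ + k, which is at least n/2
-- after passing to the complement if necessary.
--
-- For (i), take the least m with 3 C₃ᵐ ≤ ε.  For (ii), take 3ᵐ ≤ ℓ₀ < 3ᵐ⁺¹: then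
-- C₃ᵐ = (3/3ᵐ⁺¹)^ν is strictly below (3/ℓ₀)^ν, which leaves room for the factor
-- (D + 1)/D and for replacing C₃ and ν by rationals.

open import Defs
open import Data.Nat as ℕ using (ℕ; zero; suc; NonZero; _+_; _*_; _^_; _∸_; _%_; _!; _≤_; _<_; z≤n; s≤s; z<s; s<s)
import Data.Nat.Properties as ℕ
import Data.Nat.DivMod as ℕ
open import Data.Nat.DivMod using (_mod_)
open import Data.Nat.Combinatorics using (_C_; nC1≡n; nCk+nC[k+1]≡[n+1]C[k+1]; k>n⇒nCk≡0; nCk≡nC[n∸k])
open import Data.Nat.Primality using (Prime)
open import Data.Nat.Tactic.RingSolver using (solve-∀)
open import Data.Integer as ℤ using (+_; _⊖_)
import Data.Integer.Properties as ℤ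
open import Data.Rational as ℚ using (ℚ; mkℚ; 0ℚ; 1ℚ; ½; _/_; toℚᵘ)
import Data.Rational.Properties as ℚ
open import Data.Rational.Solver using (module +-*-Solver)
open import Data.Rational.Unnormalised as ℚᵘ using (mkℚᵘ; *≡*; *≤*)
import Data.Rational.Unnormalised.Properties as ℚᵘ
open import Data.Fin as Fin using (Fin; toℕ; punchIn)
import Data.Fin.Properties as Fin
open import Data.Fin.Subset using (Subset; inside; outside; ∣_∣)
open import Data.Fin.Subset.Properties using (_∈?_; _⊆?_)
open import Data.Bool using (Bool; true; false; _∧_; if_then_else_)
open import Data.Bool.Properties using (∧-zeroʳ)
open import Data.Empty using (⊥)
open import Data.List as List using (List; filter; length; allFin; map; _++_)
import Data.List.Properties as List
open import Data.Vec using ([]; _∷_)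
open import Data.Vec.Functional using (Vector; head; tail)
open import Data.Product using (Σ; ∃; ∃₂; _,_; _×_; proj₁; proj₂)
open import Data.Sum using (_⊎_; inj₁; inj₂)
open import Function using (_∘_; const; id; Injective)
open import Level using (0ℓ)
open import Relation.Nullary using (yes; no; Dec; does; ¬_; contradiction)
open import Relation.Nullary.Decidable using (_×-dec_; toWitnessFalse)
open import Relation.Unary using (Pred; Decidable)
open import Relation.Binary.PropositionalEquality
open import Algebra using (module CommutativeRing)
open import Algebra.Properties.CommutativeSemiring.Exp
  (CommutativeRing.commutativeSemiring ℚ.+-*-commutativeRing)
  using () renaming (_^_ to _^ℚ_; ^-homo-* to ^ℚ-+; ^-assocʳ to ^ℚ-*; ^-distrib-* to ^ℚ-distrib-*)
import Algebra.Properties.Semiring.Sum ℕ.+-*-semiring as Σℕ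
import Algebra.Properties.Semiring.Sum (CommutativeRing.semiring ℚ.+-*-commutativeRing) as Σℚ

open Σℕ using (sum; sum-syntax; sum-cong-≗; sum-replicate-zero; ∑-distrib-+; ∑-comm; *-distribˡ-sum)
open +-*-Solver using (solve; _:=_; _:+_; _:*_; _:-_; :-_; con)

-- Reals are Cauchy sequences, so C₃ and ε cannot be compared by decision. Counting is therefore
-- done in ℕ, cross-multiplied, and a rational c that eventually bounds C₃ takes its place; real
-- inequalities appear only at the two ends. In (i) the factor 3 is 2 · 3/2: the 2 comes from a
-- family of at least n/2 elements, and 3/2 is (D + 1)/D at D = 2. With a rational r such that r ≤ ε
-- ≤ 4r/3, minimality of m keeps the earlier powers above r/3 ≥ ε/4, which is why p > 4n/ε suffices
-- for p cʲ > n. In (ii) the constant in ε is exactly that 2, so the factor (D + 1)/D has to be paid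
-- for by ℓ₀ < 3ᵐ⁺¹. Powers with exponent ν are known only by comparison with rational exponents, so
-- this slack must be expressed by integers: enclosing ν between u/b and (u + 5)/b costs a bounded
-- factor after taking b-th powers, whereas (R/(R - 1))ᵘ with R = 3ᵐ⁺¹ is unbounded in u.

-- Binomial coefficients and Bernoulli estimates

sum-mono-≤ : ∀ {n} {f g : Fin n → ℕ} → (∀ i → f i ≤ g i) → sum f ≤ sum g
sum-mono-≤ {zero}  f≤g = z≤n
sum-mono-≤ {suc n} f≤g = ℕ.+-mono-≤ (f≤g Fin.zero) (sum-mono-≤ (f≤g ∘ Fin.suc))

sum-const : ∀ n c → sum {n} (const c) ≡ n * c
sum-const zero    c = refl
sum-const (suc n) c = cong (c ℕ.+_) (sum-const n c)

-- Both sides count a (k+1)-subset together with one of its members; the proof is Pascal's rule. It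
-- is the normalising counterpart of `selections-remove`.
C-absorption : ∀ n k → suc k * (suc n C suc k) ≡ suc n * (n C k)
C-absorption n zero = begin
  1 * (suc n C 1)  ≡⟨ ℕ.*-identityˡ _ ⟩
  suc n C 1        ≡⟨ nC1≡n (suc n) ⟩
  suc n            ≡⟨ ℕ.*-identityʳ (suc n) ⟨
  suc n * (n C 0)  ∎
  where open ≡-Reasoning
C-absorption zero (suc k) = begin
  suc (suc k) * (1 C suc (suc k))  ≡⟨ cong (suc (suc k) *_) (k>n⇒nCk≡0 {1} {suc (suc k)} (s<s z<s)) ⟩
  suc (suc k) * 0                  ≡⟨ ℕ.*-zeroʳ (suc (suc k)) ⟩
  0                                ≡⟨ cong (1 *_) (k>n⇒nCk≡0 {0} {suc k} z<s) ⟨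
  1 * (0 C suc k)                  ∎
  where open ≡-Reasoning
C-absorption (suc n) (suc k) = begin
  suc (suc k) * (suc (suc n) C suc (suc k))
    ≡⟨ cong (suc (suc k) *_) (nCk+nC[k+1]≡[n+1]C[k+1] (suc n) (suc k)) ⟨
  suc (suc k) * (C₁ + suc n C suc (suc k))
    ≡⟨ expand (suc k) C₁ _ ⟩
  C₁ + (suc k * C₁ + suc (suc k) * (suc n C suc (suc k)))
    ≡⟨ cong (C₁ ℕ.+_) (cong₂ _+_ (C-absorption n k) (C-absorption n (suc k))) ⟩
  C₁ + (suc n * (n C k) + suc n * (n C suc k))
    ≡⟨ cong (C₁ ℕ.+_) (ℕ.*-distribˡ-+ (suc n) (n C k) _) ⟨
  C₁ + suc n * (n C k + n C suc k)
    ≡⟨ cong (λ c → C₁ + suc n * c) (nCk+nC[k+1]≡[n+1]C[k+1] n k) ⟩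
  C₁ + suc n * C₁ ∎
  where
  open ≡-Reasoning
  C₁ = suc n C suc k
  expand : ∀ k x y → suc k * (x + y) ≡ x + (k * x + suc k * y)
  expand = solve-∀

-- `k ! * ((k + x) C k)` is the product (x + 1) ⋯ (x + k), and each of its k factors is at least x.
^-≤-falling : ∀ x k → x ^ k ≤ k ! * ((k + x) C k)
^-≤-falling x zero    = ℕ.≤-refl
^-≤-falling x (suc k) = begin
  x * x ^ k                                  ≤⟨ ℕ.*-mono-≤ (ℕ.m≤n+m x (suc k)) (^-≤-falling x k) ⟩
  suc (k + x) * (k ! * ((k + x) C k))        ≡⟨ swap (suc (k + x)) (k !) _ ⟩
  k ! * (suc (k + x) * ((k + x) C k))        ≡⟨ cong (k ! *_) (C-absorption (k + x) k) ⟨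
  k ! * (suc k * (suc (k + x) C suc k))      ≡⟨ rotate (k !) (suc k) _ ⟩
  suc k * k ! * (suc (k + x) C suc k)        ∎
  where
  open ℕ.≤-Reasoning
  swap : ∀ x y z → x * (y * z) ≡ y * (x * z)
  swap = solve-∀
  rotate : ∀ x y z → x * (y * z) ≡ y * x * z
  rotate = solve-∀

-- With M = d + x this is (1 - d/M)ʲ ≥ 1 - j d/M, multiplied by Mʲ⁺¹ and without subtraction.
bernoulli : ∀ d j x → (d + x) ^ suc j ≤ (d + x) * x ^ j + j * d * (d + x) ^ j
bernoulli d zero    x = ℕ.≤-reflexive (sym (ℕ.+-identityʳ _))
bernoulli d (suc j) x = begin
  M * M ^ suc j                                    ≤⟨ ℕ.*-monoʳ-≤ M (bernoulli d j x) ⟩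
  M * (M * x ^ j + j * d * M ^ j)                  ≡⟨ expand d x j (x ^ j) (M ^ j) ⟩
  M * (x * x ^ j) + j * d * (M * M ^ j) + d * (M * x ^ j)
    ≤⟨ ℕ.+-monoʳ-≤ (M * (x * x ^ j) + j * d * (M * M ^ j))
         (ℕ.*-monoʳ-≤ d (ℕ.*-monoʳ-≤ M (ℕ.^-monoˡ-≤ j (ℕ.m≤n+m x d)))) ⟩
  M * (x * x ^ j) + j * d * (M * M ^ j) + d * (M * M ^ j)
    ≡⟨ collect d j (M * (x * x ^ j)) (M * M ^ j) ⟩
  M * (x * x ^ j) + suc j * d * (M * M ^ j)        ∎
  where
  open ℕ.≤-Reasoning
  M = d + x
  expand : ∀ d x j y z → (d + x) * ((d + x) * y + j * d * z) ≡
    (d + x) * (x * y) + j * d * ((d + x) * z) + d * ((d + x) * y)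
  expand = solve-∀
  collect : ∀ d j y z → y + j * d * z + d * z ≡ y + suc j * d * z
  collect = solve-∀

-- In Bernoulli's inequality times D + 1, the error term is at most one copy of `(d + x) ^ suc j`
-- and cancels. The case d = j = k compares powers with falling factorials, and d = 1 bounds powers
-- of (D + 1)/D.
^-ratio : ∀ d j D x → suc D * (j * d) ≤ d + x → .{{NonZero (d + x)}} → D * (d + x) ^ j ≤ suc D * x ^ j
^-ratio d j D x large = ℕ.*-cancelˡ-≤ M (ℕ.+-cancelʳ-≤ (M * M ^ j) _ _ (begin
  M * (D * M ^ j) + M * M ^ j                          ≡⟨ regroup M D (M ^ j) ⟩
  suc D * M ^ suc j                                    ≤⟨ ℕ.*-monoʳ-≤ (suc D) (bernoulli d j x) ⟩
  suc D * (M * x ^ j + j * d * M ^ j)                  ≡⟨ expand D M (j * d) (x ^ j) (M ^ j) ⟩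
  M * (suc D * x ^ j) + suc D * (j * d) * M ^ j        ≤⟨ ℕ.+-monoʳ-≤ (M * (suc D * x ^ j)) (ℕ.*-monoˡ-≤ (M ^ j) large) ⟩
  M * (suc D * x ^ j) + M * M ^ j                      ∎))
  where
  open ℕ.≤-Reasoning
  M = d + x
  regroup : ∀ m D y → m * (D * y) + m * y ≡ suc D * (m * y)
  regroup = solve-∀
  expand : ∀ D m e y z → suc D * (m * y + e * z) ≡ m * (suc D * y) + suc D * e * z
  expand = solve-∀

-- Among all k-tuples of k + x positions, those without repetition make up a proportion of at least
-- D/(D + 1).
^-≤-falling-ratio : ∀ k D x → suc D * (k * k) ≤ k + x → .{{NonZero (k + x)}} →
  D * (k + x) ^ k ≤ suc D * (k ! * ((k + x) C k))
^-≤-falling-ratio k D x large =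
  ℕ.≤-trans (^-ratio k k D x large) (ℕ.*-monoʳ-≤ (suc D) (^-≤-falling x k))

-- The group of residues modulo p

ind : ∀ {ℓ} {P : Set ℓ} → Dec P → ℕ
ind P? = if does P? then 1 else 0

module _ {p : ℕ} .{{_ : NonZero p}} where

  toℕ-⊕ : ∀ (a b : Fin p) → toℕ (a ⊕ b) ≡ (toℕ a + toℕ b) % p
  toℕ-⊕ a b = Fin.toℕ-fromℕ< _

  ⊕-comm : ∀ (a b : Fin p) → a ⊕ b ≡ b ⊕ a
  ⊕-comm a b = cong (_mod p) (ℕ.+-comm (toℕ a) (toℕ b))

  mod-⊕ : ∀ m (a : Fin p) → (m mod p) ⊕ a ≡ (m + toℕ a) mod p
  mod-⊕ m a = Fin.toℕ-injective (begin
    toℕ ((m mod p) ⊕ a)              ≡⟨ toℕ-⊕ (m mod p) a ⟩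
    (toℕ (m mod p) + toℕ a) % p      ≡⟨ cong (λ x → (x + toℕ a) % p) (Fin.toℕ-fromℕ< _) ⟩
    (m % p + toℕ a) % p              ≡⟨ ℕ.%-distribˡ-+ (m % p) (toℕ a) p ⟩
    (m % p % p + toℕ a % p) % p      ≡⟨ cong (λ x → (x + toℕ a % p) % p) (ℕ.m%n%n≡m%n m p) ⟩
    (m % p + toℕ a % p) % p          ≡⟨ ℕ.%-distribˡ-+ m (toℕ a) p ⟨
    (m + toℕ a) % p                  ≡⟨ Fin.toℕ-fromℕ< _ ⟨
    toℕ ((m + toℕ a) mod p)          ∎)
    where open ≡-Reasoning

  ⊕-assoc : ∀ (a b c : Fin p) → a ⊕ b ⊕ c ≡ a ⊕ (b ⊕ c)
  ⊕-assoc a b c = begin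
    a ⊕ b ⊕ c                           ≡⟨ mod-⊕ (toℕ a + toℕ b) c ⟩
    (toℕ a + toℕ b + toℕ c) mod p       ≡⟨ cong (_mod p) (lemma (toℕ a) (toℕ b) (toℕ c)) ⟩
    (toℕ b + toℕ c + toℕ a) mod p       ≡⟨ mod-⊕ (toℕ b + toℕ c) a ⟨
    (b ⊕ c) ⊕ a                         ≡⟨ ⊕-comm (b ⊕ c) a ⟩
    a ⊕ (b ⊕ c)                         ∎
    where
    open ≡-Reasoning
    lemma : ∀ x y z → x + y + z ≡ y + z + x
    lemma = solve-∀

  ⊕-swapʳ : ∀ (a b c : Fin p) → a ⊕ b ⊕ c ≡ a ⊕ c ⊕ b
  ⊕-swapʳ a b c = begin
    a ⊕ b ⊕ c    ≡⟨ ⊕-assoc a b c ⟩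
    a ⊕ (b ⊕ c)  ≡⟨ cong (a ⊕_) (⊕-comm b c) ⟩
    a ⊕ (c ⊕ b)  ≡⟨ ⊕-assoc a c b ⟨
    a ⊕ c ⊕ b    ∎
    where open ≡-Reasoning

  0# : Fin p
  0# = 0 mod p

  ⊕-identityˡ : ∀ a → 0# ⊕ a ≡ a
  ⊕-identityˡ a = Fin.toℕ-injective (begin
    toℕ (0# ⊕ a)          ≡⟨ cong toℕ (mod-⊕ 0 a) ⟩
    toℕ (toℕ a mod p)     ≡⟨ Fin.toℕ-fromℕ< _ ⟩
    toℕ a % p             ≡⟨ ℕ.m<n⇒m%n≡m (Fin.toℕ<n a) ⟩
    toℕ a                 ∎)
    where open ≡-Reasoning

  ⊕-identityʳ : ∀ a → a ⊕ 0# ≡ a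
  ⊕-identityʳ a = trans (⊕-comm a 0#) (⊕-identityˡ a)

  ⊕-inverseˡ : ∀ (a : Fin p) → ∃ λ b → b ⊕ a ≡ 0#
  ⊕-inverseˡ a = (p ∸ toℕ a) mod p , (begin
    ((p ∸ toℕ a) mod p) ⊕ a        ≡⟨ mod-⊕ (p ∸ toℕ a) a ⟩
    (p ∸ toℕ a + toℕ a) mod p      ≡⟨ cong (_mod p) (ℕ.m∸n+n≡m (ℕ.<⇒≤ (Fin.toℕ<n a))) ⟩
    p mod p                        ≡⟨ Fin.toℕ-injective (trans (Fin.toℕ-fromℕ< _) (trans (ℕ.n%n≡0 p)
                                        (sym (trans (Fin.toℕ-fromℕ< _) (ℕ.m*n%n≡0 0 p))))) ⟩
    0#                             ∎)
    where open ≡-Reasoning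

  ⊕-cancelˡ : ∀ (a b c : Fin p) → a ⊕ b ≡ a ⊕ c → b ≡ c
  ⊕-cancelˡ a b c eq with ⊕-inverseˡ a
  ... | a⁻ , inv = trans (sym (undo b)) (trans (cong (a⁻ ⊕_) eq) (undo c))
    where
    undo : ∀ x → a⁻ ⊕ (a ⊕ x) ≡ x
    undo x = trans (sym (⊕-assoc a⁻ a x)) (trans (cong (_⊕ x) inv) (⊕-identityˡ x))

  -- Sums over selections and over tuples of entries

  δ : Fin p → Fin p → ℕ
  δ b a = ind (a Fin.≟ b)

  -- selections φ vs k a is the sum of φ (a ⊕ s) over the sums s of k entries of vs
  -- in distinct positions (unordered), and tuples φ vs k a the same for k-tuples of
  -- entries with repetition; φ = δ b counts, and φ = const 1 normalises.
  selections : (Fin p → ℕ) → ∀ {n} → Vector (Fin p) n → ℕ → Fin p → ℕ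
  selections φ         vs zero    a = φ a
  selections φ {zero}  vs (suc k) a = 0
  selections φ {suc n} vs (suc k) a =
    selections φ (tail vs) (suc k) a + selections φ (tail vs) k (a ⊕ head vs)

  tuples : (Fin p → ℕ) → ∀ {n} → Vector (Fin p) n → ℕ → Fin p → ℕ
  tuples φ vs zero    a = φ a
  tuples φ vs (suc k) a = ∑[ i < _ ] tuples φ vs k (a ⊕ vs i)

  selections-const : ∀ {n} (vs : Vector (Fin p) n) k a → selections (const 1) vs k a ≡ n C k
  selections-const         vs zero    a = refl
  selections-const {zero}  vs (suc k) a = sym (k>n⇒nCk≡0 {0} {suc k} z<s)
  selections-const {suc n} vs (suc k) a = begin
    selections (const 1) (tail vs) (suc k) a + selections (const 1) (tail vs) k (a ⊕ head vs)
      ≡⟨ cong₂ _+_ (selections-const (tail vs) (suc k) a) (selections-const (tail vs) k _) ⟩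
    n C suc k + n C k  ≡⟨ ℕ.+-comm (n C suc k) (n C k) ⟩
    n C k + n C suc k  ≡⟨ nCk+nC[k+1]≡[n+1]C[k+1] n k ⟩
    suc n C suc k      ∎
    where open ≡-Reasoning

  -- Double counting of a (k+1)-selection with a marked position i. In the induction the summand i =
  -- 0 is `Y`, where the head is marked; the other summands split according to whether the head is
  -- among the unmarked positions.
  selections-remove : ∀ φ {n} (vs : Vector (Fin p) (suc n)) k a →
    suc k * selections φ vs (suc k) a ≡ ∑[ i < suc n ] selections φ (vs ∘ punchIn i) k (a ⊕ vs i)
  selections-remove φ {zero}  vs zero    a = refl
  selections-remove φ {zero}  vs (suc k) a = ℕ.*-zeroʳ (suc (suc k))
  selections-remove φ {suc n} vs zero    a = begin
    1 * (selections φ (tail vs) 1 a + φ (a ⊕ head vs))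
      ≡⟨ lemma (selections φ (tail vs) 1 a) _ ⟩
    φ (a ⊕ head vs) + 1 * selections φ (tail vs) 1 a
      ≡⟨ cong (φ (a ⊕ head vs) ℕ.+_) (selections-remove φ (tail vs) zero a) ⟩
    φ (a ⊕ head vs) + (∑[ i < suc n ] φ (a ⊕ tail vs i)) ∎
    where
    open ≡-Reasoning
    lemma : ∀ x y → 1 * (x + y) ≡ y + 1 * x
    lemma = solve-∀
  selections-remove φ {suc n} vs (suc k) a = begin
    suc (suc k) * (X + Y)
      ≡⟨ lemma k X Y ⟩
    Y + (suc (suc k) * X + suc k * Y)
      ≡⟨ cong (Y ℕ.+_) (cong₂ _+_ (selections-remove φ (tail vs) (suc k) a)
                                (selections-remove φ (tail vs) k (a ⊕ head vs))) ⟩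
    Y + (∑[ i < suc n ] selections φ (tail vs ∘ punchIn i) (suc k) (a ⊕ tail vs i)
         + ∑[ i < suc n ] selections φ (tail vs ∘ punchIn i) k (a ⊕ head vs ⊕ tail vs i))
      ≡⟨ cong (Y ℕ.+_) (∑-distrib-+ (λ i → selections φ (tail vs ∘ punchIn i) (suc k) (a ⊕ tail vs i))
                                   (λ i → selections φ (tail vs ∘ punchIn i) k (a ⊕ head vs ⊕ tail vs i))) ⟨
    Y + ∑[ i < suc n ] (selections φ (tail vs ∘ punchIn i) (suc k) (a ⊕ tail vs i)
                        + selections φ (tail vs ∘ punchIn i) k (a ⊕ head vs ⊕ tail vs i))
      ≡⟨ cong (Y ℕ.+_) (sum-cong-≗ λ i →
           cong (λ b → selections φ (tail vs ∘ punchIn i) (suc k) (a ⊕ tail vs i)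
                       + selections φ (tail vs ∘ punchIn i) k b)
                (⊕-swapʳ a (head vs) (tail vs i))) ⟩
    Y + (∑[ i < suc n ] selections φ (vs ∘ punchIn (Fin.suc i)) (suc k) (a ⊕ tail vs i)) ∎
    where
    open ≡-Reasoning
    X = selections φ (tail vs) (suc (suc k)) a
    Y = selections φ (tail vs) (suc k) (a ⊕ head vs)
    lemma : ∀ k x y → suc (suc k) * (x + y) ≡ y + (suc (suc k) * x + suc k * y)
    lemma = solve-∀

  selections-punchIn-≤ : ∀ φ {n} (vs : Vector (Fin p) (suc n)) i k a →
    selections φ (vs ∘ punchIn i) k a ≤ selections φ vs k a
  selections-punchIn-≤ φ         vs i           zero    a = ℕ.≤-refl
  selections-punchIn-≤ φ         vs Fin.zero    (suc k) a = ℕ.m≤m+n _ _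
  selections-punchIn-≤ φ {suc n} vs (Fin.suc i) (suc k) a =
    ℕ.+-mono-≤ (selections-punchIn-≤ φ (tail vs) i (suc k) a)
             (selections-punchIn-≤ φ (tail vs) i k (a ⊕ head vs))

  -- A selection has k! orderings, and all of them are tuples. Inductively, one entry is drawn by
  -- `selections-remove` and then put back, which only enlarges the count.
  selections-≤-tuples : ∀ φ {n} (vs : Vector (Fin p) n) k a →
    k ! * selections φ vs k a ≤ tuples φ vs k a
  selections-≤-tuples φ         vs zero    a = ℕ.≤-reflexive (ℕ.*-identityˡ (φ a))
  selections-≤-tuples φ {zero}  vs (suc k) a = ℕ.≤-reflexive (ℕ.*-zeroʳ ((suc k) !))
  selections-≤-tuples φ {suc n} vs (suc k) a = begin
    suc k * k ! * selections φ vs (suc k) a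
      ≡⟨ lemma (suc k) (k !) _ ⟩
    k ! * (suc k * selections φ vs (suc k) a)
      ≡⟨ cong (k ! *_) (selections-remove φ vs k a) ⟩
    k ! * (∑[ i < suc n ] selections φ (vs ∘ punchIn i) k (a ⊕ vs i))
      ≡⟨ *-distribˡ-sum (k !) (λ i → selections φ (vs ∘ punchIn i) k (a ⊕ vs i)) ⟩
    ∑[ i < suc n ] (k ! * selections φ (vs ∘ punchIn i) k (a ⊕ vs i))
      ≤⟨ sum-mono-≤ (λ i → ℕ.≤-trans
           (ℕ.*-monoʳ-≤ (k !) (selections-punchIn-≤ φ vs i k (a ⊕ vs i)))
           (selections-≤-tuples φ vs k (a ⊕ vs i))) ⟩
    ∑[ i < suc n ] tuples φ vs k (a ⊕ vs i) ∎
    where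
    open ℕ.≤-Reasoning
    lemma : ∀ x y z → x * y * z ≡ y * (x * z)
    lemma = solve-∀

  -- Choosing one element of a k-subset uniformly at random and revealing it
  -- leaves a uniform (k-1)-subset of the remaining elements.
  selections-lift : ∀ φ P Q {M k} →
    (∀ (vs : Vector (Fin p) M) → Injective _≡_ _≡_ vs → ∀ a →
      Q * selections φ vs k a ≤ P * (M C k)) →
    ∀ j (vs : Vector (Fin p) (j + M)) → Injective _≡_ _≡_ vs → ∀ a →
    Q * selections φ vs (j + k) a ≤ P * ((j + M) C (j + k))
  selections-lift φ P Q {M} {k} base zero = base
  selections-lift φ P Q {M} {k} base (suc j) vs vs-inj a = ℕ.*-cancelˡ-≤ (suc (j + k)) (begin
    suc (j + k) * (Q * selections φ vs (suc (j + k)) a)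
      ≡⟨ lemma (suc (j + k)) Q _ ⟩
    Q * (suc (j + k) * selections φ vs (suc (j + k)) a)
      ≡⟨ cong (Q *_) (selections-remove φ vs (j + k) a) ⟩
    Q * (∑[ i < suc (j + M) ] selections φ (vs ∘ punchIn i) (j + k) (a ⊕ vs i))
      ≡⟨ *-distribˡ-sum Q (λ i → selections φ (vs ∘ punchIn i) (j + k) (a ⊕ vs i)) ⟩
    ∑[ i < suc (j + M) ] (Q * selections φ (vs ∘ punchIn i) (j + k) (a ⊕ vs i))
      ≤⟨ sum-mono-≤ (λ i → selections-lift φ P Q {M} {k} base j (vs ∘ punchIn i)
                             (Fin.punchIn-injective i _ _ ∘ vs-inj) (a ⊕ vs i)) ⟩
    ∑[ i < suc (j + M) ] (P * ((j + M) C (j + k)))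
      ≡⟨ sum-const (suc (j + M)) _ ⟩
    suc (j + M) * (P * ((j + M) C (j + k)))
      ≡⟨ lemma (suc (j + M)) P _ ⟩
    P * (suc (j + M) * ((j + M) C (j + k)))
      ≡⟨ cong (P *_) (C-absorption (j + M) (j + k)) ⟨
    P * (suc (j + k) * (suc (j + M) C suc (j + k)))
      ≡⟨ lemma P (suc (j + k)) _ ⟩
    suc (j + k) * (P * (suc (j + M) C suc (j + k))) ∎)
    where
    open ℕ.≤-Reasoning
    lemma : ∀ x y z → x * (y * z) ≡ y * (x * z)
    lemma = solve-∀

  -- Complements of selections

  total : ∀ {n} → Vector (Fin p) n → Fin p
  total {zero}  vs = 0#
  total {suc n} vs = head vs ⊕ total (tail vs)

  selections-empty : ∀ φ {n} (vs : Vector (Fin p) n) k a → n < k → selections φ vs k a ≡ 0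
  selections-empty φ {zero}  vs (suc k) a _         = refl
  selections-empty φ {suc n} vs (suc k) a (s≤s n<k) =
    cong₂ _+_ (selections-empty φ (tail vs) (suc k) a (ℕ.m<n⇒m<1+n n<k))
              (selections-empty φ (tail vs) k _ n<k)

  selections-full : ∀ φ {n} (vs : Vector (Fin p) n) a → selections φ vs n a ≡ φ (a ⊕ total vs)
  selections-full φ {zero}  vs a = cong φ (sym (⊕-identityʳ a))
  selections-full φ {suc n} vs a = cong₂ _+_
    (selections-empty φ (tail vs) (suc n) a ℕ.≤-refl)
    (trans (selections-full φ (tail vs) (a ⊕ head vs)) (cong φ (⊕-assoc a (head vs) _)))

  δ-sym : ∀ a b → δ a b ≡ δ b a
  δ-sym a b with a Fin.≟ b | b Fin.≟ a
  ... | yes _   | yes _   = refl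
  ... | no _    | no _    = refl
  ... | yes a≡b | no b≢a  with () ← b≢a (sym a≡b)
  ... | no a≢b  | yes b≡a with () ← a≢b (sym b≡a)

  δ-⊕ : ∀ a b c → δ (c ⊕ b) (c ⊕ a) ≡ δ b a
  δ-⊕ a b c with c ⊕ a Fin.≟ c ⊕ b | a Fin.≟ b
  ... | yes _   | yes _   = refl
  ... | no _    | no _    = refl
  ... | yes eq  | no a≢b  with () ← a≢b (⊕-cancelˡ c a b eq)
  ... | no neq  | yes a≡b with () ← neq (cong (c ⊕_) a≡b)

  -- A subset and its complement have sums adding up to the total.
  selections-complement : ∀ {n} (vs : Vector (Fin p) n) i j → i + j ≡ n → ∀ a b →
    selections (δ b) vs i a ≡ selections (δ (a ⊕ total vs)) vs j b
  selections-complement {n} vs zero j refl a b = begin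
    δ b a                                  ≡⟨ δ-sym b a ⟩
    δ a b                                  ≡⟨ δ-⊕ b a (total vs) ⟨
    δ (total vs ⊕ a) (total vs ⊕ b)        ≡⟨ cong₂ δ (⊕-comm (total vs) a) (⊕-comm (total vs) b) ⟩
    δ (a ⊕ total vs) (b ⊕ total vs)        ≡⟨ selections-full (δ (a ⊕ total vs)) vs b ⟨
    selections (δ (a ⊕ total vs)) vs n b   ∎
    where open ≡-Reasoning
  selections-complement {suc n} vs (suc i) zero i+j≡n a b
    with refl ← trans (sym (ℕ.+-identityʳ i)) (ℕ.suc-injective i+j≡n) =
    trans (selections-full (δ b) vs a) (δ-sym b (a ⊕ total vs))
  selections-complement {suc n} vs (suc i) (suc j) i+j≡n a b = begin
    selections (δ b) (tail vs) (suc i) a + selections (δ b) (tail vs) i (a ⊕ head vs)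
      ≡⟨ cong₂ _+_ (selections-complement (tail vs) (suc i) j (trans (sym (ℕ.+-suc i j)) (ℕ.suc-injective i+j≡n)) a b)
                   (selections-complement (tail vs) i (suc j) (ℕ.suc-injective i+j≡n) (a ⊕ head vs) b) ⟩
    selections (δ (a ⊕ T)) (tail vs) j b + selections (δ (a ⊕ head vs ⊕ T)) (tail vs) (suc j) b
      ≡⟨ cong (λ c → selections (δ (a ⊕ T)) (tail vs) j b + selections (δ c) (tail vs) (suc j) b)
              (⊕-assoc a (head vs) T) ⟩
    selections (δ (a ⊕ T)) (tail vs) j b + selections (δ t) (tail vs) (suc j) b
      ≡⟨ cong (_+ selections (δ t) (tail vs) (suc j) b) (shift (tail vs) j b) ⟩
    selections (δ t) (tail vs) j (b ⊕ head vs) + selections (δ t) (tail vs) (suc j) b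
      ≡⟨ ℕ.+-comm (selections (δ t) (tail vs) j (b ⊕ head vs)) _ ⟩
    selections (δ t) (tail vs) (suc j) b + selections (δ t) (tail vs) j (b ⊕ head vs) ∎
    where
    open ≡-Reasoning
    T = total (tail vs)
    t = a ⊕ total vs
    -- Translating target and starting point by the head together changes no count. This rewrites
    -- target `a ⊕ T` and start `b` as target `t` and start `b ⊕ head vs`, which puts the head into
    -- the complement.
    shift : ∀ {m} (ws : Vector (Fin p) m) k c →
      selections (δ (a ⊕ T)) ws k c ≡ selections (δ t) ws k (c ⊕ head vs)
    shift ws zero c = begin
      δ (a ⊕ T) c                          ≡⟨ δ-⊕ c (a ⊕ T) (head vs) ⟨
      δ (head vs ⊕ (a ⊕ T)) (head vs ⊕ c)  ≡⟨ cong₂ δ lemma (⊕-comm (head vs) c) ⟩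
      δ t (c ⊕ head vs)                    ∎
      where
      lemma : head vs ⊕ (a ⊕ T) ≡ a ⊕ (head vs ⊕ T)
      lemma = begin
        head vs ⊕ (a ⊕ T)  ≡⟨ ⊕-assoc (head vs) a T ⟨
        head vs ⊕ a ⊕ T    ≡⟨ cong (_⊕ T) (⊕-comm (head vs) a) ⟩
        a ⊕ head vs ⊕ T    ≡⟨ ⊕-assoc a (head vs) T ⟩
        a ⊕ (head vs ⊕ T)  ∎
    shift {zero}  ws (suc k) c = refl
    shift {suc m} ws (suc k) c = cong₂ _+_ (shift (tail ws) (suc k) c)
      (trans (shift (tail ws) k (c ⊕ head ws)) (cong (selections (δ t) (tail ws) k) (⊕-swapʳ c (head ws) (head vs))))


  -- Laws of sums of independent entries

  sum-δ : ∀ (f : Fin p → ℕ) b → ∑[ y < p ] (f y * δ y b) ≡ f b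
  sum-δ = go
    where
    zeros : ∀ {n} (f : Fin n → ℕ) → ∑[ y < n ] (f y * 0) ≡ 0
    zeros {n} f = trans (sum-cong-≗ (λ y → ℕ.*-zeroʳ (f y))) (sum-replicate-zero n)
    go : ∀ {n} (f : Fin n → ℕ) b → ∑[ y < n ] (f y * ind (b Fin.≟ y)) ≡ f b
    go f Fin.zero    = trans (cong₂ _+_ (ℕ.*-identityʳ _) (zeros (f ∘ Fin.suc))) (ℕ.+-identityʳ _)
    go f (Fin.suc b) = trans (cong₂ _+_ (ℕ.*-zeroʳ (f Fin.zero)) (go (f ∘ Fin.suc) b)) refl

  sum-δ-injective-≤1 : ∀ b {n} (vs : Vector (Fin p) n) → Injective _≡_ _≡_ vs →
    ∑[ i < n ] δ b (vs i) ≤ 1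
  sum-δ-injective-≤1 b {zero}  vs vs-inj = z≤n
  sum-δ-injective-≤1 b {suc n} vs vs-inj with vs Fin.zero Fin.≟ b
  ... | no _ = sum-δ-injective-≤1 b (tail vs) (Fin.suc-injective ∘ vs-inj)
  ... | yes v₀≡b = s≤s (ℕ.≤-reflexive (trans (sum-cong-≗ other) (sum-replicate-zero n)))
    where
    other : ∀ i → δ b (vs (Fin.suc i)) ≡ 0
    other i with vs (Fin.suc i) Fin.≟ b
    ... | no _     = refl
    ... | yes vᵢ≡b with () ← Fin.0≢1+n (vs-inj (trans v₀≡b (sym vᵢ≡b)))

  tuples-cong : ∀ {φ ψ} → φ ≗ ψ → ∀ {n} (vs : Vector (Fin p) n) k → tuples φ vs k ≗ tuples ψ vs k
  tuples-cong φ≗ψ vs zero    a = φ≗ψ a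
  tuples-cong φ≗ψ vs (suc k) a = sum-cong-≗ (λ i → tuples-cong φ≗ψ vs k (a ⊕ vs i))

  tuples-+ : ∀ φ {n} (vs : Vector (Fin p) n) i j a →
    tuples φ vs (i + j) a ≡ tuples (tuples φ vs j) vs i a
  tuples-+ φ vs zero    j a = refl
  tuples-+ φ vs (suc i) j a = sum-cong-≗ (λ l → tuples-+ φ vs i j (a ⊕ vs l))

  tuples-⊕ : ∀ φ {n} (vs : Vector (Fin p) n) k c a →
    tuples φ vs k (c ⊕ a) ≡ tuples (φ ∘ (c ⊕_)) vs k a
  tuples-⊕ φ vs zero    c a = refl
  tuples-⊕ φ vs (suc k) c a = sum-cong-≗ (λ i →
    trans (cong (tuples φ vs k) (⊕-assoc c a (vs i))) (tuples-⊕ φ vs k c (a ⊕ vs i)))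

  tuples-linear : ∀ (f : Fin p → ℕ) (φ : Fin p → Fin p → ℕ) {n} (vs : Vector (Fin p) n) k a →
    tuples (λ s → ∑[ y < p ] (f y * φ y s)) vs k a ≡ ∑[ y < p ] (f y * tuples (φ y) vs k a)
  tuples-linear f φ     vs zero    a = refl
  tuples-linear f φ {n} vs (suc k) a = begin
    ∑[ i < n ] tuples (λ s → ∑[ y < p ] (f y * φ y s)) vs k (a ⊕ vs i)
      ≡⟨ sum-cong-≗ (λ i → tuples-linear f φ vs k (a ⊕ vs i)) ⟩
    ∑[ i < n ] ∑[ y < p ] (f y * tuples (φ y) vs k (a ⊕ vs i))
      ≡⟨ ∑-comm (λ i y → f y * tuples (φ y) vs k (a ⊕ vs i)) ⟩
    ∑[ y < p ] ∑[ i < n ] (f y * tuples (φ y) vs k (a ⊕ vs i))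
      ≡⟨ sum-cong-≗ (λ y → *-distribˡ-sum (f y) (λ i → tuples (φ y) vs k (a ⊕ vs i))) ⟨
    ∑[ y < p ] (f y * tuples (φ y) vs (suc k) a) ∎
    where open ≡-Reasoning

  -- The unnormalised distribution of the sum of k independent uniform entries; its total mass is n
  -- ^ k.
  law : ∀ {n} → Vector (Fin p) n → ℕ → Fin p → ℕ
  law vs k y = tuples (δ y) vs k 0#

  -- The weight `φ ∘ (a ⊕_)` is expanded in the point masses `δ y`, and `tuples` is linear in its
  -- weight. A count of tuples thereby becomes an expectation under `law`.
  tuples-law : ∀ φ {n} (vs : Vector (Fin p) n) k a →
    tuples φ vs k a ≡ ∑[ y < p ] (law vs k y * φ (a ⊕ y))
  tuples-law φ vs k a = begin
    tuples φ vs k a                 ≡⟨ cong (tuples φ vs k) (⊕-identityʳ a) ⟨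
    tuples φ vs k (a ⊕ 0#)          ≡⟨ tuples-⊕ φ vs k a 0# ⟩
    tuples (φ ∘ (a ⊕_)) vs k 0#     ≡⟨ tuples-cong (sum-δ (φ ∘ (a ⊕_))) vs k 0# ⟨
    tuples (λ s → ∑[ y < p ] (φ (a ⊕ y) * δ y s)) vs k 0#
                                    ≡⟨ tuples-linear (φ ∘ (a ⊕_)) δ vs k 0# ⟩
    ∑[ y < p ] (φ (a ⊕ y) * law vs k y)
                                    ≡⟨ sum-cong-≗ (λ y → ℕ.*-comm (φ (a ⊕ y)) _) ⟩
    ∑[ y < p ] (law vs k y * φ (a ⊕ y)) ∎
    where open ≡-Reasoning

  tuples-const : ∀ {n} (vs : Vector (Fin p) n) k a → tuples (const 1) vs k a ≡ n ^ k
  tuples-const     vs zero    a = refl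
  tuples-const {n} vs (suc k) a =
    trans (sum-cong-≗ (λ i → tuples-const vs k (a ⊕ vs i))) (sum-const n (n ^ k))

  sum-law : ∀ {n} (vs : Vector (Fin p) n) k → sum (law vs k) ≡ n ^ k
  sum-law vs k = begin
    sum (law vs k)                   ≡⟨ sum-cong-≗ (λ y → ℕ.*-identityʳ (law vs k y)) ⟨
    ∑[ y < p ] (law vs k y * 1)      ≡⟨ tuples-law (const 1) vs k 0# ⟨
    tuples (const 1) vs k 0#         ≡⟨ tuples-const vs k 0# ⟩
    _                                ∎
    where open ≡-Reasoning

  -- A tuple of length 3k consists of three independent blocks of length k, so its law is a
  -- threefold convolution: up to normalisation, the shape of `threefoldSumProb`.
  law-threefold : ∀ {n} (vs : Vector (Fin p) n) k x →
    law vs (k + (k + k)) x ≡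
    ∑[ a < p ] (law vs k a * ∑[ b < p ] (law vs k b * ∑[ c < p ] (law vs k c * δ x (a ⊕ b ⊕ c))))
  law-threefold vs k x = begin
    tuples (δ x) vs (k + (k + k)) 0#
      ≡⟨ tuples-+ (δ x) vs k (k + k) 0# ⟩
    tuples (tuples (δ x) vs (k + k)) vs k 0#
      ≡⟨ tuples-law _ vs k 0# ⟩
    ∑[ a < p ] (law vs k a * tuples (δ x) vs (k + k) (0# ⊕ a))
      ≡⟨ sum-cong-≗ (λ a → cong (law vs k a *_) (begin
           tuples (δ x) vs (k + k) (0# ⊕ a)
             ≡⟨ cong (tuples (δ x) vs (k + k)) (⊕-identityˡ a) ⟩
           tuples (δ x) vs (k + k) a
             ≡⟨ tuples-+ (δ x) vs k k a ⟩
           tuples (tuples (δ x) vs k) vs k a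
             ≡⟨ tuples-law _ vs k a ⟩
           ∑[ b < p ] (law vs k b * tuples (δ x) vs k (a ⊕ b))
             ≡⟨ sum-cong-≗ (λ b → cong (law vs k b *_) (tuples-law (δ x) vs k (a ⊕ b))) ⟩
           ∑[ b < p ] (law vs k b * ∑[ c < p ] (law vs k c * δ x (a ⊕ b ⊕ c))) ∎)) ⟩
    _ ∎
    where open ≡-Reasoning

  law-one-≤ : ∀ {n} (vs : Vector (Fin p) n) → Injective _≡_ _≡_ vs → ∀ y → law vs 1 y ≤ 1
  law-one-≤ vs vs-inj y = ℕ.≤-trans
    (ℕ.≤-reflexive (sum-cong-≗ (λ i → cong (δ y) (⊕-identityˡ (vs i)))))
    (sum-δ-injective-≤1 y vs vs-inj)

  -- At most one y satisfies a ⊕ y = b, so a pointwise bound on `law` becomes uniform in start and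
  -- target. The factor Q carries a denominator.
  tuples-≤ : ∀ {n} (vs : Vector (Fin p) n) k {Q K} → (∀ y → Q * law vs k y ≤ K) →
    ∀ a b → Q * tuples (δ b) vs k a ≤ K
  tuples-≤ vs k {Q} {K} law≤ a b = begin
    Q * tuples (δ b) vs k a
      ≡⟨ cong (Q *_) (tuples-law (δ b) vs k a) ⟩
    Q * (∑[ y < p ] (law vs k y * δ b (a ⊕ y)))
      ≡⟨ *-distribˡ-sum Q (λ y → law vs k y * δ b (a ⊕ y)) ⟩
    ∑[ y < p ] (Q * (law vs k y * δ b (a ⊕ y)))
      ≤⟨ sum-mono-≤ (λ y → ℕ.≤-trans (ℕ.≤-reflexive (sym (ℕ.*-assoc Q (law vs k y) (δ b (a ⊕ y)))))
                                   (ℕ.*-monoˡ-≤ (δ b (a ⊕ y)) (law≤ y))) ⟩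
    ∑[ y < p ] (K * δ b (a ⊕ y))
      ≡⟨ *-distribˡ-sum K (λ y → δ b (a ⊕ y)) ⟨
    K * (∑[ y < p ] δ b (a ⊕ y))
      ≤⟨ ℕ.*-monoʳ-≤ K (sum-δ-injective-≤1 b (a ⊕_) (⊕-cancelˡ a _ _)) ⟩
    K * 1
      ≡⟨ ℕ.*-identityʳ K ⟩
    K ∎
    where open ℕ.≤-Reasoning

  -- A bound P/Q for tuples becomes P (D + 1) / (Q D) for selections: orderings of selections are
  -- tuples, and `^-≤-falling-ratio` changes the normalisation from a power to a binomial
  -- coefficient.
  selections-≤-initial : ∀ k D x (vs : Vector (Fin p) (k + x)) {P Q} →
    suc D * (k * k) ≤ k + x → .{{NonZero (k + x)}} →
    (∀ y → Q * law vs k y ≤ P * (k + x) ^ k) →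
    ∀ b a → D * Q * selections (δ b) vs k a ≤ P * suc D * ((k + x) C k)
  selections-≤-initial k D x vs {P} {Q} large law≤ b a = ℕ.*-cancelˡ-≤ (k !) {{k ℕ.!≢0}} (begin
    k ! * (D * Q * selections (δ b) vs k a)    ≡⟨ regroup (k !) D Q _ ⟩
    D * (Q * (k ! * selections (δ b) vs k a))  ≤⟨ ℕ.*-monoʳ-≤ D (ℕ.*-monoʳ-≤ Q (selections-≤-tuples (δ b) vs k a)) ⟩
    D * (Q * tuples (δ b) vs k a)              ≤⟨ ℕ.*-monoʳ-≤ D (tuples-≤ vs k {Q} law≤ a b) ⟩
    D * (P * (k + x) ^ k)                      ≡⟨ swap D P _ ⟩
    P * (D * (k + x) ^ k)                      ≤⟨ ℕ.*-monoʳ-≤ P (^-≤-falling-ratio k D x large) ⟩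
    P * (suc D * (k ! * ((k + x) C k)))        ≡⟨ regroup′ P (suc D) (k !) _ ⟩
    k ! * (P * suc D * ((k + x) C k))          ∎)
    where
    open ℕ.≤-Reasoning
    regroup : ∀ x y z w → x * (y * z * w) ≡ y * (z * (x * w))
    regroup = solve-∀
    swap : ∀ x y z → x * (y * z) ≡ y * (x * z)
    swap = solve-∀
    regroup′ : ∀ x y z w → x * (y * (z * w)) ≡ z * (x * y * w)
    regroup′ = solve-∀

-- Subsets of ℤ/p as selections

elements : ∀ {q} (A : Subset q) → Vector (Fin q) ∣ A ∣
elements (inside  ∷ A) Fin.zero    = Fin.zero
elements (inside  ∷ A) (Fin.suc i) = Fin.suc (elements A i)
elements (outside ∷ A) i           = Fin.suc (elements A i)

elements-injective : ∀ {q} (A : Subset q) → Injective _≡_ _≡_ (elements A)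
elements-injective (inside  ∷ A) {Fin.zero}  {Fin.zero}  eq = refl
elements-injective (inside  ∷ A) {Fin.suc i} {Fin.suc j} eq =
  cong Fin.suc (elements-injective A (Fin.suc-injective eq))
elements-injective (outside ∷ A) eq = elements-injective A (Fin.suc-injective eq)

listSum : {B : Set} → (B → ℕ) → List B → ℕ
listSum f List.[]       = 0
listSum f (x List.∷ xs) = f x ℕ.+ listSum f xs

module _ {B : Set} where

  listSum-cong : ∀ {f g : B → ℕ} → f ≗ g → ∀ xs → listSum f xs ≡ listSum g xs
  listSum-cong f≗g List.[]       = refl
  listSum-cong f≗g (x List.∷ xs) = cong₂ ℕ._+_ (f≗g x) (listSum-cong f≗g xs)

  listSum-zero : ∀ (xs : List B) → listSum (const 0) xs ≡ 0
  listSum-zero List.[]       = refl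
  listSum-zero (x List.∷ xs) = listSum-zero xs

  listSum-++ : ∀ (f : B → ℕ) xs ys → listSum f (xs ++ ys) ≡ listSum f xs ℕ.+ listSum f ys
  listSum-++ f List.[]       ys = refl
  listSum-++ f (x List.∷ xs) ys =
    trans (cong (f x ℕ.+_) (listSum-++ f xs ys)) (sym (ℕ.+-assoc (f x) _ _))

  listSum-map : ∀ {D : Set} (f : B → ℕ) (g : D → B) xs → listSum f (map g xs) ≡ listSum (f ∘ g) xs
  listSum-map f g List.[]       = refl
  listSum-map f g (x List.∷ xs) = cong (f (g x) ℕ.+_) (listSum-map f g xs)

  listSum-filter : ∀ {P : Pred B 0ℓ} (P? : Decidable P) (f : B → ℕ) xs →
    listSum f (filter P? xs) ≡ listSum (λ x → if does (P? x) then f x else 0) xs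
  listSum-filter P? f List.[] = refl
  listSum-filter P? f (x List.∷ xs) with does (P? x)
  ... | true  = cong (f x ℕ.+_) (listSum-filter P? f xs)
  ... | false = listSum-filter P? f xs

  length-as-listSum : ∀ (xs : List B) → length xs ≡ listSum (const 1) xs
  length-as-listSum List.[]       = refl
  length-as-listSum (x List.∷ xs) = cong suc (length-as-listSum xs)

module _ {p : ℕ} .{{_ : NonZero p}} where

  -- Recursion on a subset shrinks q while the values stay in `Fin p`, hence the separate map `e`.
  -- The accumulator `a` matches the starting point of `selections`.
  subsetSum : ∀ {q} → (Fin q → Fin p) → Fin p → Subset q → Fin p
  subsetSum e a []            = a
  subsetSum e a (inside  ∷ X) = subsetSum (e ∘ Fin.suc) (a ⊕ e Fin.zero) X
  subsetSum e a (outside ∷ X) = subsetSum (e ∘ Fin.suc) a X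

  private
    ⊕-sum : List (Fin p) → Fin p
    ⊕-sum = List.foldr _⊕_ 0#

  filter-∈?-suc : ∀ {q} s (X : Subset q) xs →
    filter (_∈? (s ∷ X)) (map Fin.suc xs) ≡ map Fin.suc (filter (_∈? X) xs)
  filter-∈?-suc s X List.[] = refl
  filter-∈?-suc s X (x List.∷ xs) with does (x ∈? X)
  ... | true  = cong (Fin.suc x List.∷_) (filter-∈?-suc s X xs)
  ... | false = filter-∈?-suc s X xs

  subsetSum-foldr : ∀ {q} (e : Fin q → Fin p) a X →
    subsetSum e a X ≡ a ⊕ ⊕-sum (map e (filter (_∈? X) (allFin q)))
  subsetSum-foldr e a [] = sym (⊕-identityʳ a)
  subsetSum-foldr {suc q} e a (s ∷ X) = by-head s refl
    where
    rest : ∀ a → subsetSum (e ∘ Fin.suc) a X ≡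
      a ⊕ ⊕-sum (map e (filter (_∈? (s ∷ X)) (List.tabulate Fin.suc)))
    rest a = begin
      subsetSum (e ∘ Fin.suc) a X
        ≡⟨ subsetSum-foldr (e ∘ Fin.suc) a X ⟩
      a ⊕ ⊕-sum (map (e ∘ Fin.suc) (filter (_∈? X) (allFin q)))
        ≡⟨ cong (λ xs → a ⊕ ⊕-sum xs) (List.map-∘ (filter (_∈? X) (allFin q))) ⟩
      a ⊕ ⊕-sum (map e (map Fin.suc (filter (_∈? X) (allFin q))))
        ≡⟨ cong (λ xs → a ⊕ ⊕-sum (map e xs)) (filter-∈?-suc s X (allFin q)) ⟨
      a ⊕ ⊕-sum (map e (filter (_∈? (s ∷ X)) (map Fin.suc (allFin q))))
        ≡⟨ cong (λ xs → a ⊕ ⊕-sum (map e (filter (_∈? (s ∷ X)) xs))) (List.map-tabulate id Fin.suc) ⟩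
      a ⊕ ⊕-sum (map e (filter (_∈? (s ∷ X)) (List.tabulate Fin.suc))) ∎
      where open ≡-Reasoning
    -- Matching on a copy of `s` keeps `rest`, which is stated for `s`, usable in both cases.
    by-head : ∀ t → t ≡ s → subsetSum e a (t ∷ X) ≡ a ⊕ ⊕-sum (map e (filter (_∈? (t ∷ X)) (allFin (suc q))))
    by-head inside  refl = trans (rest (a ⊕ e Fin.zero)) (⊕-assoc a (e Fin.zero) _)
    by-head outside refl = rest a

  elementSum-subsetSum : ∀ (X : Subset p) → elementSum X ≡ subsetSum id 0# X
  elementSum-subsetSum X = sym (trans (subsetSum-foldr id 0# X)
    (trans (⊕-identityˡ _) (cong ⊕-sum (List.map-id (filter (_∈? X) (allFin p))))))

  -- The Boolean to which the test in `subsetsOfSize` reduces, since `does` of a product of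
  -- decisions is a conjunction.
  admissible : ∀ {q} → Subset q → ℕ → Subset q → Bool
  admissible A ℓ X = does (X ⊆? A) ∧ does (∣ X ∣ ℕ.≟ ℓ)

  -- `allSubsets` branches on the first coordinate just as `selections` branches on the head. If
  -- that coordinate lies outside A, the branch containing it contributes nothing.
  sum-subsetsOfSize : ∀ φ {q} (e : Fin q → Fin p) A ℓ a →
    listSum (λ X → if admissible A ℓ X then φ (subsetSum e a X) else 0) (allSubsets q)
      ≡ selections φ (e ∘ elements A) ℓ a
  sum-subsetsOfSize φ e [] zero    a = ℕ.+-identityʳ _
  sum-subsetsOfSize φ e [] (suc ℓ) a = refl
  sum-subsetsOfSize φ {suc q} e (s ∷ A) ℓ a = begin
    listSum w (map (inside ∷_) (allSubsets q) ++ map (outside ∷_) (allSubsets q))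
      ≡⟨ listSum-++ w (map (inside ∷_) (allSubsets q)) _ ⟩
    listSum w (map (inside ∷_) (allSubsets q)) ℕ.+ listSum w (map (outside ∷_) (allSubsets q))
      ≡⟨ cong₂ ℕ._+_ (listSum-map w (inside ∷_) (allSubsets q)) (listSum-map w (outside ∷_) (allSubsets q)) ⟩
    listSum (w ∘ (inside ∷_)) (allSubsets q) ℕ.+ listSum (w ∘ (outside ∷_)) (allSubsets q)
      ≡⟨ cong (listSum (w ∘ (inside ∷_)) (allSubsets q) ℕ.+_) (sum-subsetsOfSize φ (e ∘ Fin.suc) A ℓ a) ⟩
    listSum (w ∘ (inside ∷_)) (allSubsets q) ℕ.+ selections φ (e ∘ Fin.suc ∘ elements A) ℓ a
      ≡⟨ by-cases s ℓ refl refl ⟩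
    selections φ (e ∘ elements (s ∷ A)) ℓ a ∎
    where
    open ≡-Reasoning
    w : Subset (suc q) → ℕ
    w X = if admissible (s ∷ A) ℓ X then φ (subsetSum e a X) else 0
    by-cases : ∀ t k → t ≡ s → k ≡ ℓ →
      listSum (w ∘ (inside ∷_)) (allSubsets q) ℕ.+ selections φ (e ∘ Fin.suc ∘ elements A) k a
        ≡ selections φ (e ∘ elements (t ∷ A)) k a
    by-cases outside k       refl refl = cong (ℕ._+ selections φ (e ∘ Fin.suc ∘ elements A) k a) (listSum-zero (allSubsets q))
    -- A subset containing the first coordinate cannot have size 0, so only the branch omitting it
    -- remains.
    by-cases inside  zero    refl refl = cong (ℕ._+ φ a)
      (trans (listSum-cong (λ X → cong (λ b → if b then φ (subsetSum e a (inside ∷ X)) else 0)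
                                       (∧-zeroʳ (does (X ⊆? A))))
                           (allSubsets q))
             (listSum-zero (allSubsets q)))
    by-cases inside  (suc k) refl refl =
      trans (cong (ℕ._+ selections φ (e ∘ Fin.suc ∘ elements A) (suc k) a) (sum-subsetsOfSize φ (e ∘ Fin.suc) A k (a ⊕ e Fin.zero)))
            (ℕ.+-comm (selections φ (e ∘ Fin.suc ∘ elements A) k (a ⊕ e Fin.zero)) _)

  length-subsetsOfSize : ∀ (A : Subset p) ℓ → length (subsetsOfSize A ℓ) ≡ ∣ A ∣ C ℓ
  length-subsetsOfSize A ℓ = begin
    length (subsetsOfSize A ℓ)                ≡⟨ length-as-listSum (subsetsOfSize A ℓ) ⟩
    listSum (const 1) (subsetsOfSize A ℓ)     ≡⟨ listSum-filter (λ X → (X ⊆? A) ×-dec (∣ X ∣ ℕ.≟ ℓ)) (const 1) (allSubsets p) ⟩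
    _                                         ≡⟨ sum-subsetsOfSize (const 1) id A ℓ 0# ⟩
    selections (const 1) (elements A) ℓ 0#    ≡⟨ selections-const (elements A) ℓ 0# ⟩
    ∣ A ∣ C ℓ                                 ∎
    where open ≡-Reasoning

  count-subsetsOfSize : ∀ (A : Subset p) ℓ x →
    length (filter (λ X → elementSum X Fin.≟ x) (subsetsOfSize A ℓ)) ≡ selections (δ x) (elements A) ℓ 0#
  count-subsetsOfSize A ℓ x = begin
    length (filter (λ X → elementSum X Fin.≟ x) (subsetsOfSize A ℓ))
      ≡⟨ length-as-listSum (filter (λ X → elementSum X Fin.≟ x) (subsetsOfSize A ℓ)) ⟩
    listSum (const 1) (filter (λ X → elementSum X Fin.≟ x) (subsetsOfSize A ℓ))
      ≡⟨ listSum-filter (λ X → elementSum X Fin.≟ x) (const 1) (subsetsOfSize A ℓ) ⟩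
    listSum (λ X → δ x (elementSum X)) (subsetsOfSize A ℓ)
      ≡⟨ listSum-filter (λ X → (X ⊆? A) ×-dec (∣ X ∣ ℕ.≟ ℓ)) _ (allSubsets p) ⟩
    listSum (λ X → if admissible A ℓ X then δ x (elementSum X) else 0) (allSubsets p)
      ≡⟨ listSum-cong (λ X → cong (λ a → if admissible A ℓ X then δ x a else 0) (elementSum-subsetSum X))
                      (allSubsets p) ⟩
    listSum (λ X → if admissible A ℓ X then δ x (subsetSum id 0# X) else 0) (allSubsets p)
      ≡⟨ sum-subsetsOfSize (δ x) id A ℓ 0# ⟩
    selections (δ x) (elements A) ℓ 0# ∎
    where open ≡-Reasoning

-- Rational arithmetic and its embedding into the reals

ι : ℕ → ℚ
ι n = + n / 1

ι-+ : ∀ m n → ι (m ℕ.+ n) ≡ ι m ℚ.+ ι n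
ι-+ m n = ℚ.toℚᵘ-injective (begin
  toℚᵘ (ι (m ℕ.+ n))                    ≈⟨ ℚ.toℚᵘ-fromℚᵘ (mkℚᵘ (+ (m ℕ.+ n)) 0) ⟩
  mkℚᵘ (+ (m ℕ.+ n)) 0                  ≈⟨ *≡* (cong (ℤ._* + 1) (sym (cong₂ ℤ._+_ (ℤ.*-identityʳ (+ m)) (ℤ.*-identityʳ (+ n))))) ⟩
  mkℚᵘ (+ m) 0 ℚᵘ.+ mkℚᵘ (+ n) 0        ≈⟨ ℚᵘ.+-cong (ℚ.toℚᵘ-fromℚᵘ (mkℚᵘ (+ m) 0)) (ℚ.toℚᵘ-fromℚᵘ (mkℚᵘ (+ n) 0)) ⟨
  toℚᵘ (ι m) ℚᵘ.+ toℚᵘ (ι n)            ≈⟨ ℚ.toℚᵘ-homo-+ (ι m) (ι n) ⟨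
  toℚᵘ (ι m ℚ.+ ι n)                    ∎)
  where open ℚᵘ.≃-Reasoning

/-*-ι : ∀ i d n .{{_ : NonZero d}} → (i / d) ℚ.* ι n ≡ (i ℤ.* + n) / d
/-*-ι i d@(suc d-1) n = ℚ.toℚᵘ-injective (begin
  toℚᵘ ((i / d) ℚ.* ι n)                ≈⟨ ℚ.toℚᵘ-homo-* (i / d) (ι n) ⟩
  toℚᵘ (i / d) ℚᵘ.* toℚᵘ (ι n)          ≈⟨ ℚᵘ.*-cong (ℚ.toℚᵘ-fromℚᵘ (mkℚᵘ i d-1)) (ℚ.toℚᵘ-fromℚᵘ (mkℚᵘ (+ n) 0)) ⟩
  mkℚᵘ i d-1 ℚᵘ.* mkℚᵘ (+ n) 0          ≈⟨ *≡* (cong (λ e → i ℤ.* + n ℤ.* + e) (sym (ℕ.*-identityʳ d))) ⟩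
  mkℚᵘ (i ℤ.* + n) d-1                  ≈⟨ ℚ.toℚᵘ-fromℚᵘ (mkℚᵘ (i ℤ.* + n) d-1) ⟨
  toℚᵘ ((i ℤ.* + n) / d)                ∎)
  where open ℚᵘ.≃-Reasoning

ι-* : ∀ m n → ι (m ℕ.* n) ≡ ι m ℚ.* ι n
ι-* m n = trans (cong (_/ 1) (ℤ.pos-* m n)) (sym (/-*-ι (+ m) 1 n))

/-*-cancel : ∀ i d .{{_ : NonZero d}} → (i / d) ℚ.* ι d ≡ i / 1
/-*-cancel i d@(suc d-1) = trans (/-*-ι i d d) (ℚ.fromℚᵘ-cong
  {mkℚᵘ (i ℤ.* + d) d-1} {mkℚᵘ i 0} (*≡* (ℤ.*-identityʳ (i ℤ.* + d))))

ι-mono-≤ : ∀ {m n} → m ℕ.≤ n → ι m ℚ.≤ ι n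
ι-mono-≤ {m} {n} m≤n = ℚ.toℚᵘ-cancel-≤ (begin
  toℚᵘ (ι m)      ≃⟨ ℚ.toℚᵘ-fromℚᵘ (mkℚᵘ (+ m) 0) ⟩
  mkℚᵘ (+ m) 0    ≤⟨ *≤* (ℤ.*-monoʳ-≤-nonNeg (+ 1) (ℤ.+≤+ m≤n)) ⟩
  mkℚᵘ (+ n) 0    ≃⟨ ℚ.toℚᵘ-fromℚᵘ (mkℚᵘ (+ n) 0) ⟨
  toℚᵘ (ι n)      ∎)
  where open ℚᵘ.≤-Reasoning

ι-cancel-≤ : ∀ {m n} → ι m ℚ.≤ ι n → m ℕ.≤ n
ι-cancel-≤ {m} {n} ιm≤ιn with ((begin
  mkℚᵘ (+ m) 0    ≃⟨ ℚ.toℚᵘ-fromℚᵘ (mkℚᵘ (+ m) 0) ⟨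
  toℚᵘ (ι m)      ≤⟨ ℚ.toℚᵘ-mono-≤ ιm≤ιn ⟩
  toℚᵘ (ι n)      ≃⟨ ℚ.toℚᵘ-fromℚᵘ (mkℚᵘ (+ n) 0) ⟩
  mkℚᵘ (+ n) 0    ∎))
  where open ℚᵘ.≤-Reasoning
... | *≤* m*1≤n*1 = ℤ.drop‿+≤+ (subst₂ ℤ._≤_ (ℤ.*-identityʳ (+ m)) (ℤ.*-identityʳ (+ n)) m*1≤n*1)

ι-mono-< : ∀ {m n} → m ℕ.< n → ι m ℚ.< ι n
ι-mono-< {m} {n} m<n = ℚ.≰⇒> (λ ιn≤ιm → ℕ.<⇒≱ m<n (ι-cancel-≤ {n} {m} ιn≤ιm))

ι-cancel-< : ∀ {m n} → ι m ℚ.< ι n → m ℕ.< n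
ι-cancel-< {m} {n} ιm<ιn = ℕ.≰⇒> (λ n≤m → ℚ.<-irrefl refl (ℚ.<-≤-trans ιm<ιn (ι-mono-≤ {n} {m} n≤m)))

0≤ι : ∀ n → 0ℚ ℚ.≤ ι n
0≤ι n = ι-mono-≤ {0} {n} z≤n

0<ι : ∀ n .{{_ : NonZero n}} → 0ℚ ℚ.< ι n
0<ι (suc n) = ι-mono-< {0} {suc n} ℕ.z<s

*-monoˡ-≤ : ∀ {r p q} → 0ℚ ℚ.≤ r → p ℚ.≤ q → r ℚ.* p ℚ.≤ r ℚ.* q
*-monoˡ-≤ {r} 0≤r = ℚ.*-monoˡ-≤-nonNeg r {{ℚ.nonNegative 0≤r}}

*-monoʳ-≤ : ∀ {r p q} → 0ℚ ℚ.≤ r → p ℚ.≤ q → p ℚ.* r ℚ.≤ q ℚ.* r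
*-monoʳ-≤ {r} 0≤r = ℚ.*-monoʳ-≤-nonNeg r {{ℚ.nonNegative 0≤r}}

*-mono-≤ : ∀ {p q r s} → 0ℚ ℚ.≤ r → 0ℚ ℚ.≤ q → p ℚ.≤ q → r ℚ.≤ s → p ℚ.* r ℚ.≤ q ℚ.* s
*-mono-≤ 0≤r 0≤q p≤q r≤s = ℚ.≤-trans (*-monoʳ-≤ 0≤r p≤q) (*-monoˡ-≤ 0≤q r≤s)

*-monoˡ-< : ∀ {r p q} → 0ℚ ℚ.< r → p ℚ.< q → r ℚ.* p ℚ.< r ℚ.* q
*-monoˡ-< {r} 0<r = ℚ.*-monoʳ-<-pos r {{ℚ.positive 0<r}}

*-monoʳ-< : ∀ {r p q} → 0ℚ ℚ.< r → p ℚ.< q → p ℚ.* r ℚ.< q ℚ.* r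
*-monoʳ-< {r} 0<r = ℚ.*-monoˡ-<-pos r {{ℚ.positive 0<r}}

*-cancelʳ-≤ : ∀ {r p q} → 0ℚ ℚ.< r → p ℚ.* r ℚ.≤ q ℚ.* r → p ℚ.≤ q
*-cancelʳ-≤ {r} 0<r = ℚ.*-cancelʳ-≤-pos r {{ℚ.positive 0<r}}

*-cancelʳ-< : ∀ {r p q} → 0ℚ ℚ.≤ r → p ℚ.* r ℚ.< q ℚ.* r → p ℚ.< q
*-cancelʳ-< {r} 0≤r = ℚ.*-cancelʳ-<-nonNeg r {{ℚ.nonNegative 0≤r}}

0<* : ∀ {p q} → 0ℚ ℚ.< p → 0ℚ ℚ.< q → 0ℚ ℚ.< p ℚ.* q
0<* {p} {q} 0<p 0<q = ℚ.positive⁻¹ (p ℚ.* q) {{ℚ.pos*pos⇒pos p {{ℚ.positive 0<p}} q {{ℚ.positive 0<q}}}}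

0≤* : ∀ {p q} → 0ℚ ℚ.≤ p → 0ℚ ℚ.≤ q → 0ℚ ℚ.≤ p ℚ.* q
0≤* {p} {q} 0≤p 0≤q = ℚ.nonNegative⁻¹ (p ℚ.* q) {{ℚ.nonNeg*nonNeg⇒nonNeg p {{ℚ.nonNegative 0≤p}} q {{ℚ.nonNegative 0≤q}}}}

0≤/ : ∀ k d .{{_ : NonZero d}} → 0ℚ ℚ.≤ + k / d
0≤/ k d = *-cancelʳ-≤ (0<ι d) (subst₂ ℚ._≤_ (sym (ℚ.*-zeroˡ (ι d))) (sym (/-*-cancel (+ k) d)) (0≤ι k))

0<1/ : ∀ d .{{_ : NonZero d}} → 0ℚ ℚ.< + 1 / d
0<1/ d = *-cancelʳ-< (0≤ι d) (subst₂ ℚ._<_ (sym (ℚ.*-zeroˡ (ι d))) (sym (/-*-cancel (+ 1) d)) (0<ι 1))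

ratio-≤ : ∀ {k n β} → 0ℚ ℚ.≤ β → ι k ℚ.≤ β ℚ.* ι n → ratio k n ℚ.≤ β
-- An empty sample space has the default value 0, which is where `0≤β` enters.
ratio-≤ {k} {zero}  0≤β _    = 0≤β
ratio-≤ {k} {suc n} 0≤β k≤βn = *-cancelʳ-≤ (0<ι (suc n))
  (ℚ.≤-trans (ℚ.≤-reflexive (/-*-cancel (+ k) (suc n))) k≤βn)

≤-by-ε : ∀ {x y} → (∀ ε → 0ℚ ℚ.< ε → x ℚ.≤ y ℚ.+ ε) → x ℚ.≤ y
≤-by-ε {x} {y} h = ℚ.≮⇒≥ λ y<x →
  let m , y<m , m<x = ℚ.<-dense y<x
      0<m-y = subst (ℚ._< m ℚ.- y) (ℚ.+-inverseʳ y) (ℚ.+-monoˡ-< (ℚ.- y) y<m)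
  in ℚ.<-irrefl refl (ℚ.<-≤-trans m<x (subst (x ℚ.≤_)
       (solve 2 (λ m y → y :+ (m :- y) := m) refl m y) (h (m ℚ.- y) 0<m-y)))

p≤p+ε : ∀ p {ε} → 0ℚ ℚ.< ε → p ℚ.≤ p ℚ.+ ε
p≤p+ε p 0<ε = subst (ℚ._≤ p ℚ.+ _) (ℚ.+-identityʳ p) (ℚ.+-monoʳ-≤ p (ℚ.<⇒≤ 0<ε))

termwise-≤ᴿ : ∀ {x y} N → (∀ n → N ℕ.≤ n → seq x n ℚ.≤ seq y n) → x ≤ᴿ y
termwise-≤ᴿ {x} {y} N x≤y ε 0<ε = N , λ n n≥N → ℚ.≤-trans (x≤y n n≥N) (p≤p+ε (seq y n) 0<ε)

fromℚ-≤ : ∀ {p q} → p ℚ.≤ q → fromℚ p ≤ᴿ fromℚ q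
fromℚ-≤ {p} {q} p≤q = termwise-≤ᴿ {fromℚ p} {fromℚ q} 0 (λ _ _ → p≤q)

<⇒gap : ∀ {p q} → p ℚ.< q → ∃ λ ε → 0ℚ ℚ.< ε × p ℚ.+ ε ℚ.≤ q
<⇒gap {p} {q} p<q = q ℚ.- p
  , subst (ℚ._< q ℚ.- p) (ℚ.+-inverseʳ p) (ℚ.+-monoˡ-< (ℚ.- p) p<q)
  , ℚ.≤-reflexive (solve 2 (λ p q → p :+ (q :- p) := q) refl p q)

seq-sumᴿ : ∀ {n} (f : Fin n → ℝ) i → seq (sumᴿ f) i ≡ Σℚ.sum (λ y → seq (f y) i)
seq-sumᴿ {zero}  f i = refl
seq-sumᴿ {suc n} f i = cong (seq (f Fin.zero) i ℚ.+_) (seq-sumᴿ (f ∘ Fin.suc) i)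

ι-sum : ∀ {n} (f : Fin n → ℕ) → ι (Σℕ.sum f) ≡ Σℚ.sum (ι ∘ f)
ι-sum {zero}  f = refl
ι-sum {suc n} f = trans (ι-+ (f Fin.zero) _) (cong (ι (f Fin.zero) ℚ.+_) (ι-sum (f ∘ Fin.suc)))

numerator-denominator : ∀ q → 0ℚ ℚ.≤ q → ∃₂ λ P Q → NonZero Q × q ℚ.* ι Q ≡ ι P
numerator-denominator q@(mkℚ (+ P) d _) 0≤q = P , suc d , _ ,
  trans (cong (ℚ._* ι (suc d)) (sym (ℚ.↥p/↧p≡p q))) (/-*-cancel (+ P) (suc d))
numerator-denominator (mkℚ ℤ.-[1+ P ] d _) (ℚ.*≤* ())

-- The contraction hypothesis for counting laws

-- The contraction hypothesis restricted to laws of sums of k entries, with denominators cleared and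
-- C₃ replaced by a rational, so that reals no longer occur.
Contracts : (p : ℕ) .{{_ : NonZero p}} → ℚ → Set
Contracts p c = ∀ lam → 0ℚ ℚ.< lam → lam ℚ.≤ + 9 / 10 → ι 2 ℚ.< ι p ℚ.* lam →
  ∀ {n} .{{_ : NonZero n}} (vs : Vector (Fin p) n) k →
  (∀ y → ι (law vs k y) ℚ.≤ lam ℚ.* ι (n ℕ.^ k)) →
  ∀ x → ι (law vs (k ℕ.+ (k ℕ.+ k)) x) ℚ.≤ c ℚ.* lam ℚ.* ι (n ℕ.^ (k ℕ.+ (k ℕ.+ k)))

-- The test is a Boolean argument so that the conditional can be resolved underneath `seq`; the cube
-- of d clears the three denominators.
scale-term : ∀ (e : Bool) q r s d i {j k l} → q ℚ.* d ≡ ι j → r ℚ.* d ≡ ι k → s ℚ.* d ≡ ι l →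
  seq (if e then fromℚ q *ᴿ fromℚ r *ᴿ fromℚ s else fromℕ 0) i ℚ.* (d ℚ.* d ℚ.* d)
    ≡ ι (j ℕ.* (k ℕ.* (l ℕ.* (if e then 1 else 0))))
scale-term true q r s d i {j} {k} {l} qd rd sd = begin
  q ℚ.* r ℚ.* s ℚ.* (d ℚ.* d ℚ.* d)
    ≡⟨ solve 4 (λ q r s d → q :* r :* s :* (d :* d :* d) := (q :* d) :* ((r :* d) :* (s :* d)))
             refl q r s d ⟩
  (q ℚ.* d) ℚ.* ((r ℚ.* d) ℚ.* (s ℚ.* d))
    ≡⟨ cong₂ ℚ._*_ qd (cong₂ ℚ._*_ rd sd) ⟩
  ι j ℚ.* (ι k ℚ.* ι l)             ≡⟨ cong (ι j ℚ.*_) (ι-* k l) ⟨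
  ι j ℚ.* ι (k ℕ.* l)               ≡⟨ ι-* j (k ℕ.* l) ⟨
  ι (j ℕ.* (k ℕ.* l))               ≡⟨ cong (λ m → ι (j ℕ.* (k ℕ.* m))) (ℕ.*-identityʳ l) ⟨
  ι (j ℕ.* (k ℕ.* (l ℕ.* 1)))       ∎
  where open ≡-Reasoning
scale-term false q r s d i {j} {k} {l} _ _ _ =
  trans (ℚ.*-zeroˡ (d ℚ.* d ℚ.* d)) (cong ι {0} (sym (zeros j k l)))
  where
  zeros : ∀ j k l → j ℕ.* (k ℕ.* (l ℕ.* 0)) ≡ 0
  zeros = solve-∀

module _ {p : ℕ} .{{_ : NonZero p}} {n : ℕ} .{{_ : NonZero n}} (vs : Vector (Fin p) n) (k : ℕ) where

  private
    D : ℕ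
    D = n ℕ.^ k

    instance
      D≢0 : NonZero D
      D≢0 = ℕ.m^n≢0 n k

  lawℚ : Fin p → ℚ
  lawℚ y = + law vs k y / D

  lawℚ-scale : ∀ y → lawℚ y ℚ.* ι D ≡ ι (law vs k y)
  lawℚ-scale y = /-*-cancel (+ law vs k y) D

  sum-lawℚ : Σℚ.sum lawℚ ℚ.* ι D ≡ 1ℚ ℚ.* ι D
  sum-lawℚ = begin
    Σℚ.sum lawℚ ℚ.* ι D                ≡⟨ Σℚ.*-distribʳ-sum (ι D) lawℚ ⟩
    Σℚ.sum (λ y → lawℚ y ℚ.* ι D)      ≡⟨ Σℚ.sum-cong-≗ lawℚ-scale ⟩
    Σℚ.sum (λ y → ι (law vs k y))      ≡⟨ ι-sum (law vs k) ⟨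
    ι (Σℕ.sum (law vs k))              ≡⟨ cong ι (sum-law vs k) ⟩
    ι D                                ≡⟨ ℚ.*-identityˡ (ι D) ⟨
    1ℚ ℚ.* ι D                         ∎
    where open ≡-Reasoning

  lawℚ-distribution : IsDistribution (fromℚ ∘ lawℚ)
  lawℚ-distribution = (λ y → fromℚ-≤ {0ℚ} {lawℚ y} (0≤/ (law vs k y) D))
    , termwise-≤ᴿ {sumᴿ (fromℚ ∘ lawℚ)} {fromℕ 1} 0 (λ i _ → ℚ.≤-trans (ℚ.≤-reflexive (seq-sumᴿ (fromℚ ∘ lawℚ) i))
                                       (*-cancelʳ-≤ (0<ι D) (ℚ.≤-reflexive sum-lawℚ)))
    , termwise-≤ᴿ {fromℕ 1} {sumᴿ (fromℚ ∘ lawℚ)} 0 (λ i _ → ℚ.≤-trans (*-cancelʳ-≤ (0<ι D) (ℚ.≤-reflexive (sym sum-lawℚ)))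
                                       (ℚ.≤-reflexive (sym (seq-sumᴿ (fromℚ ∘ lawℚ) i))))

  private
    ιD³ : ℚ
    ιD³ = ι D ℚ.* ι D ℚ.* ι D

  threefold-term : ∀ (x a b c : Fin p) i →
    seq (if does (a ⊕ b ⊕ c Fin.≟ x)
         then fromℚ (lawℚ a) *ᴿ fromℚ (lawℚ b) *ᴿ fromℚ (lawℚ c)
         else fromℕ 0) i ℚ.* ιD³
      ≡ ι (law vs k a ℕ.* (law vs k b ℕ.* (law vs k c ℕ.* δ x (a ⊕ b ⊕ c))))
  threefold-term x a b c i =
    scale-term (does (a ⊕ b ⊕ c Fin.≟ x)) (lawℚ a) (lawℚ b) (lawℚ c) (ι D) i
      {law vs k a} {law vs k b} {law vs k c}
      (lawℚ-scale a) (lawℚ-scale b) (lawℚ-scale c)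

  -- All summands share the denominator `D` cubed. The equation holds at every index i, so this real
  -- number is represented by a constant sequence.
  threefold-lawℚ : ∀ x i →
    seq (threefoldSumProb (fromℚ ∘ lawℚ) x) i ℚ.* ιD³ ≡ ι (law vs (k ℕ.+ (k ℕ.+ k)) x)
  threefold-lawℚ x i = begin
    seq (threefoldSumProb (fromℚ ∘ lawℚ) x) i ℚ.* ιD³
      ≡⟨ push (λ a → sumᴿ λ b → sumᴿ λ c → term a b c) (λ a →
           push (λ b → sumᴿ λ c → term a b c) (λ b →
             push (term a b) (λ c → threefold-term x a b c i))) ⟩
    ι (Σℕ.sum λ a → Σℕ.sum λ b → Σℕ.sum λ c → l a ℕ.* (l b ℕ.* (l c ℕ.* δ x (a ⊕ b ⊕ c))))
      ≡⟨ cong ι (begin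
        (Σℕ.sum λ a → Σℕ.sum λ b → Σℕ.sum λ c → l a ℕ.* (l b ℕ.* (l c ℕ.* δ x (a ⊕ b ⊕ c))))
          ≡⟨ Σℕ.sum-cong-≗ (λ a → trans (Σℕ.sum-cong-≗ (λ b →
               trans (sym (Σℕ.*-distribˡ-sum (l a) (λ c → l b ℕ.* (l c ℕ.* δ x (a ⊕ b ⊕ c)))))
                     (cong (l a ℕ.*_) (sym (Σℕ.*-distribˡ-sum (l b) (λ c → l c ℕ.* δ x (a ⊕ b ⊕ c)))))))
               (sym (Σℕ.*-distribˡ-sum (l a) (λ b → l b ℕ.* Σℕ.sum (λ c → l c ℕ.* δ x (a ⊕ b ⊕ c)))))) ⟩
        (Σℕ.sum λ a → l a ℕ.* Σℕ.sum λ b → l b ℕ.* Σℕ.sum λ c → l c ℕ.* δ x (a ⊕ b ⊕ c))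
          ≡⟨ law-threefold vs k x ⟨
        law vs (k ℕ.+ (k ℕ.+ k)) x ∎) ⟩
    ι (law vs (k ℕ.+ (k ℕ.+ k)) x) ∎
    where
    open ≡-Reasoning
    l : Fin p → ℕ
    l = law vs k
    term : Fin p → Fin p → Fin p → ℝ
    term a b c = if does (a ⊕ b ⊕ c Fin.≟ x)
                 then fromℚ (lawℚ a) *ᴿ fromℚ (lawℚ b) *ᴿ fromℚ (lawℚ c)
                 else fromℕ 0
    push : ∀ {m} (f : Fin m → ℝ) {g : Fin m → ℕ} → (∀ y → seq (f y) i ℚ.* ιD³ ≡ ι (g y)) →
      seq (sumᴿ f) i ℚ.* ιD³ ≡ ι (Σℕ.sum g)
    push f {g} f≡g = begin
      seq (sumᴿ f) i ℚ.* ιD³                   ≡⟨ cong (ℚ._* ιD³) (seq-sumᴿ f i) ⟩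
      Σℚ.sum (λ y → seq (f y) i) ℚ.* ιD³       ≡⟨ Σℚ.*-distribʳ-sum ιD³ (λ y → seq (f y) i) ⟩
      Σℚ.sum (λ y → seq (f y) i ℚ.* ιD³)       ≡⟨ Σℚ.sum-cong-≗ f≡g ⟩
      Σℚ.sum (ι ∘ g)                           ≡⟨ ι-sum g ⟨
      ι (Σℕ.sum g)                             ∎

  ι-cube : ιD³ ≡ ι (n ℕ.^ (k ℕ.+ (k ℕ.+ k)))
  ι-cube = sym (begin
    ι (n ℕ.^ (k ℕ.+ (k ℕ.+ k)))    ≡⟨ cong ι (trans (ℕ.^-distribˡ-+-* n k (k ℕ.+ k))
                                                    (cong (D ℕ.*_) (ℕ.^-distribˡ-+-* n k k))) ⟩
    ι (D ℕ.* (D ℕ.* D))            ≡⟨ ι-* D (D ℕ.* D) ⟩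
    ι D ℚ.* ι (D ℕ.* D)            ≡⟨ cong (ι D ℚ.*_) (ι-* D D) ⟩
    ι D ℚ.* (ι D ℚ.* ι D)          ≡⟨ ℚ.*-assoc (ι D) (ι D) (ι D) ⟨
    ιD³                            ∎)
    where open ≡-Reasoning

  -- The hypothesis is applied to the law divided by `D`. At a large index C₃ is below c, and the
  -- remaining ε disappears because both sides are then rational constants.
  law-contraction : ∀ {C₃ c N₀} → ThreefoldContraction C₃ → Prime p →
    (∀ i → N₀ ℕ.≤ i → seq C₃ i ℚ.≤ c) →
    ∀ lam → 0ℚ ℚ.< lam → lam ℚ.≤ + 9 / 10 → ι 2 ℚ.< ι p ℚ.* lam →
    (∀ y → ι (law vs k y) ℚ.≤ lam ℚ.* ι D) →
    ∀ x → ι (law vs (k ℕ.+ (k ℕ.+ k)) x) ℚ.≤ c ℚ.* lam ℚ.* ι (n ℕ.^ (k ℕ.+ (k ℕ.+ k)))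
  law-contraction {C₃} {c} {N₀} contraction p-prime C₃≤c lam 0<lam lam≤ 2<pλ law≤ x =
    subst₂ ℚ._≤_ (threefold-lawℚ x 0) (cong (c ℚ.* lam ℚ.*_) ι-cube)
      (*-monoʳ-≤ (0≤* (0≤* (0≤ι D) (0≤ι D)) (0≤ι D)) (≤-by-ε {T 0} {c ℚ.* lam} bound))
    where
    T : ℕ → ℚ
    T = seq (threefoldSumProb (fromℚ ∘ lawℚ) x)
    -- The real inequality gives information at large indices, whereas the count is read off at
    -- index 0.
    T-const : ∀ i → T 0 ≡ T i
    T-const i = ℚ.≤-antisym
      (*-cancelʳ-≤ 0<ιD³ (ℚ.≤-reflexive (trans (threefold-lawℚ x 0) (sym (threefold-lawℚ x i)))))
      (*-cancelʳ-≤ 0<ιD³ (ℚ.≤-reflexive (trans (threefold-lawℚ x i) (sym (threefold-lawℚ x 0)))))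
      where
      0<ιD³ : 0ℚ ℚ.< ιD³
      0<ιD³ = 0<* (0<* (0<ι D) (0<ι D)) (0<ι D)
    bound : ∀ ε → 0ℚ ℚ.< ε → T 0 ℚ.≤ c ℚ.* lam ℚ.+ ε
    bound ε 0<ε =
      let g₁ , 0<g₁ , 0+g₁≤lam = <⇒gap 0<lam
          g₂ , 0<g₂ , 2+g₂≤pλ = <⇒gap 2<pλ
          N , T≤C₃λ = contraction (fromℚ lam) (g₁ , 0<g₁ , 0 , λ _ _ → 0+g₁≤lam)
            (fromℚ-≤ {lam} {+ 9 / 10} lam≤) p p-prime (g₂ , 0<g₂ , 0 , λ _ _ → 2+g₂≤pλ)
            (fromℚ ∘ lawℚ) lawℚ-distribution
            (λ y → fromℚ-≤ {lawℚ y} {lam} (*-cancelʳ-≤ (0<ι D) (ℚ.≤-trans (ℚ.≤-reflexive (lawℚ-scale y)) (law≤ y))))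
            x ε 0<ε
          i = N ℕ.⊔ N₀
      in ℚ.≤-trans (ℚ.≤-reflexive (T-const i)) (ℚ.≤-trans (T≤C₃λ i (ℕ.m≤m⊔n N N₀))
           (ℚ.+-monoˡ-≤ ε (*-monoʳ-≤ (ℚ.<⇒≤ 0<lam) (C₃≤c i (ℕ.m≤n⊔m N N₀)))))

contracts : ∀ {C₃ c N₀} → ThreefoldContraction C₃ → (∀ i → N₀ ℕ.≤ i → seq C₃ i ℚ.≤ c) →
  ∀ p .{{_ : NonZero p}} → Prime p → Contracts p c
contracts {C₃} {c} {N₀} contraction C₃≤c p p-prime lam 0<lam lam≤ 2<pλ vs k law≤ =
  law-contraction vs k {C₃} {c} {N₀} contraction p-prime C₃≤c lam 0<lam lam≤ 2<pλ law≤

-- Iterated contraction and the rational concentration bound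

^ℚ-pos : ∀ {c} → 0ℚ ℚ.< c → ∀ m → 0ℚ ℚ.< c ^ℚ m
^ℚ-pos 0<c zero    = ℚ.positive⁻¹ 1ℚ
^ℚ-pos 0<c (suc m) = 0<* 0<c (^ℚ-pos 0<c m)

^ℚ-≤1 : ∀ {c} → 0ℚ ℚ.< c → c ℚ.≤ 1ℚ → ∀ m → c ^ℚ m ℚ.≤ 1ℚ
^ℚ-≤1     0<c c≤1 zero    = ℚ.≤-refl
^ℚ-≤1 {c} 0<c c≤1 (suc m) = ℚ.≤-trans
  (*-mono-≤ (ℚ.<⇒≤ (^ℚ-pos 0<c m)) (ℚ.<⇒≤ (ℚ.positive⁻¹ 1ℚ)) c≤1 (^ℚ-≤1 0<c c≤1 m))
  (ℚ.≤-reflexive (ℚ.*-identityˡ 1ℚ))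

-- The origin of the condition 3 ≤ n: the contraction starts from λ = 2/n, and 2/3 ≤ 9/10 while 2/2
-- is too large.
2/n≤9/10 : ∀ n .{{_ : NonZero n}} → 3 ℕ.≤ n → + 2 / n ℚ.≤ + 9 / 10
2/n≤9/10 n 3≤n = *-cancelʳ-≤ (0<ι n) (begin
  (+ 2 / n) ℚ.* ι n      ≡⟨ /-*-cancel (+ 2) n ⟩
  ι 2                    ≤⟨ ℚ.≤ᵇ⇒≤ _ ⟩
  (+ 9 / 10) ℚ.* ι 3     ≤⟨ *-monoˡ-≤ (0≤/ 9 10) (ι-mono-≤ {3} {n} 3≤n) ⟩
  (+ 9 / 10) ℚ.* ι n     ∎)
  where open ℚ.≤-Reasoning

-- The factors are m contractions, the initial bound 1/M ≤ 2/n for a family of M ≥ n/2 elements, and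
-- the cost of sampling without replacement.
concentration : ℚ → (n : ℕ) .{{_ : NonZero n}} → ℕ → (D : ℕ) .{{_ : NonZero D}} → ℚ
concentration c n m D = c ^ℚ m ℚ.* (+ 2 / n) ℚ.* (+ suc D / D)

module _ {p : ℕ} .{{_ : NonZero p}} {c : ℚ} (contr : Contracts p c) (0<c : 0ℚ ℚ.< c) (c≤1 : c ℚ.≤ 1ℚ)
         {n : ℕ} .{{_ : NonZero n}} (3≤n : 3 ℕ.≤ n) where

  law-iterate : ∀ {M} .{{_ : NonZero M}} (vs : Vector (Fin p) M) → Injective _≡_ _≡_ vs → n ℕ.≤ 2 ℕ.* M →
    ∀ m → (∀ j → j ℕ.< m → ι n ℚ.< ι p ℚ.* c ^ℚ j) →
    ∀ y → ι (law vs (3 ℕ.^ m) y) ℚ.≤ c ^ℚ m ℚ.* (+ 2 / n) ℚ.* ι (M ℕ.^ (3 ℕ.^ m))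
  law-iterate {M} vs vs-inj n≤2M zero    _     y = begin
    ι (law vs 1 y)                            ≤⟨ ι-mono-≤ {law vs 1 y} {1} (law-one-≤ vs vs-inj y) ⟩
    1ℚ                                        ≤⟨ *-cancelʳ-≤ (0<ι n) scaled ⟩
    1ℚ ℚ.* (+ 2 / n) ℚ.* ι M                  ≡⟨ cong (λ d → 1ℚ ℚ.* (+ 2 / n) ℚ.* ι d) (ℕ.*-identityʳ M) ⟨
    1ℚ ℚ.* (+ 2 / n) ℚ.* ι (M ℕ.^ 1)          ∎
    where
    open ℚ.≤-Reasoning
    scaled : 1ℚ ℚ.* ι n ℚ.≤ 1ℚ ℚ.* (+ 2 / n) ℚ.* ι M ℚ.* ι n
    scaled = begin
      1ℚ ℚ.* ι n                           ≡⟨ ℚ.*-identityˡ (ι n) ⟩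
      ι n                                  ≤⟨ ι-mono-≤ {n} {2 ℕ.* M} n≤2M ⟩
      ι (2 ℕ.* M)                          ≡⟨ ι-* 2 M ⟩
      ι 2 ℚ.* ι M                          ≡⟨ cong (ℚ._* ι M) (/-*-cancel (+ 2) n) ⟨
      (+ 2 / n) ℚ.* ι n ℚ.* ι M            ≡⟨ solve 3 (λ l n M → l :* n :* M := con 1ℚ :* l :* M :* n) refl (+ 2 / n) (ι n) (ι M) ⟩
      1ℚ ℚ.* (+ 2 / n) ℚ.* ι M ℚ.* ι n     ∎
  law-iterate {M} vs vs-inj n≤2M (suc m) large y =
    subst₂ (λ k lam → ι (law vs k y) ℚ.≤ lam ℚ.* ι (M ℕ.^ k))
      -- `3 ^ suc m` unfolds to k + (k + (k + 0)); the first equation accounts for the 0.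
      (cong (λ l → k ℕ.+ (k ℕ.+ l)) (sym (ℕ.+-identityʳ k))) (sym (ℚ.*-assoc c (c ^ℚ m) (+ 2 / n)))
      (contr lam (0<* 0<cᵐ 0<2/n) lam≤9/10 2<pλ vs k
        (law-iterate vs vs-inj n≤2M m (λ j j<m → large j (ℕ.m<n⇒m<1+n j<m))) y)
    where
    open ℚ.≤-Reasoning
    k : ℕ
    k = 3 ℕ.^ m
    lam : ℚ
    lam = c ^ℚ m ℚ.* (+ 2 / n)
    0<cᵐ : 0ℚ ℚ.< c ^ℚ m
    0<cᵐ = ^ℚ-pos 0<c m
    0<2/n : 0ℚ ℚ.< + 2 / n
    0<2/n = *-cancelʳ-< (0≤ι n) (subst₂ ℚ._<_ (sym (ℚ.*-zeroˡ (ι n))) (sym (/-*-cancel (+ 2) n)) (0<ι 2))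
    lam≤9/10 : lam ℚ.≤ + 9 / 10
    lam≤9/10 = begin
      c ^ℚ m ℚ.* (+ 2 / n)    ≤⟨ *-monoʳ-≤ (ℚ.<⇒≤ 0<2/n) (^ℚ-≤1 0<c c≤1 m) ⟩
      1ℚ ℚ.* (+ 2 / n)        ≡⟨ ℚ.*-identityˡ (+ 2 / n) ⟩
      + 2 / n                 ≤⟨ 2/n≤9/10 n 3≤n ⟩
      + 9 / 10                ∎
    2<pλ : ι 2 ℚ.< ι p ℚ.* lam
    -- This is n < p cᵐ, the case j = m of `large`, multiplied by 2/n.
    2<pλ = *-cancelʳ-< (0≤ι n) (begin-strict
      ι 2 ℚ.* ι n                                  <⟨ *-monoˡ-< (0<ι 2) (large m ℕ.≤-refl) ⟩
      ι 2 ℚ.* (ι p ℚ.* c ^ℚ m)                     ≡⟨ cong (ℚ._* (ι p ℚ.* c ^ℚ m)) (/-*-cancel (+ 2) n) ⟨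
      (+ 2 / n) ℚ.* ι n ℚ.* (ι p ℚ.* c ^ℚ m)       ≡⟨ solve 4 (λ l n p c → l :* n :* (p :* c) := p :* (c :* l) :* n)
                                                              refl (+ 2 / n) (ι n) (ι p) (c ^ℚ m) ⟩
      ι p ℚ.* lam ℚ.* ι n                          ∎)

  -- Here j entries are revealed and k + x are left. Writing cᵐ · 2/n as a fraction P/Q makes the
  -- counting lemmas in ℕ applicable.
  selections-≤-sparse : ∀ m D .{{_ : NonZero D}} → (∀ j → j ℕ.< m → ι n ℚ.< ι p ℚ.* c ^ℚ j) →
    ∀ j x → n ≡ j ℕ.+ (3 ℕ.^ m ℕ.+ x) → n ℕ.≤ 2 ℕ.* (3 ℕ.^ m ℕ.+ x) →
    suc D ℕ.* (3 ℕ.^ m ℕ.* 3 ℕ.^ m) ℕ.≤ 3 ℕ.^ m ℕ.+ x →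
    ∀ (vs : Vector (Fin p) n) → Injective _≡_ _≡_ vs → ∀ b a →
    ι (selections (δ b) vs (j ℕ.+ 3 ℕ.^ m) a) ℚ.≤ concentration c n m D ℚ.* ι (n C (j ℕ.+ 3 ℕ.^ m))
  selections-≤-sparse m D large j x n≡ n≤2M D≤M vs vs-inj b a = *-cancelʳ-≤ (0<ι (D ℕ.* Q)) (begin
    ι sel ℚ.* ι (D ℕ.* Q)                  ≡⟨ ℚ.*-comm (ι sel) _ ⟩
    ι (D ℕ.* Q) ℚ.* ι sel                  ≡⟨ ι-* (D ℕ.* Q) sel ⟨
    ι (D ℕ.* Q ℕ.* sel)                    ≤⟨ ι-mono-≤ {D ℕ.* Q ℕ.* sel} {P ℕ.* suc D ℕ.* bin} (lifted n≡ vs vs-inj) ⟩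
    ι (P ℕ.* suc D ℕ.* bin)                ≡⟨ trans (ι-* (P ℕ.* suc D) bin) (cong (ℚ._* ι bin) (ι-* P (suc D))) ⟩
    ι P ℚ.* ι (suc D) ℚ.* ι bin            ≡⟨ cong₂ (λ r s → r ℚ.* s ℚ.* ι bin) qQ≡P (/-*-cancel (+ suc D) D) ⟨
    q ℚ.* ι Q ℚ.* ((+ suc D / D) ℚ.* ι D) ℚ.* ι bin
                                           ≡⟨ solve 5 (λ q Q r D s → q :* Q :* (r :* D) :* s := q :* r :* s :* (D :* Q))
                                                    refl q (ι Q) (+ suc D / D) (ι D) (ι bin) ⟩
    concentration c n m D ℚ.* ι bin ℚ.* (ι D ℚ.* ι Q)  ≡⟨ cong (concentration c n m D ℚ.* ι bin ℚ.*_) (ι-* D Q) ⟨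
    concentration c n m D ℚ.* ι bin ℚ.* ι (D ℕ.* Q)    ∎)
    where
    open ℚ.≤-Reasoning
    k : ℕ
    k = 3 ℕ.^ m
    q : ℚ
    q = c ^ℚ m ℚ.* (+ 2 / n)
    0≤q : 0ℚ ℚ.≤ q
    0≤q = 0≤* (ℚ.<⇒≤ (^ℚ-pos 0<c m)) (0≤/ 2 n)
    fraction : ∃₂ λ P Q → NonZero Q × q ℚ.* ι Q ≡ ι P
    fraction = numerator-denominator q 0≤q
    P Q sel bin : ℕ
    P = proj₁ fraction
    Q = proj₁ (proj₂ fraction)
    sel = selections (δ b) vs (j ℕ.+ k) a
    bin = n C (j ℕ.+ k)
    qQ≡P : q ℚ.* ι Q ≡ ι P
    qQ≡P = proj₂ (proj₂ (proj₂ fraction))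
    instance
      Q≢0 : NonZero Q
      Q≢0 = proj₁ (proj₂ (proj₂ fraction))
      DQ≢0 : NonZero (D ℕ.* Q)
      DQ≢0 = ℕ.m*n≢0 D Q
      k≢0 : NonZero k
      k≢0 = ℕ.m^n≢0 3 m
      M≢0 : NonZero (k ℕ.+ x)
      M≢0 = ℕ.>-nonZero (ℕ.<-≤-trans (ℕ.>-nonZero⁻¹ k) (ℕ.m≤m+n k x))
    initial : ∀ (ws : Vector (Fin p) (k ℕ.+ x)) → Injective _≡_ _≡_ ws → ∀ y →
      Q ℕ.* law ws k y ℕ.≤ P ℕ.* (k ℕ.+ x) ℕ.^ k
    initial ws ws-inj y = ι-cancel-≤ {Q ℕ.* law ws k y} {P ℕ.* (k ℕ.+ x) ℕ.^ k} (begin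
      ι (Q ℕ.* law ws k y)                  ≡⟨ ι-* Q (law ws k y) ⟩
      ι Q ℚ.* ι (law ws k y)                ≤⟨ *-monoˡ-≤ (0≤ι Q) (law-iterate ws ws-inj n≤2M m large y) ⟩
      ι Q ℚ.* (q ℚ.* ι ((k ℕ.+ x) ℕ.^ k))   ≡⟨ solve 3 (λ Q q r → Q :* (q :* r) := q :* Q :* r) refl (ι Q) q (ι ((k ℕ.+ x) ℕ.^ k)) ⟩
      q ℚ.* ι Q ℚ.* ι ((k ℕ.+ x) ℕ.^ k)     ≡⟨ cong (ℚ._* ι ((k ℕ.+ x) ℕ.^ k)) qQ≡P ⟩
      ι P ℚ.* ι ((k ℕ.+ x) ℕ.^ k)           ≡⟨ ι-* P ((k ℕ.+ x) ℕ.^ k) ⟨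
      ι (P ℕ.* (k ℕ.+ x) ℕ.^ k)             ∎)
    -- The size is generalised so that its equation can be matched by `refl`, while P/Q still refers
    -- to the outer `n`.
    lifted : ∀ {n} → n ≡ j ℕ.+ (k ℕ.+ x) → (vs : Vector (Fin p) n) → Injective _≡_ _≡_ vs →
      D ℕ.* Q ℕ.* selections (δ b) vs (j ℕ.+ k) a ℕ.≤ P ℕ.* suc D ℕ.* (n C (j ℕ.+ k))
    lifted refl vs vs-inj = selections-lift (δ b) (P ℕ.* suc D) (D ℕ.* Q)
      (λ ws ws-inj → selections-≤-initial k D x ws {P} {Q} D≤M (initial ws ws-inj) b) j vs vs-inj a

  -- When ℓ ≤ r, revealing ℓ - k entries leaves k + r ≥ n/2 of them. The same inequality n ≤ 2 (k +
  -- r) turns the lower bound on n into the one on k + r that sampling needs, hence its factor 2.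
  selections-≤-half : ∀ m D .{{_ : NonZero D}} → (∀ j → j ℕ.< m → ι n ℚ.< ι p ℚ.* c ^ℚ j) →
    2 ℕ.* (suc D ℕ.* (3 ℕ.^ m ℕ.* 3 ℕ.^ m)) ℕ.≤ n →
    ∀ ℓ r → ℓ ℕ.+ r ≡ n → 3 ℕ.^ m ℕ.≤ ℓ → ℓ ℕ.≤ r →
    ∀ (vs : Vector (Fin p) n) → Injective _≡_ _≡_ vs → ∀ b a →
    ι (selections (δ b) vs ℓ a) ℚ.≤ concentration c n m D ℚ.* ι (n C ℓ)
  selections-≤-half m D large N≤n ℓ r ℓ+r≡n k≤ℓ ℓ≤r vs vs-inj b a =
    subst (λ ℓ → ι (selections (δ b) vs ℓ a) ℚ.≤ concentration c n m D ℚ.* ι (n C ℓ)) (ℕ.m∸n+n≡m k≤ℓ)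
      (selections-≤-sparse m D large (ℓ ℕ.∸ k) r n≡ n≤2M (ℕ.*-cancelˡ-≤ 2 (ℕ.≤-trans N≤n n≤2M)) vs vs-inj b a)
    where
    k : ℕ
    k = 3 ℕ.^ m
    n≡ : n ≡ ℓ ℕ.∸ k ℕ.+ (k ℕ.+ r)
    n≡ = trans (sym ℓ+r≡n) (trans (cong (ℕ._+ r) (sym (ℕ.m∸n+n≡m k≤ℓ))) (ℕ.+-assoc (ℓ ℕ.∸ k) k r))
    n≤2M : n ℕ.≤ 2 ℕ.* (k ℕ.+ r)
    n≤2M = begin
      n                      ≡⟨ sym ℓ+r≡n ⟩
      ℓ ℕ.+ r                ≤⟨ ℕ.+-monoˡ-≤ r ℓ≤r ⟩
      r ℕ.+ r                ≡⟨ cong (r ℕ.+_) (sym (ℕ.+-identityʳ r)) ⟩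
      2 ℕ.* r                ≤⟨ ℕ.*-monoʳ-≤ 2 (ℕ.m≤n+m r k) ⟩
      2 ℕ.* (k ℕ.+ r)        ∎
      where open ℕ.≤-Reasoning

  selections-≤ : ∀ m D .{{_ : NonZero D}} → (∀ j → j ℕ.< m → ι n ℚ.< ι p ℚ.* c ^ℚ j) →
    2 ℕ.* (suc D ℕ.* (3 ℕ.^ m ℕ.* 3 ℕ.^ m)) ℕ.≤ n →
    ∀ ℓ → 3 ℕ.^ m ℕ.≤ ℓ → ℓ ℕ.+ 3 ℕ.^ m ℕ.≤ n →
    ∀ (vs : Vector (Fin p) n) → Injective _≡_ _≡_ vs → ∀ b a →
    ι (selections (δ b) vs ℓ a) ℚ.≤ concentration c n m D ℚ.* ι (n C ℓ)
  selections-≤ m D large N≤n ℓ k≤ℓ ℓ+k≤n vs vs-inj b a with ℕ.≤-total ℓ (n ℕ.∸ ℓ)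
  ... | inj₁ ℓ≤r = selections-≤-half m D large N≤n ℓ (n ℕ.∸ ℓ) (ℕ.m+[n∸m]≡n ℓ≤n) k≤ℓ ℓ≤r vs vs-inj b a
    where
    ℓ≤n : ℓ ℕ.≤ n
    ℓ≤n = ℕ.≤-trans (ℕ.m≤m+n ℓ (3 ℕ.^ m)) ℓ+k≤n
  -- Passing to complements makes b the starting point and `a ⊕ total vs` the target; this is
  -- harmless because the bound is uniform in both.
  ... | inj₂ r≤ℓ = subst₂ (λ s t → ι s ℚ.≤ concentration c n m D ℚ.* ι t)
      (sym (selections-complement vs ℓ (n ℕ.∸ ℓ) (ℕ.m+[n∸m]≡n ℓ≤n) a b)) (sym (nCk≡nC[n∸k] ℓ≤n))
      (selections-≤-half m D large N≤n (n ℕ.∸ ℓ) ℓ (ℕ.m∸n+n≡m ℓ≤n) k≤r r≤ℓ vs vs-inj (a ⊕ total vs) b)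
    where
    ℓ≤n : ℓ ℕ.≤ n
    ℓ≤n = ℕ.≤-trans (ℕ.m≤m+n ℓ (3 ℕ.^ m)) ℓ+k≤n
    k≤r : 3 ℕ.^ m ℕ.≤ n ℕ.∸ ℓ
    k≤r = subst (ℕ._≤ n ℕ.∸ ℓ) (ℕ.m+n∸m≡n ℓ (3 ℕ.^ m)) (ℕ.∸-monoˡ-≤ ℓ ℓ+k≤n)

  subsetSumProb-≤ : ∀ m D .{{_ : NonZero D}} → (∀ j → j ℕ.< m → ι n ℚ.< ι p ℚ.* c ^ℚ j) →
    2 ℕ.* (suc D ℕ.* (3 ℕ.^ m ℕ.* 3 ℕ.^ m)) ℕ.≤ n →
    ∀ ℓ → 3 ℕ.^ m ℕ.≤ ℓ → ℓ ℕ.+ 3 ℕ.^ m ℕ.≤ n →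
    ∀ (A : Subset p) → ∣ A ∣ ≡ n → ∀ x →
    uniformProb (subsetsOfSize A ℓ) (λ X → elementSum X Fin.≟ x) ℚ.≤ concentration c n m D
  subsetSumProb-≤ m D large N≤n ℓ k≤ℓ ℓ+k≤n A refl x =
    subst₂ (λ s t → ratio s t ℚ.≤ concentration c n m D)
      (sym (count-subsetsOfSize A ℓ x)) (sym (length-subsetsOfSize A ℓ))
      (ratio-≤ {selections (δ x) (elements A) ℓ 0#} {∣ A ∣ C ℓ}
        (0≤* (0≤* (ℚ.<⇒≤ (^ℚ-pos 0<c m)) (0≤/ 2 n)) (0≤/ (suc D) D))
        (selections-≤ m D large N≤n ℓ k≤ℓ ℓ+k≤n (elements A) (elements-injective A) x 0#))

-- Least witnesses and growth of powers

least : ∀ {P : Pred ℕ 0ℓ} → Decidable P → ∀ m → P m → ∃ λ k → P k × (∀ j → j ℕ.< k → ¬ P j)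
least P? m pm with P? 0
... | yes p0 = 0 , p0 , λ _ ()
least P? zero    pm | no ¬p0 = contradiction pm ¬p0
least P? (suc m) pm | no ¬p0 with k , pk , min ← least (P? ∘ suc) m pm =
  suc k , pk , λ { zero _ → ¬p0 ; (suc j) (s≤s j<k) → min j j<k }

-- Bernoulli's inequality (1 + 1/r)ᵘ ≥ 1 + u/r with denominators cleared.
pow-growth : ∀ r u → r ℕ.^ u ℕ.* (r ℕ.+ u) ℕ.≤ r ℕ.* suc r ℕ.^ u
pow-growth r zero    = ℕ.≤-reflexive (trans (ℕ.*-identityˡ _) (trans (ℕ.+-identityʳ r) (sym (ℕ.*-identityʳ r))))
pow-growth r (suc u) = begin
  r ℕ.* r ℕ.^ u ℕ.* (r ℕ.+ suc u)                            ≤⟨ ℕ.m≤m+n _ (u ℕ.* r ℕ.^ u) ⟩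
  r ℕ.* r ℕ.^ u ℕ.* (r ℕ.+ suc u) ℕ.+ u ℕ.* r ℕ.^ u          ≡⟨ regroup r u (r ℕ.^ u) ⟩
  suc r ℕ.* (r ℕ.^ u ℕ.* (r ℕ.+ u))                          ≤⟨ ℕ.*-monoʳ-≤ (suc r) (pow-growth r u) ⟩
  suc r ℕ.* (r ℕ.* suc r ℕ.^ u)                              ≡⟨ swap (suc r) r (suc r ℕ.^ u) ⟩
  r ℕ.* (suc r ℕ.* suc r ℕ.^ u)                              ∎
  where
  open ℕ.≤-Reasoning
  regroup : ∀ r u x → r ℕ.* x ℕ.* (r ℕ.+ suc u) ℕ.+ u ℕ.* x ≡ suc r ℕ.* (x ℕ.* (r ℕ.+ u))
  regroup = solve-∀
  swap : ∀ x y z → x ℕ.* (y ℕ.* z) ≡ y ℕ.* (x ℕ.* z)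
  swap = solve-∀

-- By Bernoulli ((r + 1)/r)ᵘ exceeds u/r ≥ K. This one estimate drives both the decay of cᵐ and the
-- integer comparison behind (ii).
pow-dominates : ∀ K r .{{_ : NonZero r}} u → K ℕ.* r ℕ.≤ u → K ℕ.* r ℕ.^ u ℕ.< suc r ℕ.^ u
pow-dominates K r u Kr≤u = ℕ.*-cancelˡ-< r _ _ (begin-strict
  r ℕ.* (K ℕ.* r ℕ.^ u)      ≡⟨ regroup r K (r ℕ.^ u) ⟩
  r ℕ.^ u ℕ.* (K ℕ.* r)      ≤⟨ ℕ.*-monoʳ-≤ (r ℕ.^ u) Kr≤u ⟩
  r ℕ.^ u ℕ.* u              <⟨ ℕ.*-monoʳ-< (r ℕ.^ u) {{ℕ.m^n≢0 r u}} (ℕ.m<n+m u (ℕ.>-nonZero⁻¹ r)) ⟩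
  r ℕ.^ u ℕ.* (r ℕ.+ u)      ≤⟨ pow-growth r u ⟩
  r ℕ.* suc r ℕ.^ u          ∎)
  where
  open ℕ.≤-Reasoning
  regroup : ∀ r K x → r ℕ.* (K ℕ.* x) ≡ x ℕ.* (K ℕ.* r)
  regroup = solve-∀

n<3^n : ∀ n → n ℕ.< 3 ℕ.^ n
n<3^n zero    = ℕ.z<s
n<3^n (suc n) = begin-strict
  suc n                ≤⟨ n<3^n n ⟩
  3 ℕ.^ n              <⟨ ℕ.m<m*n (3 ℕ.^ n) 3 {{ℕ.m^n≢0 3 n}} (s≤s ℕ.z<s) ⟩
  3 ℕ.^ n ℕ.* 3        ≡⟨ ℕ.*-comm (3 ℕ.^ n) 3 ⟩
  3 ℕ.^ suc n          ∎
  where open ℕ.≤-Reasoning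

ι-^ : ∀ m k → ι (m ℕ.^ k) ≡ ι m ^ℚ k
ι-^ m zero    = refl
ι-^ m (suc k) = trans (ι-* m (m ℕ.^ k)) (cong (ι m ℚ.*_) (ι-^ m k))

0≤^ℚ : ∀ {c} → 0ℚ ℚ.≤ c → ∀ m → 0ℚ ℚ.≤ c ^ℚ m
0≤^ℚ 0≤c zero    = ℚ.nonNegative⁻¹ 1ℚ
0≤^ℚ 0≤c (suc m) = 0≤* 0≤c (0≤^ℚ 0≤c m)

^ℚ-mono-≤ : ∀ {p q} → 0ℚ ℚ.≤ p → p ℚ.≤ q → ∀ k → p ^ℚ k ℚ.≤ q ^ℚ k
^ℚ-mono-≤ 0≤p p≤q zero    = ℚ.≤-refl
^ℚ-mono-≤ 0≤p p≤q (suc k) = *-mono-≤ (0≤^ℚ 0≤p k) (ℚ.≤-trans 0≤p p≤q) p≤q (^ℚ-mono-≤ 0≤p p≤q k)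

^ℚ-anti-≤ : ∀ {c} → 0ℚ ℚ.< c → c ℚ.≤ 1ℚ → ∀ {j m} → j ℕ.≤ m → c ^ℚ m ℚ.≤ c ^ℚ j
^ℚ-anti-≤ 0<c c≤1 {m = m} z≤n       = ^ℚ-≤1 0<c c≤1 m
^ℚ-anti-≤ 0<c c≤1         (s≤s j≤m) = *-monoˡ-≤ (ℚ.<⇒≤ 0<c) (^ℚ-anti-≤ 0<c c≤1 j≤m)

pow-vanishes : ∀ {c e} → 0ℚ ℚ.< c → c ℚ.< 1ℚ → 0ℚ ℚ.< e → ∃ λ m → c ^ℚ m ℚ.≤ e
pow-vanishes {c} {e} 0<c c<1 0<e
  with P , Q , Q≢0 , cQ≡P ← numerator-denominator c (ℚ.<⇒≤ 0<c)
     | S , T , T≢0 , eT≡S ← numerator-denominator e (ℚ.<⇒≤ 0<e) = m , *-cancelʳ-≤ 0<scale bound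
  where
  open ℚ.≤-Reasoning
  instance
    _ = Q≢0
    _ = T≢0
    P≢0 : NonZero P
    P≢0 = ℕ.>-nonZero (ι-cancel-< {0} {P} (subst (0ℚ ℚ.<_) cQ≡P (0<* 0<c (0<ι Q))))
  -- With c = P/Q and e = S/T, `pow-dominates` at K = T gives T Pᵐ < (P + 1)ᵐ ≤ Qᵐ for this m, so cᵐ
  -- ≤ 1/T ≤ e.
  m : ℕ
  m = T ℕ.* P
  0<scale : 0ℚ ℚ.< ι (Q ℕ.^ m) ℚ.* ι T
  0<scale = 0<* (0<ι (Q ℕ.^ m) {{ℕ.m^n≢0 Q m}}) (0<ι T)
  P<Q : P ℕ.< Q
  P<Q = ι-cancel-< {P} {Q} (subst₂ ℚ._<_ cQ≡P (ℚ.*-identityˡ (ι Q)) (*-monoʳ-< (0<ι Q) c<1))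
  1≤S : 1 ℕ.≤ S
  1≤S = ι-cancel-< {0} {S} (subst (0ℚ ℚ.<_) eT≡S (0<* 0<e (0<ι T)))
  bound : c ^ℚ m ℚ.* (ι (Q ℕ.^ m) ℚ.* ι T) ℚ.≤ e ℚ.* (ι (Q ℕ.^ m) ℚ.* ι T)
  bound = begin
    c ^ℚ m ℚ.* (ι (Q ℕ.^ m) ℚ.* ι T)      ≡⟨ cong (λ z → c ^ℚ m ℚ.* (z ℚ.* ι T)) (ι-^ Q m) ⟩
    c ^ℚ m ℚ.* (ι Q ^ℚ m ℚ.* ι T)         ≡⟨ ℚ.*-assoc (c ^ℚ m) (ι Q ^ℚ m) (ι T) ⟨
    c ^ℚ m ℚ.* ι Q ^ℚ m ℚ.* ι T           ≡⟨ cong (ℚ._* ι T) (^ℚ-distrib-* c (ι Q) m) ⟨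
    (c ℚ.* ι Q) ^ℚ m ℚ.* ι T              ≡⟨ cong (λ z → z ^ℚ m ℚ.* ι T) cQ≡P ⟩
    ι P ^ℚ m ℚ.* ι T                      ≡⟨ cong (ℚ._* ι T) (ι-^ P m) ⟨
    ι (P ℕ.^ m) ℚ.* ι T                   ≡⟨ trans (ℚ.*-comm (ι (P ℕ.^ m)) (ι T)) (sym (ι-* T (P ℕ.^ m))) ⟩
    ι (T ℕ.* P ℕ.^ m)                     ≤⟨ ι-mono-≤ {T ℕ.* P ℕ.^ m} {Q ℕ.^ m} (ℕ.≤-trans
                                               (ℕ.<⇒≤ (pow-dominates T P m ℕ.≤-refl)) (ℕ.^-monoˡ-≤ m P<Q)) ⟩
    ι (Q ℕ.^ m)                           ≡⟨ ℚ.*-identityʳ (ι (Q ℕ.^ m)) ⟨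
    ι (Q ℕ.^ m) ℚ.* ι 1                   ≤⟨ *-monoˡ-≤ (0≤ι (Q ℕ.^ m)) (ι-mono-≤ {1} {S} 1≤S) ⟩
    ι (Q ℕ.^ m) ℚ.* ι S                   ≡⟨ cong (ι (Q ℕ.^ m) ℚ.*_) eT≡S ⟨
    ι (Q ℕ.^ m) ℚ.* (e ℚ.* ι T)           ≡⟨ solve 3 (λ q e t → q :* (e :* t) := e :* (q :* t)) refl (ι (Q ℕ.^ m)) e (ι T) ⟩
    e ℚ.* (ι (Q ℕ.^ m) ℚ.* ι T)           ∎

nat-floor : ∀ z → 0ℚ ℚ.≤ z → ∃ λ u → ι u ℚ.≤ z × z ℚ.< ι (suc u)
nat-floor z 0≤z with P , Q , Q≢0 , zQ≡P ← numerator-denominator z 0≤z = u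
  , *-cancelʳ-≤ (0<ι Q) (subst₂ ℚ._≤_ (ι-* u Q) (sym zQ≡P) (ι-mono-≤ {u ℕ.* Q} {P} (ℕ.m/n*n≤m P Q)))
  , *-cancelʳ-< (0≤ι Q) (subst₂ ℚ._<_ (sym zQ≡P) (ι-* (suc u) Q) (ι-mono-< {P} {suc u ℕ.* Q} P<))
  where
  instance _ = Q≢0
  u : ℕ
  u = P ℕ./ Q
  P< : P ℕ.< suc u ℕ.* Q
  P< = subst (ℕ._< suc u ℕ.* Q) (sym (ℕ.m≡m%n+[m/n]*n P Q)) (ℕ.+-monoˡ-< (u ℕ.* Q) (ℕ.m%n<n P Q))

-- Rational approximation of real numbers

p≤∣p∣ : ∀ p → p ℚ.≤ ℚ.∣ p ∣
p≤∣p∣ p with ℚ.≤-total 0ℚ p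
... | inj₁ 0≤p = ℚ.≤-reflexive (sym (ℚ.0≤p⇒∣p∣≡p 0≤p))
... | inj₂ p≤0 = ℚ.≤-trans p≤0 (ℚ.0≤∣p∣ p)

∣p-q∣≤δ⇒p≤q+δ : ∀ p q {δ} → ℚ.∣ p ℚ.- q ∣ ℚ.≤ δ → p ℚ.≤ q ℚ.+ δ
∣p-q∣≤δ⇒p≤q+δ p q {δ} close = begin
  p                       ≡⟨ solve 2 (λ p q → p := q :+ (p :- q)) refl p q ⟩
  q ℚ.+ (p ℚ.- q)         ≤⟨ ℚ.+-monoʳ-≤ q (ℚ.≤-trans (p≤∣p∣ (p ℚ.- q)) close) ⟩
  q ℚ.+ δ                 ∎
  where open ℚ.≤-Reasoning

cauchy-above : ∀ x {δ} → 0ℚ ℚ.< δ → ∃ λ N → ∀ m n → N ℕ.≤ m → N ℕ.≤ n → seq x m ℚ.≤ seq x n ℚ.+ δ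
cauchy-above x 0<δ with N , close ← cauchy x _ 0<δ =
  N , λ m n m≥N n≥N → ∣p-q∣≤δ⇒p≤q+δ (seq x m) (seq x n) (close m n m≥N n≥N)

seq-^ᴿ : ∀ x k i → seq (x ^ᴿ k) i ≡ seq x i ^ℚ k
seq-^ᴿ x zero    i = refl
seq-^ᴿ x (suc k) i = cong (seq x i ℚ.*_) (seq-^ᴿ x k i)

positive-bound : ∀ x → fromℕ 0 <ᴿ x → ∃ λ e → 0ℚ ℚ.< e × ∃ λ N → ∀ n → N ℕ.≤ n → e ℚ.≤ seq x n
positive-bound x (e , 0<e , N , h) =
  e , 0<e , N , λ n n≥N → subst (ℚ._≤ seq x n) (ℚ.+-identityˡ e) (h n n≥N)

-- The relation q + δ ≤ (1 + θ)(q - δ) amounts to (2 + θ) δ ≤ θ q. Fixing δ through the lower bound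
-- e of q turns an absolute error into a relative one.
interval-ratio : ∀ {q e δ θ} → 0ℚ ℚ.< e → 0ℚ ℚ.< θ → e ℚ.≤ q → (ι 2 ℚ.+ θ) ℚ.* δ ≡ θ ℚ.* e →
  0ℚ ℚ.< q ℚ.- δ × q ℚ.+ δ ℚ.≤ (q ℚ.- δ) ℚ.+ θ ℚ.* (q ℚ.- δ)
interval-ratio {q} {e} {δ} {θ} 0<e 0<θ e≤q [2+θ]δ≡θe =
  subst (ℚ._< q ℚ.- δ) (ℚ.+-inverseʳ δ) (ℚ.+-monoˡ-< (ℚ.- δ) (ℚ.<-≤-trans δ<e e≤q)) ,
  (begin
    q ℚ.+ δ
      ≡⟨ solve 3 (λ q d t → q :+ d := (q :- d :- t :* d) :+ (con (ι 2) :+ t) :* d) refl q δ θ ⟩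
    (q ℚ.- δ ℚ.- θ ℚ.* δ) ℚ.+ (ι 2 ℚ.+ θ) ℚ.* δ
      ≡⟨ cong ((q ℚ.- δ ℚ.- θ ℚ.* δ) ℚ.+_) [2+θ]δ≡θe ⟩
    (q ℚ.- δ ℚ.- θ ℚ.* δ) ℚ.+ θ ℚ.* e
      ≤⟨ ℚ.+-monoʳ-≤ (q ℚ.- δ ℚ.- θ ℚ.* δ) (*-monoˡ-≤ {θ} {e} {q} (ℚ.<⇒≤ 0<θ) e≤q) ⟩
    (q ℚ.- δ ℚ.- θ ℚ.* δ) ℚ.+ θ ℚ.* q
      ≡⟨ solve 3 (λ q d t → (q :- d :- t :* d) :+ t :* q := (q :- d) :+ t :* (q :- d)) refl q δ θ ⟩
    (q ℚ.- δ) ℚ.+ θ ℚ.* (q ℚ.- δ) ∎)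
  where
  open ℚ.≤-Reasoning
  δ<e : δ ℚ.< e
  δ<e = *-cancelʳ-< {ι 2 ℚ.+ θ} {δ} {e} (ℚ.<⇒≤ (ℚ.+-mono-< (0<ι 2) 0<θ)) (begin-strict
    δ ℚ.* (ι 2 ℚ.+ θ)             ≡⟨ ℚ.*-comm δ (ι 2 ℚ.+ θ) ⟩
    (ι 2 ℚ.+ θ) ℚ.* δ             ≡⟨ [2+θ]δ≡θe ⟩
    θ ℚ.* e                       ≡⟨ ℚ.+-identityˡ (θ ℚ.* e) ⟨
    0ℚ ℚ.+ θ ℚ.* e                <⟨ ℚ.+-monoˡ-< (θ ℚ.* e) (0<* {ι 2} {e} (0<ι 2) 0<e) ⟩
    ι 2 ℚ.* e ℚ.+ θ ℚ.* e         ≡⟨ solve 2 (λ t e → con (ι 2) :* e :+ t :* e := e :* (con (ι 2) :+ t)) refl θ e ⟩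
    e ℚ.* (ι 2 ℚ.+ θ)             ∎)

relative-approximation : ∀ x → fromℕ 0 <ᴿ x → ∀ θ → 0ℚ ℚ.< θ →
  ∃ λ r → 0ℚ ℚ.< r × ∃ λ N → ∀ n → N ℕ.≤ n → r ℚ.≤ seq x n × seq x n ℚ.≤ r ℚ.+ θ ℚ.* r
relative-approximation x 0<x θ 0<θ =
  let e , 0<e , N₁ , e≤x = positive-bound x 0<x
      δ , 0<δ , [2+θ]δ≡θe = divide {ι 2 ℚ.+ θ} {θ ℚ.* e} (ℚ.+-mono-< (0<ι 2) 0<θ) (0<* 0<θ 0<e)
      N₂ , close = cauchy-above x {δ} 0<δ
      N = N₁ ℕ.⊔ N₂
      q = seq x N
      0<r , q+δ≤ = interval-ratio {q} {e} {δ} {θ} 0<e 0<θ (e≤x N (ℕ.m≤m⊔n N₁ N₂)) [2+θ]δ≡θe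
  in q ℚ.- δ , 0<r , N , λ n n≥N →
    subst (q ℚ.- δ ℚ.≤_) (solve 2 (λ s d → s :+ d :- d := s) refl (seq x n) δ)
      (ℚ.+-monoˡ-≤ (ℚ.- δ) (close N n (ℕ.m≤n⊔m N₁ N₂) (ℕ.m⊔n≤o⇒n≤o N₁ N₂ n≥N))) ,
    ℚ.≤-trans (close n N (ℕ.m⊔n≤o⇒n≤o N₁ N₂ n≥N) (ℕ.m≤n⊔m N₁ N₂)) q+δ≤

rational-bound : ∀ x → fromℕ 0 <ᴿ x → x <ᴿ fromℕ 1 →
  ∃ λ c → 0ℚ ℚ.< c × c ℚ.< 1ℚ × ∃ λ N → ∀ n → N ℕ.≤ n → seq x n ℚ.≤ c
rational-bound x 0<x (e , 0<e , N , x+e≤1) with d , 0<d , M , d≤x ← positive-bound x 0<x =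
  1ℚ ℚ.- e
  , ℚ.<-≤-trans 0<d (ℚ.≤-trans (d≤x (M ℕ.⊔ N) (ℕ.m≤m⊔n M N)) (bound (M ℕ.⊔ N) (ℕ.m≤n⊔m M N)))
  , subst (1ℚ ℚ.- e ℚ.<_) (ℚ.+-identityʳ 1ℚ) (ℚ.+-monoʳ-< 1ℚ (ℚ.neg-antimono-< 0<e))
  , N , bound
  where
  bound : ∀ n → N ℕ.≤ n → seq x n ℚ.≤ 1ℚ ℚ.- e
  bound n n≥N = subst (ℚ._≤ 1ℚ ℚ.- e) (solve 2 (λ s e → s :+ e :- e := s) refl (seq x n) e)
    (ℚ.+-monoˡ-≤ (ℚ.- e) (x+e≤1 n n≥N))

-- The bound for a fixed ε

-- The common end of (i) and (ii): what remains is to choose m, D and c with 2 cᵐ (D + 1)/D ≤ ε and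
-- to verify the condition on p.
subsetSumProb-≤ᴿ : ∀ {C₃ c N₀} → ThreefoldContraction C₃ → (∀ i → N₀ ℕ.≤ i → seq C₃ i ℚ.≤ c) →
  0ℚ ℚ.< c → c ℚ.≤ 1ℚ →
  ∀ ε {M} m D .{{_ : NonZero D}} →
  (∀ i → M ℕ.≤ i → c ^ℚ m ℚ.* (+ suc D / D) ℚ.* ι 2 ℚ.≤ seq ε i) →
  ∀ n ℓ .{{_ : NonZero n}} → 3 ℕ.≤ n → 2 ℕ.* (suc D ℕ.* (3 ℕ.^ m ℕ.* 3 ℕ.^ m)) ℕ.≤ n →
  3 ℕ.^ m ℕ.≤ ℓ → ℓ ℕ.+ 3 ℕ.^ m ℕ.≤ n →
  ∀ p .{{_ : NonZero p}} → Prime p → (∀ j → j ℕ.< m → ι n ℚ.< ι p ℚ.* c ^ℚ j) →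
  ∀ (A : Subset p) → ∣ A ∣ ≡ n → ∀ x → subsetSumProb A ℓ x ≤ᴿ ε /ᴿ n
subsetSumProb-≤ᴿ {C₃} {c} {N₀} contraction C₃≤c 0<c c≤1 ε {M} m D bound≤ε n ℓ 3≤n D≤n k≤ℓ ℓ+k≤n p p-prime large A ∣A∣≡n x =
  termwise-≤ᴿ {subsetSumProb A ℓ x} {ε /ᴿ n} M (λ i i≥M → ℚ.≤-trans
    (subsetSumProb-≤ {p} {c} (contracts {C₃} {c} {N₀} contraction C₃≤c p p-prime) 0<c c≤1 3≤n
      m D large D≤n ℓ k≤ℓ ℓ+k≤n A ∣A∣≡n x)
    (*-cancelʳ-≤ {ι n} {concentration c n m D} {seq ε i ℚ.* (+ 1 / n)} (0<ι n) (begin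
      c ^ℚ m ℚ.* (+ 2 / n) ℚ.* (+ suc D / D) ℚ.* ι n
        ≡⟨ solve 4 (λ q l d n → q :* l :* d :* n := q :* d :* (l :* n)) refl (c ^ℚ m) (+ 2 / n) (+ suc D / D) (ι n) ⟩
      c ^ℚ m ℚ.* (+ suc D / D) ℚ.* ((+ 2 / n) ℚ.* ι n)
        ≡⟨ cong (c ^ℚ m ℚ.* (+ suc D / D) ℚ.*_) (/-*-cancel (+ 2) n) ⟩
      c ^ℚ m ℚ.* (+ suc D / D) ℚ.* ι 2
        ≤⟨ bound≤ε i i≥M ⟩
      seq ε i
        ≡⟨ ℚ.*-identityʳ (seq ε i) ⟨
      seq ε i ℚ.* ι 1
        ≡⟨ cong (seq ε i ℚ.*_) (/-*-cancel (+ 1) n) ⟨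
      seq ε i ℚ.* ((+ 1 / n) ℚ.* ι n)
        ≡⟨ ℚ.*-assoc (seq ε i) (+ 1 / n) (ι n) ⟨
      seq ε i ℚ.* (+ 1 / n) ℚ.* ι n ∎)))
  where open ℚ.≤-Reasoning

1/3 : ℚ
1/3 = + 1 / 3

thirds : ∀ p r → p ℚ.* (r ℚ.+ 1/3 ℚ.* r) ≡ p ℚ.* (1/3 ℚ.* r ℚ.* ι 4)
thirds = solve 2 (λ p r → p :* (r :+ con 1/3 :* r) := p :* (con 1/3 :* r :* con (ι 4))) refl

-- The 4 of the hypothesis arises as 4n < p ε ≤ p (r + r/3) = 4 p (r/3) ≤ 4 p cʲ: an error of a
-- third in ε is exactly the gap between 3 and 4.
large-prime : ∀ ε {r c N₁} → (∀ i → N₁ ℕ.≤ i → seq ε i ℚ.≤ r ℚ.+ 1/3 ℚ.* r) →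
  ∀ n p → fromℕ (4 ℕ.* n) <ᴿ fromℕ p *ᴿ ε → ∀ j → 1/3 ℚ.* r ℚ.≤ c ^ℚ j → ι n ℚ.< ι p ℚ.* c ^ℚ j
large-prime ε {r} {c} {N₁} ε≤ n p (g , 0<g , N₂ , 4n+g≤pε) j r≤cʲ =
  *-cancelʳ-< {ι 4} {ι n} {ι p ℚ.* c ^ℚ j} (0≤ι 4) (begin-strict
    ι n ℚ.* ι 4                            ≡⟨ trans (ℚ.*-comm (ι n) (ι 4)) (sym (ι-* 4 n)) ⟩
    ι (4 ℕ.* n)                            ≡⟨ ℚ.+-identityʳ (ι (4 ℕ.* n)) ⟨
    ι (4 ℕ.* n) ℚ.+ 0ℚ                     <⟨ ℚ.+-monoʳ-< (ι (4 ℕ.* n)) 0<g ⟩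
    ι (4 ℕ.* n) ℚ.+ g                      ≤⟨ 4n+g≤pε i (ℕ.m≤n⊔m N₁ N₂) ⟩
    ι p ℚ.* seq ε i                        ≤⟨ *-monoˡ-≤ {ι p} (0≤ι p) (ε≤ i (ℕ.m≤m⊔n N₁ N₂)) ⟩
    ι p ℚ.* (r ℚ.+ 1/3 ℚ.* r)              ≡⟨ thirds (ι p) r ⟩
    ι p ℚ.* (1/3 ℚ.* r ℚ.* ι 4)            ≤⟨ *-monoˡ-≤ {ι p} (0≤ι p) (*-monoʳ-≤ {ι 4} {1/3 ℚ.* r} {c ^ℚ j} (0≤ι 4) r≤cʲ) ⟩
    ι p ℚ.* (c ^ℚ j ℚ.* ι 4)               ≡⟨ ℚ.*-assoc (ι p) (c ^ℚ j) (ι 4) ⟨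
    ι p ℚ.* c ^ℚ j ℚ.* ι 4                 ∎)
  where
  open ℚ.≤-Reasoning
  i : ℕ
  i = N₁ ℕ.⊔ N₂

fixed-ε : ∀ C₃ → fromℕ 0 <ᴿ C₃ → C₃ <ᴿ fromℕ 1 → ThreefoldContraction C₃ →
  ∀ ε → fromℕ 0 <ᴿ ε →
  ∃ λ N → ∀ n ℓ .{{_ : NonZero n}} → N ℕ.≤ n → N ℕ.≤ ℓ → ℓ ℕ.+ N ℕ.≤ n →
  ∀ p .{{_ : NonZero p}} → Prime p → fromℕ (4 ℕ.* n) <ᴿ fromℕ p *ᴿ ε →
  ∀ (A : Subset p) → ∣ A ∣ ≡ n → ∀ x → subsetSumProb A ℓ x ≤ᴿ ε /ᴿ n
fixed-ε C₃ 0<C₃ C₃<1 contraction ε 0<ε =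
  let c , 0<c , c<1 , N₀ , C₃≤c = rational-bound C₃ 0<C₃ C₃<1
      r , 0<r , N₁ , approx = relative-approximation ε 0<ε 1/3 (0<1/ 3)
      m₀ , m₀-small = pow-vanishes {c} {1/3 ℚ.* r} 0<c c<1 (0<* (0<1/ 3) 0<r)
      -- Taking the least m keeps every earlier power above r/3, as `large-prime` demands.
      m , m-small , below-m = least (λ j → c ^ℚ j ℚ.≤? 1/3 ℚ.* r) m₀ m₀-small
      k = 3 ℕ.^ m
      K = 2 ℕ.* (3 ℕ.* (k ℕ.* k))
      N = 3 ℕ.⊔ (K ℕ.⊔ k)
      k≤N = ℕ.≤-trans (ℕ.m≤n⊔m K k) (ℕ.m≤n⊔m 3 (K ℕ.⊔ k))
  in N , λ n ℓ n≥N ℓ≥N ℓ+N≤n p p-prime 4n<pε A ∣A∣≡n x →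
    subsetSumProb-≤ᴿ {C₃} {c} {N₀} contraction C₃≤c 0<c (ℚ.<⇒≤ c<1) ε {N₁} m 2
      (λ i i≥N₁ → ℚ.≤-trans (scaled c m r m-small) (proj₁ (approx i i≥N₁))) n ℓ
      (ℕ.≤-trans (ℕ.m≤m⊔n 3 (K ℕ.⊔ k)) n≥N)
      (ℕ.≤-trans (ℕ.≤-trans (ℕ.m≤m⊔n K k) (ℕ.m≤n⊔m 3 (K ℕ.⊔ k))) n≥N)
      (ℕ.≤-trans k≤N ℓ≥N) (ℕ.≤-trans (ℕ.+-monoʳ-≤ ℓ k≤N) ℓ+N≤n)
      p p-prime
      (λ j j<m → large-prime ε {r} {c} {N₁} (λ i i≥N₁ → proj₂ (approx i i≥N₁)) n p 4n<pε j
                   (ℚ.<⇒≤ (ℚ.≰⇒> (below-m j j<m))))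
      A ∣A∣≡n x
  where
  scaled : ∀ c m r → c ^ℚ m ℚ.≤ 1/3 ℚ.* r → c ^ℚ m ℚ.* (+ 3 / 2) ℚ.* ι 2 ℚ.≤ r
  scaled c m r small = begin
    c ^ℚ m ℚ.* (+ 3 / 2) ℚ.* ι 2           ≡⟨ ℚ.*-assoc (c ^ℚ m) (+ 3 / 2) (ι 2) ⟩
    c ^ℚ m ℚ.* ι 3                         ≤⟨ *-monoʳ-≤ {ι 3} {c ^ℚ m} {1/3 ℚ.* r} (0≤ι 3) small ⟩
    1/3 ℚ.* r ℚ.* ι 3                      ≡⟨ solve 1 (λ r → con 1/3 :* r :* con (ι 3) := r) refl r ⟩
    r                                      ∎
    where open ℚ.≤-Reasoning

-- Logarithms and real powers through natural exponents

archimedean : ∀ {e} → 0ℚ ℚ.< e → ∀ K → ∃ λ b → NonZero b × ι K ℚ.≤ ι b ℚ.* e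
archimedean {e} 0<e K =
  let P , Q , Q≢0 , eQ≡P = numerator-denominator e (ℚ.<⇒≤ 0<e)
      0<P = ι-cancel-< {0} {P} (subst (0ℚ ℚ.<_) eQ≡P (0<* 0<e (0<ι Q {{Q≢0}})))
  in suc K ℕ.* Q , ℕ.m*n≢0 (suc K) Q {{_}} {{Q≢0}} , (begin
    ι K                          ≤⟨ ι-mono-≤ {K} {suc K ℕ.* P} (ℕ.≤-trans (ℕ.n≤1+n K) (ℕ.m≤m*n (suc K) P {{ℕ.>-nonZero 0<P}})) ⟩
    ι (suc K ℕ.* P)              ≡⟨ ι-* (suc K) P ⟩
    ι (suc K) ℚ.* ι P            ≡⟨ cong (ι (suc K) ℚ.*_) (trans (ℚ.*-comm (ι Q) e) eQ≡P) ⟨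
    ι (suc K) ℚ.* (ι Q ℚ.* e)    ≡⟨ ℚ.*-assoc (ι (suc K)) (ι Q) e ⟨
    ι (suc K) ℚ.* ι Q ℚ.* e      ≡⟨ cong (ℚ._* e) (ι-* (suc K) Q) ⟨
    ι (suc K ℕ.* Q) ℚ.* e        ∎)
  where open ℚ.≤-Reasoning

⊖-/ : ∀ u b .{{_ : NonZero b}} → (0 ⊖ u) / b ≡ ℚ.- ((u ⊖ 0) / b)
⊖-/ zero    b = trans (ℚ.0/n≡0 b) (sym (cong ℚ.-_ (ℚ.0/n≡0 b)))
⊖-/ (suc u) b = refl

IsPower-seq : ∀ a k b y i → seq (a ^ᴿ k *ᴿ y ^ᴿ b) i ≡ seq a i ^ℚ k ℚ.* seq y i ^ℚ b
IsPower-seq a k b y i = cong₂ ℚ._*_ (seq-^ᴿ a k i) (seq-^ᴿ y b i)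

1≤3 : fromℕ 1 ≤ᴿ fromℕ 3
1≤3 = fromℚ-≤ {ι 1} {ι 3} (ι-mono-≤ {1} {3} (s≤s z≤n))

-- A logarithm ≥ -1/B would force 3 C^B ≥ 1.
log-negative : ∀ X t → fromℕ 0 <ᴿ X → X <ᴿ fromℕ 1 → IsLog (fromℕ 3) X t →
  ∃ λ e → 0ℚ ℚ.< e × ∃ λ N → ∀ n → N ℕ.≤ n → seq t n ℚ.≤ ℚ.- e
log-negative X t 0<X X<1 t-log =
  let c , 0<c , c<1 , N₁ , X≤c = rational-bound X 0<X X<1
      d , 0<d , N₂ , d≤X = positive-bound X 0<X
      -- The bound 1/6 here and the tolerance 1/4 below contradict each other through 3 · 1/6 + 1/4
      -- = 3/4 < 1.
      M , cᴹ≤ = pow-vanishes {c} {+ 1 / 6} 0<c c<1 (0<1/ 6)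
      B = suc M
      -- A quarter of 1/B: if t is at least -2e at index N, it stays above -3e = -1/B + e, which is
      -- the strict inequality -1/B < t with gap e.
      e = ½ ℚ.* (½ ℚ.* (+ 1 / B))
      0<e = half {½ ℚ.* (+ 1 / B)} (half {+ 1 / B} (0<1/ B))
      N , close = cauchy-above t {e} 0<e
      absurd : ℚ.- e ℚ.- e ℚ.≤ seq t N → ⊥
      absurd -2e≤t =
        let above = proj₁ (IsPower.above t-log 0 1 B
              (e , 0<e , N , λ n n≥N → gap (+ 1 / B) (seq t N) (seq t n) -2e≤t (close N n ℕ.≤-refl n≥N))) 1≤3
            N₃ , 1≤ = above (+ 1 / 4) (0<1/ 4)
            n = N₁ ℕ.⊔ N₂ ℕ.⊔ N₃
            N₁≤n = ℕ.≤-trans (ℕ.m≤m⊔n N₁ N₂) (ℕ.m≤m⊔n (N₁ ℕ.⊔ N₂) N₃)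
            N₂≤n = ℕ.≤-trans (ℕ.m≤n⊔m N₁ N₂) (ℕ.m≤m⊔n (N₁ ℕ.⊔ N₂) N₃)
        in too-small c (seq X n) M (ℚ.≤-trans (ℚ.<⇒≤ 0<d) (d≤X n N₂≤n)) (X≤c n N₁≤n) (ℚ.<⇒≤ c<1) cᴹ≤
             (subst (λ z → 1ℚ ℚ.≤ z ℚ.+ (+ 1 / 4)) (IsPower-seq (fromℕ 3) 1 B X n)
               (1≤ n (ℕ.m≤n⊔m (N₁ ℕ.⊔ N₂) N₃)))
      t<-2e = ℚ.≰⇒> {ℚ.- e ℚ.- e} {seq t N} absurd
  in e , 0<e , N , λ n n≥N → ℚ.≤-trans (close n N n≥N ℕ.≤-refl)
       (subst (seq t N ℚ.+ e ℚ.≤_) (solve 1 (λ e → :- e :- e :+ e := :- e) refl e)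
         (ℚ.+-monoˡ-≤ e (ℚ.<⇒≤ t<-2e)))
  where
  gap : ∀ z s s′ → let e = ½ ℚ.* (½ ℚ.* z) in ℚ.- e ℚ.- e ℚ.≤ s → s ℚ.≤ s′ ℚ.+ e → ℚ.- z ℚ.+ e ℚ.≤ s′
  gap z s s′ s≥ s≤ = begin
    ℚ.- z ℚ.+ e              ≡⟨ solve 1 (λ z → :- z :+ con ½ :* (con ½ :* z) :=
                                  (:- (con ½ :* (con ½ :* z)) :- con ½ :* (con ½ :* z)) :- con ½ :* (con ½ :* z)) refl z ⟩
    (ℚ.- e ℚ.- e) ℚ.- e      ≤⟨ ℚ.+-monoˡ-≤ (ℚ.- e) (ℚ.≤-trans s≥ s≤) ⟩
    s′ ℚ.+ e ℚ.- e           ≡⟨ solve 2 (λ s e → s :+ e :- e := s) refl s′ e ⟩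
    s′                       ∎
    where
    open ℚ.≤-Reasoning
    e : ℚ
    e = ½ ℚ.* (½ ℚ.* z)
  too-small : ∀ c s M → 0ℚ ℚ.≤ s → s ℚ.≤ c → c ℚ.≤ 1ℚ → c ^ℚ M ℚ.≤ + 1 / 6 →
    1ℚ ℚ.≤ ι 3 ^ℚ 1 ℚ.* s ^ℚ suc M ℚ.+ (+ 1 / 4) → ⊥
  too-small c s M 0≤s s≤c c≤1 cᴹ≤ 1≤ = toWitnessFalse {a? = 1ℚ ℚ.≤? (+ 3 / 4)} _ (begin
    1ℚ                                          ≤⟨ 1≤ ⟩
    ι 3 ℚ.* (s ℚ.* s ^ℚ M) ℚ.+ (+ 1 / 4)        ≤⟨ ℚ.+-monoˡ-≤ (+ 1 / 4) (*-monoˡ-≤ {ι 3} {s ℚ.* s ^ℚ M} {1ℚ ℚ.* (+ 1 / 6)} (0≤ι 3)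
                                                     (*-mono-≤ {s} {1ℚ} {s ^ℚ M} {+ 1 / 6} (0≤^ℚ 0≤s M) (0≤ι 1) (ℚ.≤-trans s≤c c≤1)
                                                       (ℚ.≤-trans (^ℚ-mono-≤ 0≤s s≤c M) cᴹ≤))) ⟩
    + 3 / 4                                     ∎)
    where open ℚ.≤-Reasoning

-- The gap 5 covers the rounding of the floor and an approximation of -t within 1/b on both sides.
rational-bracket : ∀ t {e N₀} → 0ℚ ℚ.< e → (∀ n → N₀ ℕ.≤ n → seq t n ℚ.≤ ℚ.- e) → ∀ U →
  ∃ λ u → ∃ λ b → Σ (NonZero b) λ b≢0 → U ℕ.≤ u
    × t <ᴿ fromℚ (_/_ (0 ⊖ u) b {{b≢0}})
    × fromℚ (_/_ (u ⊖ 0) b {{b≢0}}) <ᴿ -ᴿ t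
    × -ᴿ t <ᴿ fromℚ (_/_ ((u ℕ.+ 5) ⊖ 0) b {{b≢0}})
rational-bracket t {e} {N₀} 0<e t≤-e U = from-floor (archimedean 0<e (2 ℕ.+ U))
  where
  -- The denominator b is so large that -t · b exceeds U even after the floor is lowered by 2.
  from-floor : (∃ λ b → NonZero b × ι (2 ℕ.+ U) ℚ.≤ ι b ℚ.* e) → _
  from-floor (b , b≢0 , U≤be) =
    let instance _ = b≢0
        η = + 1 / b
        N₁ , close = cauchy-above t {η} (0<1/ b)
        N = N₀ ℕ.⊔ N₁
        w = ℚ.- seq t N
        z = w ℚ.* ι b
        U≤z : ι (2 ℕ.+ U) ℚ.≤ z
        U≤z = ℚ.≤-trans U≤be (ℚ.≤-trans (ℚ.≤-reflexive (ℚ.*-comm (ι b) e))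
                (*-monoʳ-≤ {ι b} {e} {w} (0≤ι b) (subst (ℚ._≤ w) (solve 1 (λ e → :- (:- e) := e) refl e)
                  (ℚ.neg-antimono-≤ (t≤-e N (ℕ.m≤m⊔n N₀ N₁))))))
        u₀ , u₀≤z , z<u₀+1 = nat-floor z (ℚ.≤-trans (0≤ι (2 ℕ.+ U)) U≤z)
        2+U≤u₀ = ℕ.≤-pred (ι-cancel-< {2 ℕ.+ U} {suc u₀} (ℚ.≤-<-trans U≤z z<u₀+1))
        above : ∀ n → N ℕ.≤ n → w ℚ.- η ℚ.≤ ℚ.- seq t n
        above n n≥N = flip-≤ (seq t N) (seq t n) η (close n N (ℕ.m⊔n≤o⇒n≤o N₀ N₁ n≥N) (ℕ.m≤n⊔m N₀ N₁))
        below : ∀ n → N ℕ.≤ n → ℚ.- seq t n ℚ.≤ w ℚ.+ η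
        below n n≥N = flip-≤′ (seq t N) (seq t n) η (close N n (ℕ.m≤n⊔m N₀ N₁) (ℕ.m⊔n≤o⇒n≤o N₀ N₁ n≥N))
    in finish b b≢0 w N above below u₀ 2+U≤u₀ u₀≤z z<u₀+1
    where
    flip-≤ : ∀ s s′ η → s′ ℚ.≤ s ℚ.+ η → ℚ.- s ℚ.- η ℚ.≤ ℚ.- s′
    flip-≤ s s′ η h = subst (ℚ._≤ ℚ.- s′) (ℚ.neg-distrib-+ s η) (ℚ.neg-antimono-≤ h)
    flip-≤′ : ∀ s s′ η → s ℚ.≤ s′ ℚ.+ η → ℚ.- s′ ℚ.≤ ℚ.- s ℚ.+ η
    flip-≤′ s s′ η h = subst (ℚ._≤ ℚ.- s ℚ.+ η) (solve 2 (λ s η → :- (s :+ η) :+ η := :- s) refl s′ η)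
      (ℚ.+-monoˡ-≤ η (ℚ.neg-antimono-≤ h))
    finish : ∀ b (b≢0 : NonZero b) w N →
      (∀ n → N ℕ.≤ n → w ℚ.- _/_ (+ 1) b {{b≢0}} ℚ.≤ ℚ.- seq t n) →
      (∀ n → N ℕ.≤ n → ℚ.- seq t n ℚ.≤ w ℚ.+ _/_ (+ 1) b {{b≢0}}) →
      ∀ u₀ → 2 ℕ.+ U ℕ.≤ u₀ → ι u₀ ℚ.≤ w ℚ.* ι b → w ℚ.* ι b ℚ.< ι (suc u₀) →
      _
    -- With u = u₀ - 2, one unit 1/b below absorbs the approximation error and one makes the
    -- inequality strict. Above, w b < u + 3, and the same two units lead to u + 5.
    finish b b≢0 w N above below (suc (suc u)) (s≤s (s≤s U≤u)) u₀≤z z<u₀+1 =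
      u , b , b≢0 , U≤u
      , (η , 0<η , N , λ n n≥N → subst (seq t n ℚ.+ η ℚ.≤_) (sym (⊖-/ u b))
          (neg-shift (seq t n) η (+ u / b) (ℚ.≤-trans lower (above n n≥N))))
      , (η , 0<η , N , λ n n≥N → ℚ.≤-trans lower (above n n≥N))
      , (η , 0<η , N , λ n n≥N → ℚ.≤-trans (ℚ.+-monoˡ-≤ η (below n n≥N)) upper)
      where
      instance _ = b≢0
      open ℚ.≤-Reasoning
      η : ℚ
      η = + 1 / b
      0<η : 0ℚ ℚ.< η
      0<η = 0<1/ b
      neg-shift : ∀ s η q → q ℚ.+ η ℚ.≤ ℚ.- s → s ℚ.+ η ℚ.≤ ℚ.- q
      neg-shift s η q h = subst₂ ℚ._≤_
        (solve 3 (λ s η q → q :+ η :+ (s :- q) := s :+ η) refl s η q)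
        (solve 2 (λ s q → :- s :+ (s :- q) := :- q) refl s q)
        (ℚ.+-monoˡ-≤ (s ℚ.- q) h)
      lower : (+ u / b) ℚ.+ η ℚ.≤ w ℚ.- η
      lower = *-cancelʳ-≤ {ι b} {(+ u / b) ℚ.+ η} {w ℚ.- η} (0<ι b) (begin
        ((+ u / b) ℚ.+ η) ℚ.* ι b               ≡⟨ ℚ.*-distribʳ-+ (ι b) (+ u / b) η ⟩
        (+ u / b) ℚ.* ι b ℚ.+ η ℚ.* ι b         ≡⟨ cong₂ ℚ._+_ (/-*-cancel (+ u) b) (/-*-cancel (+ 1) b) ⟩
        ι u ℚ.+ ι 1                             ≡⟨ solve 1 (λ u → u :+ con (ι 1) := (con (ι 2) :+ u) :- con (ι 1)) refl (ι u) ⟩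
        (ι 2 ℚ.+ ι u) ℚ.- ι 1                   ≡⟨ cong (ℚ._- ι 1) (ι-+ 2 u) ⟨
        ι (2 ℕ.+ u) ℚ.- ι 1                     ≤⟨ ℚ.+-monoˡ-≤ (ℚ.- ι 1) u₀≤z ⟩
        w ℚ.* ι b ℚ.- ι 1                       ≡⟨ cong (λ o → w ℚ.* ι b ℚ.- o) (/-*-cancel (+ 1) b) ⟨
        w ℚ.* ι b ℚ.- η ℚ.* ι b                 ≡⟨ solve 3 (λ w e b → w :* b :- e :* b := (w :- e) :* b) refl w η (ι b) ⟩
        (w ℚ.- η) ℚ.* ι b                       ∎)
      upper : w ℚ.+ η ℚ.+ η ℚ.≤ + (u ℕ.+ 5) / b
      upper = *-cancelʳ-≤ {ι b} {w ℚ.+ η ℚ.+ η} {+ (u ℕ.+ 5) / b} (0<ι b) (begin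
        (w ℚ.+ η ℚ.+ η) ℚ.* ι b                 ≡⟨ solve 3 (λ w e b → (w :+ e :+ e) :* b := w :* b :+ e :* b :+ e :* b) refl w η (ι b) ⟩
        w ℚ.* ι b ℚ.+ η ℚ.* ι b ℚ.+ η ℚ.* ι b   ≡⟨ cong (λ o → w ℚ.* ι b ℚ.+ o ℚ.+ o) (/-*-cancel (+ 1) b) ⟩
        w ℚ.* ι b ℚ.+ ι 1 ℚ.+ ι 1               ≤⟨ ℚ.+-monoˡ-≤ (ι 1) (ℚ.+-monoˡ-≤ (ι 1) (ℚ.<⇒≤ z<u₀+1)) ⟩
        ι (3 ℕ.+ u) ℚ.+ ι 1 ℚ.+ ι 1             ≡⟨ cong (λ o → o ℚ.+ ι 1 ℚ.+ ι 1) (ι-+ 3 u) ⟩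
        ι 3 ℚ.+ ι u ℚ.+ ι 1 ℚ.+ ι 1             ≡⟨ solve 1 (λ u → con (ι 3) :+ u :+ con (ι 1) :+ con (ι 1) := u :+ con (ι 5)) refl (ι u) ⟩
        ι u ℚ.+ ι 5                             ≡⟨ ι-+ u 5 ⟨
        ι (u ℕ.+ 5)                             ≡⟨ /-*-cancel (+ (u ℕ.+ 5)) b ⟨
        (+ (u ℕ.+ 5) / b) ℚ.* ι b               ∎)

-- `^-ratio` with d = 1 and D = 2T + 1. The bound 2 is the factor 2 that `exponents-dominate` leaves
-- free.
ratio-near-one : ∀ T → ∃ λ D → NonZero D × (∀ .{{_ : NonZero D}} → (+ suc D / D) ^ℚ T ℚ.≤ ι 2)
ratio-near-one T = D , _ , bound
  where
  open ℚ.≤-Reasoning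
  D : ℕ
  D = suc (2 ℕ.* T)
  D-large : 2 ℕ.* (T ℕ.* 1) ℕ.≤ suc D
  D-large = ℕ.≤-trans (ℕ.≤-reflexive (cong (2 ℕ.*_) (ℕ.*-identityʳ T))) (ℕ.≤-trans (ℕ.n≤1+n _) (ℕ.n≤1+n D))
  pow≤ : suc D ℕ.^ T ℕ.≤ 2 ℕ.* D ℕ.^ T
  pow≤ = ℕ.≤-trans (ℕ.≤-reflexive (sym (ℕ.*-identityˡ (suc D ℕ.^ T)))) (^-ratio 1 T 1 D D-large)
  bound : .{{_ : NonZero D}} → (+ suc D / D) ^ℚ T ℚ.≤ ι 2
  bound = *-cancelʳ-≤ {ι (D ℕ.^ T)} {(+ suc D / D) ^ℚ T} {ι 2} (0<ι (D ℕ.^ T) {{ℕ.m^n≢0 D T}}) (begin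
    (+ suc D / D) ^ℚ T ℚ.* ι (D ℕ.^ T)        ≡⟨ cong ((+ suc D / D) ^ℚ T ℚ.*_) (ι-^ D T) ⟩
    (+ suc D / D) ^ℚ T ℚ.* ι D ^ℚ T           ≡⟨ ^ℚ-distrib-* (+ suc D / D) (ι D) T ⟨
    ((+ suc D / D) ℚ.* ι D) ^ℚ T              ≡⟨ cong (_^ℚ T) (/-*-cancel (+ suc D) D) ⟩
    ι (suc D) ^ℚ T                            ≡⟨ ι-^ (suc D) T ⟨
    ι (suc D ℕ.^ T)                           ≤⟨ ι-mono-≤ {suc D ℕ.^ T} {2 ℕ.* D ℕ.^ T} pow≤ ⟩
    ι (2 ℕ.* D ℕ.^ T)                         ≡⟨ ι-* 2 (D ℕ.^ T) ⟩
    ι 2 ℚ.* ι (D ℕ.^ T)                       ∎)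

ratio-suc : ∀ D .{{_ : NonZero D}} r → (+ suc D / D) ℚ.* r ≡ r ℚ.+ (+ 1 / D) ℚ.* r
ratio-suc D r = trans (cong (ℚ._* r) split) (trans (ℚ.*-distribʳ-+ r 1ℚ (+ 1 / D)) (cong (ℚ._+ (+ 1 / D) ℚ.* r) (ℚ.*-identityˡ r)))
  where
  scaled : (+ suc D / D) ℚ.* ι D ≡ (1ℚ ℚ.+ (+ 1 / D)) ℚ.* ι D
  scaled = begin
    (+ suc D / D) ℚ.* ι D                     ≡⟨ /-*-cancel (+ suc D) D ⟩
    ι (suc D)                                 ≡⟨ cong ι (ℕ.+-comm 1 D) ⟩
    ι (D ℕ.+ 1)                               ≡⟨ ι-+ D 1 ⟩
    ι D ℚ.+ ι 1                               ≡⟨ cong₂ ℚ._+_ (ℚ.*-identityˡ (ι D)) (/-*-cancel (+ 1) D) ⟨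
    1ℚ ℚ.* ι D ℚ.+ (+ 1 / D) ℚ.* ι D          ≡⟨ ℚ.*-distribʳ-+ (ι D) 1ℚ (+ 1 / D) ⟨
    (1ℚ ℚ.+ (+ 1 / D)) ℚ.* ι D                ∎
    where open ≡-Reasoning
  split : + suc D / D ≡ 1ℚ ℚ.+ (+ 1 / D)
  split = ℚ.≤-antisym (*-cancelʳ-≤ {ι D} {+ suc D / D} {1ℚ ℚ.+ (+ 1 / D)} (0<ι D) (ℚ.≤-reflexive scaled))
                      (*-cancelʳ-≤ {ι D} {1ℚ ℚ.+ (+ 1 / D)} {+ suc D / D} (0<ι D) (ℚ.≤-reflexive (sym scaled)))

power-bracket : ∀ l .{{_ : NonZero l}} → ∃ λ m → 3 ℕ.^ m ℕ.≤ l × l ℕ.< 3 ℕ.^ suc m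
power-bracket l = from-least (least (λ m → l ℕ.<? 3 ℕ.^ suc m) l (ℕ.<-trans (n<3^n l) (ℕ.^-monoʳ-< 3 (s≤s (s≤s z≤n)) (ℕ.n<1+n l))))
  where
  from-least : (∃ λ m → l ℕ.< 3 ℕ.^ suc m × (∀ j → j ℕ.< m → ¬ l ℕ.< 3 ℕ.^ suc j)) →
    ∃ λ m → 3 ℕ.^ m ℕ.≤ l × l ℕ.< 3 ℕ.^ suc m
  from-least (zero  , l<3  , _)   = zero , ℕ.>-nonZero⁻¹ l , l<3
  from-least (suc m , l<3ᵐ , min) = suc m , ℕ.≮⇒≥ (min m ℕ.≤-refl) , l<3ᵐ

-- With R = 3^(m+1) the right-hand side is at least R^u, which beats the
-- powers of R - 1 ≥ l once u is large.
exponents-dominate : ∀ m l .{{_ : NonZero l}} → l ℕ.< 3 ℕ.^ suc m → ∃ λ U → ∀ u → U ℕ.≤ u →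
  ∀ w → u ℕ.≤ w → w ℕ.≤ u ℕ.+ 5 → 2 ℕ.* l ℕ.^ w ℕ.< 3 ℕ.^ (u ℕ.* m ℕ.+ w)
exponents-dominate m l l<R = 2 ℕ.* r ℕ.^ 5 ℕ.* r , bound
  where
  r : ℕ
  r = ℕ.pred (3 ℕ.^ suc m)
  R≡ : suc r ≡ 3 ℕ.^ suc m
  R≡ = ℕ.suc-pred (3 ℕ.^ suc m) {{ℕ.m^n≢0 3 (suc m)}}
  bound : ∀ u → 2 ℕ.* r ℕ.^ 5 ℕ.* r ℕ.≤ u → ∀ w → u ℕ.≤ w → w ℕ.≤ u ℕ.+ 5 →
    2 ℕ.* l ℕ.^ w ℕ.< 3 ℕ.^ (u ℕ.* m ℕ.+ w)
  bound u U≤u w u≤w w≤u+5 = begin-strict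
    2 ℕ.* l ℕ.^ w                          ≤⟨ ℕ.*-monoʳ-≤ 2 (ℕ.^-monoʳ-≤ l w≤u+5) ⟩
    2 ℕ.* l ℕ.^ (u ℕ.+ 5)                  ≤⟨ ℕ.*-monoʳ-≤ 2 (ℕ.^-monoˡ-≤ (u ℕ.+ 5) l≤r) ⟩
    2 ℕ.* r ℕ.^ (u ℕ.+ 5)                  ≡⟨ cong (2 ℕ.*_) (ℕ.^-distribˡ-+-* r u 5) ⟩
    2 ℕ.* (r ℕ.^ u ℕ.* r ℕ.^ 5)            ≡⟨ regroup (r ℕ.^ u) (r ℕ.^ 5) ⟩
    2 ℕ.* r ℕ.^ 5 ℕ.* r ℕ.^ u              <⟨ pow-dominates (2 ℕ.* r ℕ.^ 5) r {{r≢0}} u U≤u ⟩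
    suc r ℕ.^ u                            ≡⟨ cong (ℕ._^ u) R≡ ⟩
    (3 ℕ.^ suc m) ℕ.^ u                    ≡⟨ ℕ.^-*-assoc 3 (suc m) u ⟩
    3 ℕ.^ (u ℕ.+ m ℕ.* u)                  ≡⟨ cong (3 ℕ.^_) (trans (ℕ.+-comm u (m ℕ.* u)) (cong (ℕ._+ u) (ℕ.*-comm m u))) ⟩
    3 ℕ.^ (u ℕ.* m ℕ.+ u)                  ≤⟨ ℕ.^-monoʳ-≤ 3 (ℕ.+-monoʳ-≤ (u ℕ.* m) u≤w) ⟩
    3 ℕ.^ (u ℕ.* m ℕ.+ w)                  ∎
    where
    open ℕ.≤-Reasoning
    l≤r : l ℕ.≤ r
    l≤r = ℕ.≤-pred (subst (l ℕ.<_) (sym R≡) l<R)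
    r≢0 : NonZero r
    r≢0 = ℕ.>-nonZero (ℕ.<-≤-trans (ℕ.>-nonZero⁻¹ l) l≤r)
    regroup : ∀ x y → 2 ℕ.* (x ℕ.* y) ≡ 2 ℕ.* y ℕ.* x
    regroup = solve-∀

-- This encodes C₃ᵐ < (3/l)^ν, with r close to C₃ and 3ᵘ rᵇ ≤ 1 saying r ≤ 3^(-u/b). After
-- multiplication by 3^(um) l^w the left side is at most κ^((m+1)b) l^w ≤ 2 l^w, and the right side
-- is 3^(um+w). Of the m + 1 factors κ, one pays for sampling without replacement and m for rounding
-- C₃ up to κ r.
power-gap : ∀ {r κ} m u b w l .{{_ : NonZero l}} → 0ℚ ℚ.≤ r → 0ℚ ℚ.≤ κ →
  ι 3 ^ℚ u ℚ.* r ^ℚ b ℚ.≤ 1ℚ → κ ^ℚ (suc m ℕ.* b) ℚ.≤ ι 2 →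
  2 ℕ.* l ℕ.^ w ℕ.< 3 ℕ.^ (u ℕ.* m ℕ.+ w) →
  ((κ ℚ.* r) ^ℚ m ℚ.* κ) ^ℚ b ℚ.< (+ 3 / l) ^ℚ w
power-gap {r} {κ} m u b w l 0≤r 0≤κ 3r≤1 κ≤2 dominated =
  *-cancelʳ-< {scale} {G} {a ^ℚ w} (0≤* (0≤^ℚ (0≤^ℚ (0≤ι 3) u) m) (0≤^ℚ (0≤ι l) w)) (begin-strict
    G ℚ.* (t ^ℚ m ℚ.* ι l ^ℚ w)
      ≡⟨ cong (ℚ._* scale) G≡ ⟩
    κ ^ℚ (suc m ℕ.* b) ℚ.* (r ^ℚ b) ^ℚ m ℚ.* (t ^ℚ m ℚ.* ι l ^ℚ w)
      ≡⟨ solve 4 (λ k r t l → k :* r :* (t :* l) := k :* (t :* r) :* l) refl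
               (κ ^ℚ (suc m ℕ.* b)) ((r ^ℚ b) ^ℚ m) (t ^ℚ m) (ι l ^ℚ w) ⟩
    κ ^ℚ (suc m ℕ.* b) ℚ.* (t ^ℚ m ℚ.* (r ^ℚ b) ^ℚ m) ℚ.* ι l ^ℚ w
      ≤⟨ *-monoʳ-≤ {ι l ^ℚ w} (0≤^ℚ (0≤ι l) w) (*-mono-≤ {κ ^ℚ (suc m ℕ.* b)} {ι 2} {t ^ℚ m ℚ.* (r ^ℚ b) ^ℚ m} {1ℚ}
           (0≤* (0≤^ℚ (0≤^ℚ (0≤ι 3) u) m) (0≤^ℚ (0≤^ℚ 0≤r b) m)) (0≤ι 2) κ≤2 tr≤1) ⟩
    ι 2 ℚ.* 1ℚ ℚ.* ι l ^ℚ w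
      ≡⟨ cong (ℚ._* ι l ^ℚ w) (ℚ.*-identityʳ (ι 2)) ⟩
    ι 2 ℚ.* ι l ^ℚ w
      ≡⟨ cong (ι 2 ℚ.*_) (ι-^ l w) ⟨
    ι 2 ℚ.* ι (l ℕ.^ w)
      ≡⟨ ι-* 2 (l ℕ.^ w) ⟨
    ι (2 ℕ.* l ℕ.^ w)
      <⟨ ι-mono-< {2 ℕ.* l ℕ.^ w} {3 ℕ.^ (u ℕ.* m ℕ.+ w)} dominated ⟩
    ι (3 ℕ.^ (u ℕ.* m ℕ.+ w))
      ≡⟨ ι-^ 3 (u ℕ.* m ℕ.+ w) ⟩
    ι 3 ^ℚ (u ℕ.* m ℕ.+ w)
      ≡⟨ ^ℚ-+ (ι 3) (u ℕ.* m) w ⟩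
    ι 3 ^ℚ (u ℕ.* m) ℚ.* ι 3 ^ℚ w
      ≡⟨ cong₂ ℚ._*_ (^ℚ-* (ι 3) u m) (trans (sym (^ℚ-distrib-* a (ι l) w)) (cong (_^ℚ w) (/-*-cancel (+ 3) l))) ⟨
    t ^ℚ m ℚ.* (a ^ℚ w ℚ.* ι l ^ℚ w)
      ≡⟨ solve 3 (λ t a l → t :* (a :* l) := a :* (t :* l)) refl (t ^ℚ m) (a ^ℚ w) (ι l ^ℚ w) ⟩
    a ^ℚ w ℚ.* (t ^ℚ m ℚ.* ι l ^ℚ w) ∎)
  where
  open ℚ.≤-Reasoning
  a t G scale : ℚ
  a = + 3 / l
  t = ι 3 ^ℚ u
  G = ((κ ℚ.* r) ^ℚ m ℚ.* κ) ^ℚ b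
  scale = t ^ℚ m ℚ.* ι l ^ℚ w
  1^ℚ : ∀ m → 1ℚ ^ℚ m ≡ 1ℚ
  1^ℚ zero    = refl
  1^ℚ (suc m) = trans (ℚ.*-identityˡ (1ℚ ^ℚ m)) (1^ℚ m)
  tr≤1 : t ^ℚ m ℚ.* (r ^ℚ b) ^ℚ m ℚ.≤ 1ℚ
  tr≤1 = subst₂ ℚ._≤_ (^ℚ-distrib-* t (r ^ℚ b) m) (1^ℚ m)
    (^ℚ-mono-≤ (0≤* (0≤^ℚ (0≤ι 3) u) (0≤^ℚ 0≤r b)) 3r≤1 m)
  G≡ : G ≡ κ ^ℚ (suc m ℕ.* b) ℚ.* (r ^ℚ b) ^ℚ m
  G≡ = begin-equality
    ((κ ℚ.* r) ^ℚ m ℚ.* κ) ^ℚ b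
      ≡⟨ cong (λ z → (z ℚ.* κ) ^ℚ b) (^ℚ-distrib-* κ r m) ⟩
    (κ ^ℚ m ℚ.* r ^ℚ m ℚ.* κ) ^ℚ b
      ≡⟨ cong (_^ℚ b) (solve 3 (λ k r x → k :* r :* x := x :* k :* r) refl (κ ^ℚ m) (r ^ℚ m) κ) ⟩
    (κ ^ℚ suc m ℚ.* r ^ℚ m) ^ℚ b
      ≡⟨ ^ℚ-distrib-* (κ ^ℚ suc m) (r ^ℚ m) b ⟩
    (κ ^ℚ suc m) ^ℚ b ℚ.* (r ^ℚ m) ^ℚ b
      ≡⟨ cong₂ ℚ._*_ (^ℚ-* κ (suc m) b)
           (trans (^ℚ-* r m b) (trans (cong (r ^ℚ_) (ℕ.*-comm m b)) (sym (^ℚ-* r b m)))) ⟩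
    κ ^ℚ (suc m ℕ.* b) ℚ.* (r ^ℚ b) ^ℚ m ∎

-- A b-th root is taken by contradiction: y < g would give yᵇ ≤ gᵇ < q. The gap between gᵇ and q
-- absorbs the ε of the real inequality, and positivity of y makes powers monotone.
eventually-≥ : ∀ y b {g q} → fromℕ 0 <ᴿ y → g ^ℚ b ℚ.< q →
  (∀ ε → 0ℚ ℚ.< ε → ∃ λ N → ∀ n → N ℕ.≤ n → q ℚ.≤ seq y n ^ℚ b ℚ.+ ε) →
  ∃ λ N → ∀ n → N ℕ.≤ n → g ℚ.≤ seq y n
eventually-≥ y b {g} {q} 0<y gᵇ<q q≤ =
  let m , gᵇ<m , m<q = ℚ.<-dense gᵇ<q
      e , 0<e , N₁ , e≤y = positive-bound y 0<y
      0<q-m = subst (ℚ._< q ℚ.- m) (ℚ.+-inverseʳ m) (ℚ.+-monoˡ-< (ℚ.- m) m<q)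
      N₂ , bound = q≤ (q ℚ.- m) 0<q-m
  in N₁ ℕ.⊔ N₂ , λ n n≥N → ℚ.≮⇒≥ λ y<g →
    ℚ.<-irrefl {q} refl (ℚ.≤-<-trans (bound n (ℕ.m⊔n≤o⇒n≤o N₁ N₂ n≥N))
      (subst (seq y n ^ℚ b ℚ.+ (q ℚ.- m) ℚ.<_) (solve 2 (λ m q → m :+ (q :- m) := q) refl m q)
        (ℚ.+-monoˡ-< (q ℚ.- m) (ℚ.≤-<-trans
          (^ℚ-mono-≤ (ℚ.≤-trans (ℚ.<⇒≤ 0<e) (e≤y n (ℕ.m⊔n≤o⇒m≤o N₁ N₂ n≥N))) (ℚ.<⇒≤ y<g) b) gᵇ<m))))

-- The fractions u/b < ν < (u + 5)/b turn x = 3^(-ν) and y = a^ν into inequalities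
-- between natural powers; which fraction is used for y depends on whether a ≥ 1.
log-upper-bound : ∀ x t u b {r N} .{{_ : NonZero b}} → IsLog (fromℕ 3) x t → t <ᴿ fromℚ ((0 ⊖ u) / b) →
  0ℚ ℚ.≤ r → (∀ i → N ℕ.≤ i → r ℚ.≤ seq x i) → ι 3 ^ℚ u ℚ.* r ^ℚ b ℚ.≤ 1ℚ
log-upper-bound x t u b {r} {N} t-log t< 0≤r r≤x = ≤-by-ε λ ε 0<ε →
  let M , bound = proj₁ (IsPower.below t-log 0 u b t<) 1≤3 ε 0<ε
      n = N ℕ.⊔ M
  in ℚ.≤-trans
       (*-monoˡ-≤ {ι 3 ^ℚ u} {r ^ℚ b} {seq x n ^ℚ b} (0≤^ℚ (0≤ι 3) u) (^ℚ-mono-≤ 0≤r (r≤x n (ℕ.m≤m⊔n N M)) b))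
       (subst (ℚ._≤ 1ℚ ℚ.+ ε) (IsPower-seq (fromℕ 3) u b x n) (bound n (ℕ.m≤n⊔m N M)))

power-lower-bound : ∀ a ν y u v b .{{_ : NonZero b}} → u ℕ.≤ v → IsPower (fromℚ a) ν y →
  fromℚ ((u ⊖ 0) / b) <ᴿ ν → ν <ᴿ fromℚ ((v ⊖ 0) / b) →
  ∃ λ w → u ℕ.≤ w × w ℕ.≤ v ×
    (∀ ε → 0ℚ ℚ.< ε → ∃ λ N → ∀ n → N ℕ.≤ n → a ^ℚ w ℚ.≤ seq y n ^ℚ b ℚ.+ ε)
power-lower-bound a ν y u v b u≤v pow u<ν ν<v = by-total (ℚ.≤-total 1ℚ a)
  where
  at : ∀ w → fromℚ a ^ᴿ w ≤ᴿ fromℚ a ^ᴿ 0 *ᴿ y ^ᴿ b →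
    ∀ ε → 0ℚ ℚ.< ε → ∃ λ N → ∀ n → N ℕ.≤ n → a ^ℚ w ℚ.≤ seq y n ^ℚ b ℚ.+ ε
  at w h ε 0<ε = let N , bound = h ε 0<ε in N , λ n n≥N →
    subst₂ (λ p q → p ℚ.≤ q ℚ.+ ε) (seq-^ᴿ (fromℚ a) w n)
      (trans (IsPower-seq (fromℚ a) 0 b y n) (ℚ.*-identityˡ (seq y n ^ℚ b))) (bound n n≥N)
  -- The base is rational, so this case distinction is available. For a ≤ 1 the power decreases in
  -- the exponent, and the upper fraction yields the lower bound.
  by-total : 1ℚ ℚ.≤ a ⊎ a ℚ.≤ 1ℚ → _
  by-total (inj₁ 1≤a) = u , ℕ.≤-refl , u≤v , at u (proj₁ (IsPower.above pow u 0 b u<ν) (fromℚ-≤ {1ℚ} {a} 1≤a))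
  by-total (inj₂ a≤1) = v , u≤v , ℕ.≤-refl , at v (proj₂ (IsPower.below pow v 0 b ν<v) (fromℚ-≤ {a} {1ℚ} a≤1))

-- Strict comparison of C₃ᵐ with the power of 3/ℓ₀

0<⊓ : ∀ {p q} → 0ℚ ℚ.< p → 0ℚ ℚ.< q → 0ℚ ℚ.< p ℚ.⊓ q
0<⊓ {p} {q} 0<p 0<q with ℚ.≤-total p q
... | inj₁ p≤q = subst (0ℚ ℚ.<_) (sym (ℚ.p≤q⇒p⊓q≡p p≤q)) 0<p
... | inj₂ q≤p = subst (0ℚ ℚ.<_) (sym (ℚ.p≥q⇒p⊓q≡q q≤p)) 0<q

0</ : ∀ D .{{_ : NonZero D}} → 0ℚ ℚ.< + suc D / D
0</ D = *-cancelʳ-< {ι D} {0ℚ} {+ suc D / D} (0≤ι D)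
  (subst₂ ℚ._<_ (sym (ℚ.*-zeroˡ (ι D))) (sym (/-*-cancel (+ suc D) D)) (0<ι (suc D)))

⊓-≤ : ∀ c₀ {q κ s} m → 0ℚ ℚ.< c₀ → 0ℚ ℚ.< q → 0ℚ ℚ.≤ κ → q ^ℚ m ℚ.* κ ℚ.≤ s → (c₀ ℚ.⊓ q) ^ℚ m ℚ.* κ ℚ.≤ s
⊓-≤ c₀ {q} {κ} m 0<c₀ 0<q 0≤κ bound = ℚ.≤-trans
  (*-monoʳ-≤ {κ} {(c₀ ℚ.⊓ q) ^ℚ m} {q ^ℚ m} 0≤κ
    (^ℚ-mono-≤ {c₀ ℚ.⊓ q} {q} (ℚ.<⇒≤ (0<⊓ {c₀} {q} 0<c₀ 0<q)) (ℚ.p⊓q≤q c₀ q) m)) bound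

-- The strict inequality C₃ᵐ < y in the form that `subsetSumProb-≤ᴿ` consumes, with room for
-- rounding C₃ up and for the sampling factor.
ContractionPower≤ : ℝ → ℝ → ℕ → Set
ContractionPower≤ C₃ y m =
  ∃ λ c → 0ℚ ℚ.< c × c ℚ.≤ 1ℚ × ∃ λ N₀ → (∀ i → N₀ ℕ.≤ i → seq C₃ i ℚ.≤ c) ×
  ∃ λ D → Σ (NonZero D) λ D≢0 → ∃ λ N₁ → ∀ i → N₁ ℕ.≤ i → c ^ℚ m ℚ.* _/_ (+ suc D) D {{D≢0}} ℚ.≤ seq y i

-- The close bound κ r of C₃ may exceed 1, whereas the iteration needs c ≤ 1; the minimum with some
-- rational bound c₀ < 1 has both properties.
close-rational : ∀ C₃ → C₃ <ᴿ fromℕ 1 → fromℕ 0 <ᴿ C₃ → ∀ y m D (D≢0 : NonZero D) → let κ = _/_ (+ suc D) D {{D≢0}} in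
  ∀ r N₁ N₃ → 0ℚ ℚ.< r →
  (∀ i → N₁ ℕ.≤ i → seq C₃ i ℚ.≤ κ ℚ.* r) →
  (∀ i → N₃ ℕ.≤ i → (κ ℚ.* r) ^ℚ m ℚ.* κ ℚ.≤ seq y i) → ContractionPower≤ C₃ y m
close-rational C₃ C₃<1 0<C₃ y m D D≢0 r N₁ N₃ 0<r C₃≤ g≤y = from-bound (rational-bound C₃ 0<C₃ C₃<1)
  where
  instance _ = D≢0
  κ : ℚ
  κ = + suc D / D
  0<κr : 0ℚ ℚ.< κ ℚ.* r
  0<κr = 0<* {κ} {r} (0</ D) 0<r
  from-bound : (∃ λ c → 0ℚ ℚ.< c × c ℚ.< 1ℚ × ∃ λ N → ∀ n → N ℕ.≤ n → seq C₃ n ℚ.≤ c) → ContractionPower≤ C₃ y m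
  from-bound (c₀ , 0<c₀ , c₀<1 , N₂ , C₃≤c₀) =
    c₀ ℚ.⊓ (κ ℚ.* r) , 0<⊓ {c₀} {κ ℚ.* r} 0<c₀ 0<κr
    , ℚ.≤-trans (ℚ.p⊓q≤p c₀ (κ ℚ.* r)) (ℚ.<⇒≤ c₀<1)
    , N₁ ℕ.⊔ N₂
    , (λ i i≥ → ℚ.⊓-glb {seq C₃ i} {c₀} {κ ℚ.* r} (C₃≤c₀ i (ℕ.m⊔n≤o⇒n≤o N₁ N₂ i≥)) (C₃≤ i (ℕ.m⊔n≤o⇒m≤o N₁ N₂ i≥)))
    , D , D≢0 , N₃
    , λ i i≥ → ⊓-≤ c₀ {κ ℚ.* r} {κ} {seq y i} m 0<c₀ 0<κr (ℚ.<⇒≤ (0</ D)) (g≤y i i≥)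

-- The order of choices matters: U depends on m and l, then u and b bracket ν, then D is adapted to
-- b so that κ^((m+1)b) ≤ 2, and only then is C₃ approximated within the factor κ.
contraction-power-≤ : ∀ C₃ → fromℕ 0 <ᴿ C₃ → C₃ <ᴿ fromℕ 1 → ∀ t → IsLog (fromℕ 3) C₃ t →
  ∀ l .{{_ : NonZero l}} y → IsPower (fromℚ (+ 3 / l)) (-ᴿ t) y →
  ∀ m → l ℕ.< 3 ℕ.^ suc m → ContractionPower≤ C₃ y m
contraction-power-≤ C₃ 0<C₃ C₃<1 t t-log l y y-pow m l< =
  let e , 0<e , N₀ , t≤-e = log-negative C₃ t 0<C₃ C₃<1 t-log
      U , dominated = exponents-dominate m l l<
      u , b , b≢0 , U≤u , t< , u<ν , ν<v = rational-bracket t {e} {N₀} 0<e t≤-e U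
      w , u≤w , w≤v , a≤y = power-lower-bound (+ 3 / l) (-ᴿ t) y u (u ℕ.+ 5) b {{b≢0}} (ℕ.m≤m+n u 5) y-pow u<ν ν<v
      D , D≢0 , κ≤2 = ratio-near-one (suc m ℕ.* b)
  in with-exponents u b b≢0 t< w (dominated u U≤u w u≤w w≤v) a≤y D D≢0 (κ≤2 {{D≢0}})
  where
  with-exponents : ∀ u b (b≢0 : NonZero b) → t <ᴿ fromℚ (_/_ (0 ⊖ u) b {{b≢0}}) →
    ∀ w → 2 ℕ.* l ℕ.^ w ℕ.< 3 ℕ.^ (u ℕ.* m ℕ.+ w) →
    (∀ ε → 0ℚ ℚ.< ε → ∃ λ N → ∀ n → N ℕ.≤ n → (+ 3 / l) ^ℚ w ℚ.≤ seq y n ^ℚ b ℚ.+ ε) →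
    ∀ D (D≢0 : NonZero D) → _/_ (+ suc D) D {{D≢0}} ^ℚ (suc m ℕ.* b) ℚ.≤ ι 2 → ContractionPower≤ C₃ y m
  with-exponents u b b≢0 t< w dominated a≤y D D≢0 κ≤2 =
    from-approximation (relative-approximation C₃ 0<C₃ (+ 1 / D) (0<1/ D))
    where
    instance
      _ = b≢0
      _ = D≢0
    κ : ℚ
    κ = + suc D / D
    from-approximation : (∃ λ r → 0ℚ ℚ.< r × ∃ λ N → ∀ n → N ℕ.≤ n →
      r ℚ.≤ seq C₃ n × seq C₃ n ℚ.≤ r ℚ.+ (+ 1 / D) ℚ.* r) → ContractionPower≤ C₃ y m
    from-approximation (r , 0<r , N₁ , approx) =
      let 3r≤1 = log-upper-bound C₃ t u b {r} {N₁} t-log t< (ℚ.<⇒≤ 0<r) (λ i i≥N₁ → proj₁ (approx i i≥N₁))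
          N₃ , g≤y = eventually-≥ y b {(κ ℚ.* r) ^ℚ m ℚ.* κ} {(+ 3 / l) ^ℚ w} (IsPower.value-positive y-pow)
            (power-gap {r} {κ} m u b w l (ℚ.<⇒≤ 0<r) (ℚ.<⇒≤ (0</ D)) 3r≤1 κ≤2 dominated) a≤y
      in close-rational C₃ C₃<1 0<C₃ y m D D≢0 r N₁ N₃ 0<r
           (λ i i≥N₁ → subst (seq C₃ i ℚ.≤_) (sym (ratio-suc D r)) (proj₂ (approx i i≥N₁))) g≤y

-- The bound for ε given by a power of 3/ℓ₀

-- Once n ≥ K the product n cᵐ is at least 1, so n ≤ n² cᵐ < p cᵐ ≤ p cʲ. This is the use of p > n².
larger-prime : ∀ {c K m} n p → 0ℚ ℚ.< c → c ℚ.≤ 1ℚ → ι 1 ℚ.≤ ι K ℚ.* c ^ℚ m → K ℕ.≤ n → n ℕ.^ 2 ℕ.< p →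
  ∀ j → j ℕ.< m → ι n ℚ.< ι p ℚ.* c ^ℚ j
larger-prime {c} {K} {m} n p 0<c c≤1 1≤Kcᵐ K≤n n²<p j j<m = begin-strict
  ι n                          ≡⟨ ℚ.*-identityʳ (ι n) ⟨
  ι n ℚ.* ι 1                  ≤⟨ *-monoˡ-≤ {ι n} {ι 1} {ι n ℚ.* c ^ℚ m} (0≤ι n) (ℚ.≤-trans 1≤Kcᵐ
                                    (*-monoʳ-≤ {c ^ℚ m} {ι K} {ι n} (ℚ.<⇒≤ (^ℚ-pos 0<c m)) (ι-mono-≤ {K} {n} K≤n))) ⟩
  ι n ℚ.* (ι n ℚ.* c ^ℚ m)     ≡⟨ ℚ.*-assoc (ι n) (ι n) (c ^ℚ m) ⟨
  ι n ℚ.* ι n ℚ.* c ^ℚ m       ≡⟨ cong (ℚ._* c ^ℚ m) (trans (sym (ι-* n n)) (cong (λ k → ι (n ℕ.* k)) (sym (ℕ.*-identityʳ n)))) ⟩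
  ι (n ℕ.^ 2) ℚ.* c ^ℚ m       <⟨ *-monoʳ-< {c ^ℚ m} {ι (n ℕ.^ 2)} {ι p} (^ℚ-pos 0<c m) (ι-mono-< {n ℕ.^ 2} {p} n²<p) ⟩
  ι p ℚ.* c ^ℚ m               ≤⟨ *-monoˡ-≤ {ι p} (0≤ι p) (^ℚ-anti-≤ 0<c c≤1 (ℕ.<⇒≤ j<m)) ⟩
  ι p ℚ.* c ^ℚ j               ∎
  where open ℚ.≤-Reasoning

power-ε : ∀ C₃ → fromℕ 0 <ᴿ C₃ → C₃ <ᴿ fromℕ 1 → ThreefoldContraction C₃ →
  ∀ t → IsLog (fromℕ 3) C₃ t → ∀ ℓ₀ .{{_ : NonZero ℓ₀}} y → IsPower (fromℚ (+ 3 / ℓ₀)) (-ᴿ t) y →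
  ∃ λ N → ∀ n ℓ .{{_ : NonZero n}} → N ℕ.≤ n → ℓ₀ ℕ.< ℓ → ℓ ℕ.+ ℓ₀ ℕ.< n →
  ∀ p .{{_ : NonZero p}} → Prime p → n ℕ.^ 2 ℕ.< p →
  ∀ (A : Subset p) → ∣ A ∣ ≡ n → ∀ x → subsetSumProb A ℓ x ≤ᴿ (fromℕ 2 *ᴿ y) /ᴿ n
power-ε C₃ 0<C₃ C₃<1 contraction t t-log ℓ₀ y y-pow =
  -- The lower bound 3ᵐ ≤ ℓ₀ leaves enough elements both inside and outside the subset; the strict
  -- upper bound ℓ₀ < 3ᵐ⁺¹ supplies the slack in ε.
  let m , 3ᵐ≤ℓ₀ , ℓ₀< = power-bracket ℓ₀
      c , 0<c , c≤1 , N₀ , C₃≤c , D , D≢0 , N₁ , bound≤y =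
        contraction-power-≤ C₃ 0<C₃ C₃<1 t t-log ℓ₀ y y-pow m ℓ₀<
      K , _ , 1≤Kcᵐ = archimedean {c ^ℚ m} (^ℚ-pos 0<c m) 1
      L = 2 ℕ.* (suc D ℕ.* (3 ℕ.^ m ℕ.* 3 ℕ.^ m))
      N = 3 ℕ.⊔ (K ℕ.⊔ L)
  in N , λ n ℓ n≥N ℓ₀<ℓ ℓ+ℓ₀<n p p-prime n²<p A ∣A∣≡n x →
    let K⊔L≤n = ℕ.m⊔n≤o⇒n≤o 3 (K ℕ.⊔ L) n≥N in
    subsetSumProb-≤ᴿ {C₃} {c} {N₀} contraction C₃≤c 0<c c≤1 (fromℕ 2 *ᴿ y) {N₁} m D {{D≢0}}
      (λ i i≥N₁ → subst (c ^ℚ m ℚ.* _/_ (+ suc D) D {{D≢0}} ℚ.* ι 2 ℚ.≤_) (ℚ.*-comm (seq y i) (ι 2))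
        (*-monoʳ-≤ {ι 2} {c ^ℚ m ℚ.* _/_ (+ suc D) D {{D≢0}}} {seq y i} (0≤ι 2) (bound≤y i i≥N₁)))
      n ℓ (ℕ.m⊔n≤o⇒m≤o 3 (K ℕ.⊔ L) n≥N) (ℕ.m⊔n≤o⇒n≤o K L K⊔L≤n)
      (ℕ.≤-trans 3ᵐ≤ℓ₀ (ℕ.<⇒≤ ℓ₀<ℓ)) (ℕ.≤-trans (ℕ.+-monoʳ-≤ ℓ 3ᵐ≤ℓ₀) (ℕ.<⇒≤ ℓ+ℓ₀<n))
      p p-prime
      (larger-prime {c} {K} {m} n p 0<c c≤1 1≤Kcᵐ (ℕ.m⊔n≤o⇒m≤o K L K⊔L≤n) n²<p)
      A ∣A∣≡n x

theorem4p3 : ∀ (C₃ : ℝ) → fromℕ 0 <ᴿ C₃ → C₃ <ᴿ fromℕ 1 → ThreefoldContraction C₃ →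
    (∀ (ε : ℝ) → fromℕ 0 <ᴿ ε →
    ∃ λ (N : ℕ) →
    ∀ (n ℓ : ℕ) .{{_ : NonZero n}} .{{_ : NonZero ℓ}} →
    N ≤ n → N ≤ ℓ → ℓ + N ≤ n →
    ∀ (p : ℕ) .{{_ : NonZero p}} → Prime p → fromℕ (4 * n) <ᴿ fromℕ p *ᴿ ε →
    ∀ (A : Subset p) → ∣ A ∣ ≡ n →
    ∀ x → subsetSumProb A ℓ x ≤ᴿ ε /ᴿ n)
    ×
    (∀ (log₃C₃ : ℝ) → IsLog (fromℕ 3) C₃ log₃C₃ →
    let ν = -ᴿ log₃C₃ in
    ∀ (ℓ₀ : ℕ) .{{_ : NonZero ℓ₀}} →
    ∀ (y : ℝ) → IsPower (fromℚ (+ 3 / ℓ₀)) ν y →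
    let ε = fromℕ 2 *ᴿ y in
    ∃ λ (N : ℕ) →
    ∀ (n ℓ : ℕ) .{{_ : NonZero n}} → N ≤ n → ℓ₀ < ℓ → ℓ + ℓ₀ < n →
    ∀ (p : ℕ) .{{_ : NonZero p}} → Prime p → n ^ 2 < p →
    ∀ (A : Subset p) → ∣ A ∣ ≡ n →
    ∀ x → subsetSumProb A ℓ x ≤ᴿ ε /ᴿ n)
theorem4p3 C₃ 0<C₃ C₃<1 contraction =
  (λ ε 0<ε → let N , bound = fixed-ε C₃ 0<C₃ C₃<1 contraction ε 0<ε in N , λ n ℓ → bound n ℓ) ,
  power-ε C₃ 0<C₃ C₃<1 contraction
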